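{- Let $t\geq 1$ and $r\geq 2$ be integers, let $a_{1}\geq a_{2}\geq\cdots\geq a_{t}\geq 3$ and $\ell_{1}\geq \ell_{2}\geq\cdots\geq \ell_{r}\geq 2$ be integers, and let $F=\left(\bigcup_{1\leq i\leq t}K_{1,a_{i}}\right)\cup \left(\bigcup_{1\leq j\leq r}P_{\ell_{j}}\right)$ (disjoint union). Set $b=\sum_{1\leq j\leq r}\left\lfloor\frac{\ell_{j}}{2}\right\rfloor$. Then for all sufficiently large $n$ (i.e. for all $n\geq n_0$ for some $n_0$ depending only on $F$), each graph in $\mathrm{EX}(n,F)$ is (up to isomorphism) either a graph in $\mathrm{EX}\left(n,\bigcup_{1\leq i\leq t}K_{1,a_{i}}\right)$, or one of the following graphs: (i) the graph obtained from $K_{t+b-1}\vee\overline{K_{n-t-b+1}}$ by adding a maximum matching in the part $\overline{K_{n-t-b+1}}$ (that is, $\lfloor (n-t-b+1)/2\rfloor$ pairwise disjoint edges), when $\ell_{j}=3$ for every $1\leq j\leq r$; (ii) $K_{t+b-1}\vee\left(K_{2}\cup \overline{K_{n-t-b-1}}\right)$, when all $\ell_{j}$ are odd and at least one of them is not $3$; (iii) $K_{t+b-1}\vee\overline{K_{n-t-b+1}}$, when at least one of the $\ell_{j}$ with $1\leq j\leq r$ is even.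
   Context: All graphs are finite, undirected and simple. $K_n$ and $P_n$ denote the complete graph and the path on $n$ vertices; $K_{1,d}$ is the star on $d+1$ vertices; $\overline{G}$ is the complement of $G$ (so $\overline{K_m}$ is the edgeless graph on $m$ vertices). $G_1\cup G_2$ denotes the disjoint union, and $G_1\vee G_2$ denotes the join, obtained from the disjoint union by connecting each vertex of $G_1$ to each vertex of $G_2$. A graph $G$ is $F$-free if it does not contain $F$ as a (not necessarily induced) subgraph. $\mathrm{EX}(n,F)$ denotes the set of $F$-free graphs of order $n$ with the maximum number of edges; its members are called the extremal graphs of order $n$ for $F$. -}

module Defs where

import Algebra.Definitions.RawMonoid
open import Data.Bool using (Bool; true; false; not; T; T?; _∧_)
open import Data.Bool.Properties using (∧-zeroʳ)
open import Data.Fin using (Fin; zero; suc; toℕ; splitAt)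
import Data.Fin as Fin
open import Data.List using (List; length; filter; allFin; cartesianProduct)
open import Data.Nat using (ℕ; zero; suc; _+_; _≤_; _≡ᵇ_; ∣_-_∣; +-0-rawMonoid)
open import Data.Nat.Properties using (∣-∣-comm; ∣n-n∣≡0)
open import Data.Product using (_×_; _,_; Σ-syntax)
open import Data.Sum using (_⊎_; inj₁; inj₂)
open import Data.Vec.Functional using (Vector)
open import Function using (_∘_; _↔_; Inverse; Injective)
open import Relation.Binary.PropositionalEquality using (_≡_; refl; sym; cong; cong₂; trans)
open import Relation.Nullary using (¬_; does; yes; no)
open import Relation.Nullary.Decidable using (_×-dec_; dec-true)
open import Relation.Nullary.Negation using (contradiction)

open Algebra.Definitions.RawMonoid +-0-rawMonoid public using (sum)

record Graph (n : ℕ) : Set where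
  field
    adj        : Fin n → Fin n → Bool
    adj-sym    : ∀ u v → adj u v ≡ adj v u
    adj-irrefl : ∀ v → adj v v ≡ false

  Adjacent : Fin n → Fin n → Set
  Adjacent u v = T (adj u v)

open Graph public

-- Each edge is listed once, with its smaller endpoint first.
edges : ∀ {n} → Graph n → List (Fin n × Fin n)
edges {n} G =
  filter (λ (u , v) → (u Fin.<? v) ×-dec T? (adj G u v))
         (cartesianProduct (allFin n) (allFin n))

e : ∀ {n} → Graph n → ℕ
e G = length (edges G)

-- F ⊑ G : G contains F as a (not necessarily induced) subgraph.
infix 4 _⊑_ _≅_

_⊑_ : ∀ {m n} → Graph m → Graph n → Set
_⊑_ {m} {n} F G =
  Σ[ f ∈ (Fin m → Fin n) ]
    Injective _≡_ _≡_ f × (∀ u v → Adjacent F u v → Adjacent G (f u) (f v))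

_≅_ : ∀ {m n} → Graph m → Graph n → Set
_≅_ {m} {n} G H =
  Σ[ φ ∈ (Fin m ↔ Fin n) ]
    (∀ u v → adj G u v ≡ adj H (Inverse.to φ u) (Inverse.to φ v))

Free : ∀ {m n} → Graph m → Graph n → Set
Free F G = ¬ (F ⊑ G)

-- EX n F G : the graph G belongs to EX(n, F).
EX : ∀ {m} (n : ℕ) → Graph m → Graph n → Set
EX n F G = Free F G × (∀ (H : Graph n) → Free F H → e H ≤ e G)

≟-comm : ∀ {n} (u v : Fin n) → does (u Fin.≟ v) ≡ does (v Fin.≟ u)
≟-comm u v with u Fin.≟ v
... | yes u≡v = sym (dec-true (v Fin.≟ u) (sym u≡v))
... | no  u≢v with v Fin.≟ u
...   | yes v≡u = contradiction (sym v≡u) u≢v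
...   | no  _   = refl

K : ∀ n → Graph n
K n = record
  { adj        = λ u v → not (does (u Fin.≟ v))
  ; adj-sym    = λ u v → cong not (≟-comm u v)
  ; adj-irrefl = λ v → cong not (dec-true (v Fin.≟ v) refl)
  }

complement : ∀ {n} → Graph n → Graph n
complement G = record
  { adj        = λ u v → not (adj G u v) ∧ not (does (u Fin.≟ v))
  ; adj-sym    = λ u v → cong₂ _∧_ (cong not (adj-sym G u v)) (cong not (≟-comm u v))
  ; adj-irrefl = λ v → trans (cong (λ b → not (adj G v v) ∧ not b) (dec-true (v Fin.≟ v) refl))
                             (∧-zeroʳ (not (adj G v v)))
  }

K̄ : ∀ n → Graph n
K̄ n = complement (K n)

P : ∀ n → Graph n
P n = record
  { adj        = λ u v → ∣ toℕ u - toℕ v ∣ ≡ᵇ 1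
  ; adj-sym    = λ u v → cong (_≡ᵇ 1) (∣-∣-comm (toℕ u) (toℕ v))
  ; adj-irrefl = λ v → cong (_≡ᵇ 1) (∣n-n∣≡0 (toℕ v))
  }

-- The first m vertices of the result carry G and the last n carry H; the
-- Boolean says whether the vertices of G are adjacent to those of H.
juxtapose : ∀ {m n} → Bool → Graph m → Graph n → Graph (m + n)
juxtapose {m} {n} c G H = record
  { adj        = λ u v → adj′ (splitAt m u) (splitAt m v)
  ; adj-sym    = λ u v → adj′-sym (splitAt m u) (splitAt m v)
  ; adj-irrefl = λ v → adj′-irrefl (splitAt m v)
  }
  where
  adj′ : Fin m ⊎ Fin n → Fin m ⊎ Fin n → Bool
  adj′ (inj₁ u) (inj₁ v) = adj G u v
  adj′ (inj₂ u) (inj₂ v) = adj H u v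
  adj′ (inj₁ _) (inj₂ _) = c
  adj′ (inj₂ _) (inj₁ _) = c

  adj′-sym : ∀ u v → adj′ u v ≡ adj′ v u
  adj′-sym (inj₁ u) (inj₁ v) = adj-sym G u v
  adj′-sym (inj₂ u) (inj₂ v) = adj-sym H u v
  adj′-sym (inj₁ _) (inj₂ _) = refl
  adj′-sym (inj₂ _) (inj₁ _) = refl

  adj′-irrefl : ∀ v → adj′ v v ≡ false
  adj′-irrefl (inj₁ v) = adj-irrefl G v
  adj′-irrefl (inj₂ v) = adj-irrefl H v

infixr 6 _∪_
infixr 5 _∨_

_∪_ : ∀ {m n} → Graph m → Graph n → Graph (m + n)
_∪_ = juxtapose false

_∨_ : ∀ {m n} → Graph m → Graph n → Graph (m + n)
_∨_ = juxtapose true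

⋃ : ∀ {k} {m : Vector ℕ k} → (∀ i → Graph (m i)) → Graph (sum m)
⋃ {zero}  G = K 0
⋃ {suc k} G = G zero ∪ ⋃ (λ i → G (suc i))

-- K_{1,d}, as the complete bipartite graph with parts of sizes 1 and d.
star : ∀ d → Graph (1 + d)
star d = K 1 ∨ K̄ d

-- K̄ n with a maximum matching added: ⌊n/2⌋ disjoint edges, together with one
-- isolated vertex if n is odd.
matching : ∀ n → Graph n
matching 0             = K̄ 0
matching 1             = K̄ 1
matching (suc (suc n)) = K 2 ∪ matching n

{-# OPTIONS --safe #-}

-- Let G be F-free with the maximum number of edges, n vertices and a copy of S.
-- If fewer than t vertices have large degree, deleting them and the copy of S
-- costs too few edges, and the rest contains the linear forest L. Otherwise the
-- deletion of t vertices of large degree leaves an L-free graph, since stars can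
-- be added greedily; comparing with the extremal graph it suffices to show that
-- an L-free graph with enough edges consists of b - 1 dominating vertices and a
-- remainder that is edgeless, a single edge or a maximum matching.
--
-- As long as L has more than two paths, Erdős–Gallai yields a path P_ℓ, and edge
-- counting yields ⌊ℓ/2⌋ of its vertices with many common neighbours; these carry
-- a path P_ℓ wherever needed, so they can be deleted along with P_ℓ. For two
-- paths, with p ≥ q the halves of their lengths, pass to a subgraph of minimum
-- degree at least p + q - 1 and find p vertices with many common neighbours.
-- Disjoint pieces are grown from these neighbours: either many pieces share a new
-- neighbour, which becomes a further connector, or each piece becomes longer.
-- Pieces longer than one vertex end up giving both paths, so one obtains
-- p + q - 1 vertices with many common neighbours, and the remainder is described
-- by counting its edges.

module Submission where

open import Defs
open import Data.Empty using (⊥)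
open import Data.Bool using (Bool; true; false; not; T; T?; _∧_; if_then_else_)
import Data.Bool.Properties as Bool
open import Data.Fin using (Fin; zero; suc; toℕ)
import Data.Fin as Fin
import Data.Fin.Properties as Fin
open import Data.List using (List; []; _∷_; _++_; length; map; filter; reverse; take; drop; allFin; cartesianProduct; tabulate)
open import Data.List.Membership.Propositional using (_∈_; _∉_)
open import Data.List.Membership.Propositional.Properties using (∈-lookup; ∈-tabulate⁺; ∈-++⁺ˡ; ∈-++⁺ʳ; ∈-++⁻; ∈-filter⁺; ∈-filter⁻; ∈-allFin; ∈-∃++)
import Data.List.Membership.DecPropositional as DecMembership
import Data.List as List
open import Data.Nat.ListAction using () renaming (sum to total)
import Data.Nat.ListAction.Properties as ListAction
import Data.List.Properties as List
open import Data.List.Relation.Unary.All as All using (All; []; _∷_)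
import Data.List.Relation.Unary.All.Properties as All
open import Data.List.Relation.Unary.AllPairs as AllPairs using (AllPairs; []; _∷_)
import Data.List.Relation.Unary.AllPairs.Properties as AllPairs
open import Data.List.Relation.Unary.Any using (here; there)
open import Data.List.Relation.Unary.Unique.Propositional using (Unique)
import Data.List.Relation.Unary.Unique.Propositional.Properties as Unique
open import Data.List.Relation.Binary.Disjoint.Propositional using (Disjoint)
open import Data.List.Relation.Binary.Permutation.Propositional as Perm using (_↭_; prep; swap; ↭-sym; ↭-trans; ↭-refl)
import Data.List.Relation.Binary.Permutation.Propositional.Properties as Perm
import Data.List.Relation.Binary.Permutation.Setoid.Properties as PermSetoid
open import Data.Nat using (ℕ; zero; suc; _+_; _*_; _∸_; _^_; _≤_; _<_; _≥_; z≤n; s≤s; s≤s⁻¹; _≤?_; _<?_; ⌊_/2⌋)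
import Data.Nat as ℕ
open import Data.Nat.Divisibility using (_∣_; _∤_; _∣?_; divides)
open import Data.Nat.Properties
open import Data.Nat.Tactic.RingSolver using (solve-∀)
open import Data.Product using (Σ-syntax; ∃; ∃-syntax; _×_; _,_; proj₁; proj₂)
open import Data.Sum using (_⊎_; inj₁; inj₂; [_,_]′)
open import Data.Vec.Functional using (Vector)
open import Function using (_∘_; id; case_of_; Injective; mk↔ₛ′)
open import Relation.Binary.Definitions using (tri<; tri≈; tri>)
open import Relation.Binary.Core using (_Preserves_⟶_)
open import Relation.Binary.PropositionalEquality using (_≡_; _≢_; refl; sym; trans; cong; cong₂; subst; subst₂; _≗_; ≢-sym; setoid; module ≡-Reasoning)
open import Relation.Nullary using (¬_; Dec; yes; no; does; contradiction)
open import Relation.Nullary.Decidable using (dec-true; dec-false; _×-dec_; _→-dec_; ¬?; map′)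

-- Counting in vertex sets

-- Let B be the sum of the halves ⌊ℓ/2⌋. Stars aside, the target has B - 1 edges per vertex, up to a
-- constant, while the crude bound for linear forests is B - 1/2. This is good enough when one path
-- is split off: either enough of its vertices share many neighbours, or it meets so few edges that
-- the total falls to B - 3/2 per vertex, below the target. The descent cannot continue to a single
-- path: for a path of odd order, disjoint cliques have B - 1/2 edges per vertex and no dominating
-- vertex. Hence the last two paths are treated together: a clique-like rest contains long pieces,
-- and connectors through long pieces carry longer paths than connectors through single vertices.
-- The final structure has one connector fewer than the paths need. Every configuration excluded
-- from the remainder is therefore one that saves a connector, and parity decides which ones do: one
-- edge suffices for an even path, an odd path needs two.

lin : ∀ {a b l r} d → l ≤ r → b + l ≡ a + r + d → a ≤ b
lin {a} {b} {l} {r} d l≤r eq = +-cancelʳ-≤ l a b (begin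
  a + l     ≤⟨ +-monoʳ-≤ a l≤r ⟩
  a + r     ≤⟨ m≤m+n (a + r) d ⟩
  a + r + d ≡⟨ sym eq ⟩
  b + l     ∎)
  where open ≤-Reasoning

infixl 7 _⊕_

-- Linear arithmetic is done by certificates: hypotheses are added up with `_⊕_`, and `lin` reduces
-- the goal to one identity for the ring solver, in which `d` is the slack that remains.
_⊕_ : ∀ {l r l′ r′} → l ≤ r → l′ ≤ r′ → l + l′ ≤ r + r′
_⊕_ = +-mono-≤

⟦_⟧ : Bool → ℕ
⟦ true ⟧  = 1
⟦ false ⟧ = 0

⟦⟧≤1 : ∀ b → ⟦ b ⟧ ≤ 1
⟦⟧≤1 true  = s≤s z≤n
⟦⟧≤1 false = z≤n

⟦⟧>0 : ∀ b → 1 ≤ ⟦ b ⟧ → b ≡ true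
⟦⟧>0 true  _ = refl

∧-true⁻ : ∀ a {b} → a ∧ b ≡ true → a ≡ true × b ≡ true
∧-true⁻ true eq = refl , eq

∧-true⁺ : ∀ {a b} → a ≡ true → b ≡ true → a ∧ b ≡ true
∧-true⁺ refl refl = refl

true-or-false : ∀ b → b ≡ true ⊎ b ≡ false
true-or-false true  = inj₁ refl
true-or-false false = inj₂ refl

true≢false : ∀ {b} → b ≡ true → b ≡ false → ∀ {a} {A : Set a} → A
true≢false refl ()

not-true⇒false : ∀ {b} → b ≢ true → b ≡ false
not-true⇒false {true}  h = contradiction refl h
not-true⇒false {false} _ = refl

does⁻ : ∀ {P : Set} (d : Dec P) → does d ≡ true → P
does⁻ (yes p) _ = p

not-does⁻ : ∀ {P : Set} (d : Dec P) → not (does d) ≡ true → ¬ P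
not-does⁻ (no ¬p) _ = ¬p

_∈?_ : ∀ {n} (v : Fin n) (xs : List (Fin n)) → Dec (v ∈ xs)
_∈?_ = DecMembership._∈?_ Fin._≟_

sum-cong : ∀ {n} {f g : Vector ℕ n} → (∀ i → f i ≡ g i) → sum f ≡ sum g
sum-cong {zero}  h = refl
sum-cong {suc n} h = cong₂ _+_ (h zero) (sum-cong (h ∘ suc))

sum-mono : ∀ {n} {f g : Vector ℕ n} → (∀ i → f i ≤ g i) → sum f ≤ sum g
sum-mono {zero}  h = z≤n
sum-mono {suc n} h = +-mono-≤ (h zero) (sum-mono (h ∘ suc))

sum-0 : ∀ n → sum {n} (λ _ → 0) ≡ 0
sum-0 zero    = refl
sum-0 (suc n) = sum-0 n

sum-+ : ∀ {n} (f g : Vector ℕ n) → sum (λ i → f i + g i) ≡ sum f + sum g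
sum-+ {zero}  f g = refl
sum-+ {suc n} f g rewrite sum-+ (f ∘ suc) (g ∘ suc) =
  interchange (f zero) (g zero) _ _
  where
  interchange : ∀ a b c d → (a + b) + (c + d) ≡ (a + c) + (b + d)
  interchange = solve-∀

sum-swap : ∀ {m n} (f : Fin m → Fin n → ℕ) →
           sum (λ i → sum (f i)) ≡ sum (λ j → sum (λ i → f i j))
sum-swap {zero}  {n} f = sym (sum-0 n)
sum-swap {suc m} f rewrite sum-swap (f ∘ suc) =
  sym (sum-+ (f zero) (λ j → sum (λ i → f (suc i) j)))

VSet : ℕ → Set
VSet n = Fin n → Bool

full : ∀ {n} → VSet n
full _ = true

infixl 6 _-_ _∖_ _∩_
_-_ : ∀ {n} → VSet n → Fin n → VSet n
(X - a) v = X v ∧ not (does (v Fin.≟ a))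

_∖_ : ∀ {n} → VSet n → List (Fin n) → VSet n
X ∖ []       = X
X ∖ (x ∷ xs) = (X - x) ∖ xs

_∩_ : ∀ {n} → VSet n → VSet n → VSet n
(X ∩ Y) v = X v ∧ Y v

_∩ᶜ_ : ∀ {n} → VSet n → VSet n → VSet n
(X ∩ᶜ Y) v = X v ∧ not (Y v)

infix 4 _⊆_
_⊆_ : ∀ {n} → VSet n → VSet n → Set
X ⊆ Y = ∀ v → X v ≡ true → Y v ≡ true

module _ {n : ℕ} where

  ∈-⁻ : ∀ (X : VSet n) a {v} → (X - a) v ≡ true → X v ≡ true × v ≢ a
  ∈-⁻ X a {v} h with X v | v Fin.≟ a
  ... | true | no v≢a = refl , v≢a

  ∈-⁺ : ∀ (X : VSet n) a {v} → X v ≡ true → v ≢ a → (X - a) v ≡ true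
  ∈-⁺ X a {v} Xv v≢a = ∧-true⁺ Xv (cong not (dec-false (v Fin.≟ a) v≢a))

  ∈∖⁻ : ∀ (X : VSet n) xs {v} → (X ∖ xs) v ≡ true → X v ≡ true × v ∉ xs
  ∈∖⁻ X []       h = h , λ ()
  ∈∖⁻ X (x ∷ xs) h = let h′ , v∉ = ∈∖⁻ (X - x) xs h
                         Xv , v≢ = ∈-⁻ X x h′
                     in Xv , λ { (here eq) → v≢ eq ; (there v∈) → v∉ v∈ }

  ∖⊆ : ∀ (X : VSet n) xs → X ∖ xs ⊆ X
  ∖⊆ X xs v h = proj₁ (∈∖⁻ X xs h)

  All-∖⁺ : ∀ (X : VSet n) x {ys} → All (x ≢_) ys → All (λ v → X v ≡ true) ys →
           All (λ v → (X - x) v ≡ true) ys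
  All-∖⁺ X x []       []       = []
  All-∖⁺ X x (p ∷ ps) (q ∷ qs) = ∈-⁺ X x q (≢-sym p) ∷ All-∖⁺ X x ps qs

  opaque
    Σₛ : VSet n → (Fin n → ℕ) → ℕ
    Σₛ X f = sum (λ v → if X v then f v else 0)

  opaque
    unfolding Σₛ

    Σₛ-cong : ∀ X {f g} → (∀ v → X v ≡ true → f v ≡ g v) → Σₛ X f ≡ Σₛ X g
    Σₛ-cong X {f} {g} h = sum-cong pointwise
      where
      pointwise : ∀ v → (if X v then f v else 0) ≡ (if X v then g v else 0)
      pointwise v with X v in eq
      ... | true  = h v eq
      ... | false = refl

    Σₛ-mono : ∀ X {f g} → (∀ v → X v ≡ true → f v ≤ g v) → Σₛ X f ≤ Σₛ X g
    Σₛ-mono X {f} {g} h = sum-mono pointwise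
      where
      pointwise : ∀ v → (if X v then f v else 0) ≤ (if X v then g v else 0)
      pointwise v with X v in eq
      ... | true  = h v eq
      ... | false = z≤n

    Σₛ-⊆ : ∀ {X Y} f → X ⊆ Y → Σₛ X f ≤ Σₛ Y f
    Σₛ-⊆ {X} {Y} f h = sum-mono pointwise
      where
      pointwise : ∀ v → (if X v then f v else 0) ≤ (if Y v then f v else 0)
      pointwise v with X v in eq
      ... | true rewrite h v eq = ≤-refl
      ... | false = z≤n

    Σₛ-+ : ∀ X f g → Σₛ X (λ v → f v + g v) ≡ Σₛ X f + Σₛ X g
    Σₛ-+ X f g = trans (sum-cong pointwise) (sum-+ (λ v → if X v then f v else 0) (λ v → if X v then g v else 0))
      where
      pointwise : ∀ v → (if X v then f v + g v else 0) ≡ (if X v then f v else 0) + (if X v then g v else 0)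
      pointwise v with X v
      ... | true  = refl
      ... | false = refl

    Σₛ-swap : ∀ X Y (f : Fin n → Fin n → ℕ) →
              Σₛ X (λ v → Σₛ Y (f v)) ≡ Σₛ Y (λ u → Σₛ X (λ v → f v u))
    Σₛ-swap X Y f = trans (sum-cong push)
      (trans (sum-swap (λ v u → if X v then (if Y u then f v u else 0) else 0)) (sum-cong pull))
      where
      push : ∀ v → (if X v then Σₛ Y (f v) else 0) ≡
                   sum (λ u → if X v then (if Y u then f v u else 0) else 0)
      push v with X v
      ... | true  = refl
      ... | false = sym (sum-0 n)
      pull : ∀ u → sum (λ v → if X v then (if Y u then f v u else 0) else 0) ≡
                   (if Y u then Σₛ X (λ v → f v u) else 0)
      pull u with Y u
      ... | true  = refl
      ... | false = trans (sum-cong (λ v → Bool.if-eta (X v))) (sum-0 n)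

    Σₛ-split : ∀ X Y f → Σₛ X f ≡ Σₛ (X ∩ Y) f + Σₛ (X ∩ᶜ Y) f
    Σₛ-split X Y f = trans (sum-cong pointwise)
      (sum-+ (λ v → if (X ∩ Y) v then f v else 0) (λ v → if (X ∩ᶜ Y) v then f v else 0))
      where
      pointwise : ∀ v → (if X v then f v else 0) ≡
                  (if (X ∩ Y) v then f v else 0) + (if (X ∩ᶜ Y) v then f v else 0)
      pointwise v with X v | Y v
      ... | true  | true  = sym (+-identityʳ (f v))
      ... | true  | false = refl
      ... | false | _     = refl

sum-single : ∀ {n} (a : Fin n) (f : Fin n → ℕ) → sum (λ v → if does (v Fin.≟ a) then f v else 0) ≡ f a
sum-single {suc n} zero    f = trans (cong (f zero +_) (sum-0 n)) (+-identityʳ (f zero))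
sum-single {suc n} (suc a) f = sum-single a (f ∘ suc)

module _ {n : ℕ} where

  opaque
    unfolding Σₛ

    Σₛ-remove : ∀ (X : VSet n) {a} f → X a ≡ true → Σₛ X f ≡ f a + Σₛ (X - a) f
    Σₛ-remove X {a} f Xa = trans (Σₛ-split X (λ v → does (v Fin.≟ a)) f)
      (cong (_+ Σₛ (X - a) f) (trans (sum-cong pointwise) (sum-single a f)))
      where
      pointwise : ∀ v → (if X v ∧ does (v Fin.≟ a) then f v else 0) ≡ (if does (v Fin.≟ a) then f v else 0)
      pointwise v with v Fin.≟ a
      ... | yes refl rewrite Xa = refl
      ... | no _ = cong (λ b → if b then f v else 0) (Bool.∧-zeroʳ (X v))

  # : VSet n → ℕ
  # X = Σₛ X (λ _ → 1)

  opaque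
    unfolding Σₛ

    Σₛ-const : ∀ (X : VSet n) c → Σₛ X (λ _ → c) ≡ c * # X
    Σₛ-const X c = trans (sum-cong pointwise) (*-sum (λ v → if X v then 1 else 0))
      where
      pointwise : ∀ v → (if X v then c else 0) ≡ c * (if X v then 1 else 0)
      pointwise v with X v
      ... | true  = sym (*-identityʳ c)
      ... | false = sym (*-zeroʳ c)
      *-sum : ∀ {m} (f : Vector ℕ m) → sum (λ i → c * f i) ≡ c * sum f
      *-sum {zero}  f = sym (*-zeroʳ c)
      *-sum {suc m} f = trans (cong (c * f zero +_) (*-sum (f ∘ suc))) (sym (*-distribˡ-+ c (f zero) _))

  Σₛ-≤const : ∀ (X : VSet n) {f} c → (∀ v → X v ≡ true → f v ≤ c) → Σₛ X f ≤ c * # X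
  Σₛ-≤const X c h = ≤-trans (Σₛ-mono X h) (≤-reflexive (Σₛ-const X c))

  Σₛ-∈ : ∀ (X : VSet n) {a} f → X a ≡ true → f a ≤ Σₛ X f
  Σₛ-∈ X f Xa = ≤-trans (m≤m+n _ _) (≤-reflexive (sym (Σₛ-remove X f Xa)))

  Σₛ-pos : ∀ (X : VSet n) f → 1 ≤ Σₛ X f → ∃[ v ] X v ≡ true × 1 ≤ f v
  Σₛ-pos X f h with Fin.any? (λ v → (X v Bool.≟ true) ×-dec (1 ≤? f v))
  ... | yes (v , Xv , fv) = v , Xv , fv
  ... | no none = contradiction (≤-trans h (≤-trans (Σₛ-≤const X 0 zeros) (≤-reflexive refl))) λ ()
    where
    zeros : ∀ v → X v ≡ true → f v ≤ 0
    zeros v Xv with f v in eq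
    ... | zero  = z≤n
    ... | suc _ = contradiction (v , Xv , subst (1 ≤_) (sym eq) (s≤s z≤n)) none

  opaque
    unfolding Σₛ

    Σₛ-∅ : ∀ (X : VSet n) f → (∀ v → X v ≡ false) → Σₛ X f ≡ 0
    Σₛ-∅ X f h = trans (sum-cong (λ v → cong (λ b → if b then f v else 0) (h v))) (sum-0 n)

  #-remove : ∀ (X : VSet n) {a} → X a ≡ true → # X ≡ suc (# (X - a))
  #-remove X Xa = Σₛ-remove X (λ _ → 1) Xa

  #-⊆ : ∀ {X Y : VSet n} → X ⊆ Y → # X ≤ # Y
  #-⊆ = Σₛ-⊆ (λ _ → 1)

  #-pos : ∀ (X : VSet n) → 1 ≤ # X → ∃[ v ] X v ≡ true
  #-pos X h = let v , Xv , _ = Σₛ-pos X _ h in v , Xv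

  #-empty : ∀ (X : VSet n) → # X ≡ 0 → ∀ v → X v ≡ false
  #-empty X h v = not-true⇒false (λ Xv → contradiction (trans (sym h) (#-remove X Xv)) λ ())

  lsum : (Fin n → ℕ) → List (Fin n) → ℕ
  lsum f []       = 0
  lsum f (x ∷ xs) = f x + lsum f xs

  lsum-const : ∀ c xs → lsum (λ _ → c) xs ≡ c * length xs
  lsum-const c []       = sym (*-zeroʳ c)
  lsum-const c (x ∷ xs) = trans (cong (c +_) (lsum-const c xs)) (sym (*-suc c (length xs)))

  lsum-mono : ∀ {f g} xs → All (λ v → f v ≤ g v) xs → lsum f xs ≤ lsum g xs
  lsum-mono []       []       = z≤n
  lsum-mono (x ∷ xs) (p ∷ ps) = +-mono-≤ p (lsum-mono xs ps)

  Inside : VSet n → List (Fin n) → Set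
  Inside X = All (λ v → X v ≡ true)

  Inside-⊆ : ∀ {X Y : VSet n} {xs} → X ⊆ Y → Inside X xs → Inside Y xs
  Inside-⊆ h = All.map (h _)

  Inside-∖⁻ : ∀ (X : VSet n) ys {xs} → Inside (X ∖ ys) xs → Inside X xs
  Inside-∖⁻ X ys = Inside-⊆ (∖⊆ X ys)

  Inside-∖-disjoint : ∀ (X : VSet n) ys {xs} → Inside (X ∖ ys) xs → Disjoint xs ys
  Inside-∖-disjoint X ys h (v∈xs , v∈ys) = proj₂ (∈∖⁻ X ys (All.lookup h v∈xs)) v∈ys

  Σₛ-removeL : ∀ (X : VSet n) xs f → Unique xs → Inside X xs →
               Σₛ X f ≡ lsum f xs + Σₛ (X ∖ xs) f
  Σₛ-removeL X []       f _        _        = refl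
  Σₛ-removeL X (x ∷ xs) f (p ∷ ps) (q ∷ qs) =
    trans (Σₛ-remove X f q)
    (trans (cong (f x +_) (Σₛ-removeL (X - x) xs f ps (All-∖⁺ X x p qs)))
           (sym (+-assoc (f x) _ _)))

  #-removeL : ∀ (X : VSet n) xs → Unique xs → Inside X xs → # X ≡ length xs + # (X ∖ xs)
  #-removeL X xs u i = trans (Σₛ-removeL X xs _ u i)
    (cong (_+ # (X ∖ xs)) (trans (lsum-const 1 xs) (*-identityˡ (length xs))))

  length≤# : ∀ (X : VSet n) xs → Unique xs → Inside X xs → length xs ≤ # X
  length≤# X xs u i = ≤-trans (m≤m+n _ _) (≤-reflexive (sym (#-removeL X xs u i)))

  opaque
    unfolding Σₛ

    #≤n : ∀ (X : VSet n) → # X ≤ n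
    #≤n X = ≤-trans (sum-mono (λ v → h (X v))) (≤-reflexive (ones n))
      where
      h : ∀ b → (if b then 1 else 0) ≤ 1
      h true  = s≤s z≤n
      h false = z≤n
      ones : ∀ m → sum {m} (λ _ → 1) ≡ m
      ones zero    = refl
      ones (suc m) = cong suc (ones m)

    #full : # (full {n}) ≡ n
    #full = ones n
      where
      ones : ∀ m → sum {m} (λ _ → 1) ≡ m
      ones zero    = refl
      ones (suc m) = cong suc (ones m)

  Σₛ-≤lsum : ∀ (X : VSet n) xs f → (∀ v → X v ≡ true → 1 ≤ f v → v ∈ xs) → Σₛ X f ≤ lsum f xs
  Σₛ-≤lsum X []       f h = ≤-trans (Σₛ-≤const X 0 zeros) z≤n
    where
    zeros : ∀ v → X v ≡ true → f v ≤ 0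
    zeros v Xv with f v in eq
    ... | zero  = z≤n
    ... | suc _ = case h v Xv (subst (1 ≤_) (sym eq) (s≤s z≤n)) of λ ()
  Σₛ-≤lsum X (x ∷ xs) f h with true-or-false (X x)
  ... | inj₁ Xx = ≤-trans (≤-reflexive (Σₛ-remove X f Xx))
          (+-monoʳ-≤ (f x) (Σₛ-≤lsum (X - x) xs f h′))
    where
    h′ : ∀ v → (X - x) v ≡ true → 1 ≤ f v → v ∈ xs
    h′ v v∈ pos with ∈-⁻ X x v∈
    ... | Xv , v≢x with h v Xv pos
    ...   | here v≡x = contradiction v≡x v≢x
    ...   | there q  = q
  ... | inj₂ ¬Xx = ≤-trans (Σₛ-≤lsum X xs f h′) (m≤n+m _ (f x))
    where
    h′ : ∀ v → X v ≡ true → 1 ≤ f v → v ∈ xs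
    h′ v Xv pos with h v Xv pos
    ... | here refl = true≢false Xv ¬Xx
    ... | there q   = q

  Σₛ-lsum-swap : ∀ (X : VSet n) xs (f : Fin n → Fin n → ℕ) →
                 Σₛ X (λ v → lsum (f v) xs) ≡ lsum (λ u → Σₛ X (λ v → f v u)) xs
  Σₛ-lsum-swap X []       f = trans (Σₛ-const X 0) refl
  Σₛ-lsum-swap X (x ∷ xs) f = trans (Σₛ-+ X (λ v → f v x) _) (cong (_ +_) (Σₛ-lsum-swap X xs f))

  elems : VSet n → List (Fin n)
  elems X = filter (λ v → X v Bool.≟ true) (allFin n)

  ∈-elems⁺ : ∀ (X : VSet n) {v} → X v ≡ true → v ∈ elems X
  ∈-elems⁺ X Xv = ∈-filter⁺ (λ v → X v Bool.≟ true) (∈-allFin _) Xv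

  ∈-elems⁻ : ∀ (X : VSet n) {v} → v ∈ elems X → X v ≡ true
  ∈-elems⁻ X v∈ = proj₂ (∈-filter⁻ (λ v → X v Bool.≟ true) {xs = allFin n} v∈)

  elems-unique : ∀ X → Unique (elems X)
  elems-unique X = Unique.filter⁺ (λ v → X v Bool.≟ true) (Unique.allFin⁺ n)

  elems-inside : ∀ X → Inside X (elems X)
  elems-inside X = All.tabulate (∈-elems⁻ X)

  #-elems : ∀ X → # X ≡ length (elems X)
  #-elems X = ≤-antisym
    (≤-trans (Σₛ-≤lsum X (elems X) _ (λ v Xv _ → ∈-elems⁺ X Xv))
             (≤-reflexive (trans (lsum-const 1 (elems X)) (*-identityˡ _))))
    (length≤# X (elems X) (elems-unique X) (elems-inside X))

-- Degrees, walks and the Erdős–Gallai bound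

-- This is k(k - 1), twice the number of edges of a clique, in a form without subtraction.
tri : ℕ → ℕ
tri zero    = 0
tri (suc k) = tri k + 2 * k

tri+ : ∀ m → tri m + m ≡ m * m
tri+ zero    = refl
tri+ (suc m) = begin
  tri m + 2 * m + suc m   ≡⟨ regroup (tri m) m ⟩
  (tri m + m) + suc (2 * m) ≡⟨ cong (_+ suc (2 * m)) (tri+ m) ⟩
  m * m + suc (2 * m)     ≡⟨ square m ⟩
  suc m * suc m           ∎
  where
  open ≡-Reasoning
  regroup : ∀ t m → t + 2 * m + suc m ≡ (t + m) + suc (2 * m)
  regroup = solve-∀
  square : ∀ m → m * m + suc (2 * m) ≡ suc m * suc m
  square = solve-∀

listSearch : ∀ {n} m {P : List (Fin n) → Set} → (∀ xs → Dec (P xs)) →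
             Dec (∃[ xs ] length xs ≡ m × P xs)
listSearch zero {P} P? = map′ (λ p → [] , refl , p) (λ { ([] , refl , p) → p }) (P? [])
listSearch (suc m) {P} P? =
  map′ (λ { (x , xs , len , p) → x ∷ xs , cong suc len , p })
       (λ { (x ∷ xs , len , p) → x , xs , suc-injective len , p })
       (Fin.any? (λ x → listSearch m (λ xs → P? (x ∷ xs))))

module Counting {n : ℕ} (G : Graph n) where

  V : Set
  V = Fin n

  Adj : V → V → Set
  Adj u v = adj G u v ≡ true

  adj-comm : ∀ {u v} → Adj u v → Adj v u
  adj-comm {u} {v} h = trans (adj-sym G v u) h

  adj-≢ : ∀ {u v} → Adj u v → u ≢ v
  adj-≢ h refl = true≢false h (adj-irrefl G _)

  a? : V → V → ℕ
  a? u v = ⟦ adj G u v ⟧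

  deg : VSet n → V → ℕ
  deg X v = Σₛ X (a? v)

  -- Twice the number of edges inside `X`. All edge counts below are doubled in this way, so that
  -- nothing has to be halved.
  e2 : VSet n → ℕ
  e2 X = Σₛ X (deg X)

  ladj : V → List V → ℕ
  ladj v xs = lsum (a? v) xs

  deg-⊆ : ∀ {X Y} → X ⊆ Y → ∀ v → deg X v ≤ deg Y v
  deg-⊆ h v = Σₛ-⊆ (a? v) h

  deg-remove : ∀ X {a} v → X a ≡ true → deg X v ≡ a? v a + deg (X - a) v
  deg-remove X v Xa = Σₛ-remove X (a? v) Xa

  deg-self : ∀ X {a} → X a ≡ true → deg X a ≡ deg (X - a) a
  deg-self X {a} Xa = trans (deg-remove X a Xa) (cong (_+ deg (X - a) a) (cong ⟦_⟧ (adj-irrefl G a)))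

  deg≤# : ∀ X v → deg X v ≤ # X
  deg≤# X v = Σₛ-mono X (λ u _ → ⟦⟧≤1 (adj G v u))

  e2-remove : ∀ X {a} → X a ≡ true → e2 X ≡ 2 * deg X a + e2 (X - a)
  e2-remove X {a} Xa = begin
    e2 X                                                  ≡⟨ Σₛ-remove X (deg X) Xa ⟩
    deg X a + Σₛ (X - a) (deg X)                          ≡⟨ cong (deg X a +_) (Σₛ-cong (X - a) (λ v _ → deg-remove X v Xa)) ⟩
    deg X a + Σₛ (X - a) (λ v → a? v a + deg (X - a) v)   ≡⟨ cong (deg X a +_) (Σₛ-+ (X - a) (λ v → a? v a) (deg (X - a))) ⟩
    deg X a + (Σₛ (X - a) (λ v → a? v a) + e2 (X - a))    ≡⟨ cong (λ s → deg X a + (s + e2 (X - a))) column ⟩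
    deg X a + (deg X a + e2 (X - a))                      ≡⟨ double (deg X a) (e2 (X - a)) ⟩
    2 * deg X a + e2 (X - a)                              ∎
    where
    open ≡-Reasoning
    column : Σₛ (X - a) (λ v → a? v a) ≡ deg X a
    column = trans (Σₛ-cong (X - a) (λ v _ → cong ⟦_⟧ (adj-sym G v a))) (sym (deg-self X Xa))
    double : ∀ x y → x + (x + y) ≡ 2 * x + y
    double = solve-∀

  e2-removeL : ∀ xs X → Unique xs → Inside X xs → e2 X ≤ e2 (X ∖ xs) + 2 * lsum (deg X) xs
  e2-removeL []       X _ _ = ≤-reflexive (sym (+-identityʳ (e2 X)))
  e2-removeL (x ∷ xs) X (p ∷ ps) (q ∷ qs) = begin
    e2 X                                                              ≡⟨ e2-remove X q ⟩
    2 * deg X x + e2 (X - x)                                          ≤⟨ +-monoʳ-≤ (2 * deg X x) (e2-removeL xs (X - x) ps (All-∖⁺ X x p qs)) ⟩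
    2 * deg X x + (e2 ((X - x) ∖ xs) + 2 * lsum (deg (X - x)) xs)     ≤⟨ +-monoʳ-≤ (2 * deg X x) (+-monoʳ-≤ (e2 ((X - x) ∖ xs)) (*-monoʳ-≤ 2 (lsum-mono xs (All.tabulate (λ {v} _ → deg-⊆ (λ u h → proj₁ (∈-⁻ X x h)) v))))) ⟩
    2 * deg X x + (e2 ((X - x) ∖ xs) + 2 * lsum (deg X) xs)           ≡⟨ regroup (deg X x) (e2 ((X - x) ∖ xs)) (lsum (deg X) xs) ⟩
    e2 ((X - x) ∖ xs) + 2 * (deg X x + lsum (deg X) xs)               ∎
    where
    open ≤-Reasoning
    regroup : ∀ a b c → 2 * a + (b + 2 * c) ≡ b + 2 * (a + c)
    regroup = solve-∀

  deg-∖ : ∀ xs X v → Unique xs → Inside X xs → deg X v ≤ length xs + deg (X ∖ xs) v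
  deg-∖ xs X v u i = begin
    deg X v                           ≡⟨ Σₛ-removeL X xs (a? v) u i ⟩
    ladj v xs + deg (X ∖ xs) v        ≤⟨ +-monoˡ-≤ (deg (X ∖ xs) v) (lsum-mono {g = λ _ → 1} xs (All.tabulate (λ {w} _ → ⟦⟧≤1 (adj G v w)))) ⟩
    lsum (λ _ → 1) xs + deg (X ∖ xs) v ≡⟨ cong (_+ deg (X ∖ xs) v) (trans (lsum-const 1 xs) (*-identityˡ (length xs))) ⟩
    length xs + deg (X ∖ xs) v        ∎
    where open ≤-Reasoning

  -- Only the edges inside `A` are estimated, as if `A` were a clique; those leaving it are counted
  -- exactly. By contrast, `e2-removeL` charges every vertex its full degree.
  e2-cross : ∀ A X → Unique A → Inside X A →
             e2 X ≤ tri (length A) + 2 * lsum (deg (X ∖ A)) A + e2 (X ∖ A)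
  e2-cross []       X _ _ = ≤-refl
  e2-cross (a ∷ A) X (p ∷ ps) (q ∷ qs) = begin
    e2 X                            ≡⟨ e2-remove X q ⟩
    2 * deg X a + e2 (X - a)        ≡⟨ cong (λ d → 2 * d + e2 (X - a)) (deg-self X q) ⟩
    2 * deg (X - a) a + e2 (X - a)  ≤⟨ +-mono-≤ (*-monoʳ-≤ 2 (deg-∖ A (X - a) a ps inA)) (e2-cross A (X - a) ps inA) ⟩
    2 * (length A + d) + (tri (length A) + 2 * l + e2 R) ≡⟨ regroup (length A) d (tri (length A)) l (e2 R) ⟩
    tri (length A) + 2 * length A + 2 * (d + l) + e2 R   ∎
    where
    open ≤-Reasoning
    R = (X - a) ∖ A
    d = deg R a
    l = lsum (deg R) A
    inA = All-∖⁺ X a p qs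
    regroup : ∀ k d t l e → 2 * (k + d) + (t + 2 * l + e) ≡ t + 2 * k + 2 * (d + l) + e
    regroup = solve-∀

  lsum-deg : ∀ R A → lsum (deg R) A ≡ Σₛ R (λ v → ladj v A)
  lsum-deg R A = trans (lsum-cong A) (sym (Σₛ-lsum-swap R A (λ v a → a? v a)))
    where
    lsum-cong : ∀ A → lsum (deg R) A ≡ lsum (λ a → Σₛ R (λ v → a? v a)) A
    lsum-cong []      = refl
    lsum-cong (a ∷ A) = cong₂ _+_ (Σₛ-cong R (λ v _ → cong ⟦_⟧ (adj-sym G a v))) (lsum-cong A)

  find-neighbour : ∀ X x L → length L < deg X x → ∃[ z ] X z ≡ true × Adj x z × z ∉ L
  find-neighbour X x L len
    with Fin.any? (λ z → (X z Bool.≟ true) ×-dec (adj G x z Bool.≟ true) ×-dec ¬? (z ∈? L))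
  ... | yes found = found
  ... | no none = contradiction len (≤⇒≯ (begin
      deg X x            ≤⟨ Σₛ-≤lsum X L (a? x) inL ⟩
      lsum (a? x) L      ≤⟨ lsum-mono {g = λ _ → 1} L (All.tabulate (λ {w} _ → ⟦⟧≤1 (adj G x w))) ⟩
      lsum (λ _ → 1) L   ≡⟨ trans (lsum-const 1 L) (*-identityˡ (length L)) ⟩
      length L           ∎))
    where
    open ≤-Reasoning
    inL : ∀ z → X z ≡ true → 1 ≤ a? x z → z ∈ L
    inL z Xz pos with z ∈? L
    ... | yes z∈ = z∈
    ... | no z∉  = contradiction (z , Xz , ⟦⟧>0 _ pos , z∉) none

  data Walk : V → V → List V → Set where
    [_] : ∀ v → Walk v v (v ∷ [])
    _∷_ : ∀ {u v w xs} → Adj u v → Walk v w xs → Walk u w (u ∷ xs)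

  walk-join : ∀ {u v x y xs ys} → Walk u v xs → Adj v x → Walk x y ys → Walk u y (xs ++ ys)
  walk-join [ v ]   a w′ = a ∷ w′
  walk-join (b ∷ w) a w′ = b ∷ walk-join w a w′

  walk-reverse : ∀ {u v xs} → Walk u v xs → Walk v u (reverse xs)
  walk-reverse [ v ] = [ v ]
  walk-reverse (_∷_ {u} {v} {w} {xs} a p) =
    subst (Walk w u) (sym (List.unfold-reverse u xs)) (walk-join (walk-reverse p) (adj-comm a) [ u ])

  head∈ : ∀ {u v xs} → Walk u v xs → u ∈ xs
  head∈ [ v ]   = here refl
  head∈ (a ∷ w) = here refl

  last∈ : ∀ {u v xs} → Walk u v xs → v ∈ xs
  last∈ [ v ]   = here refl
  last∈ (a ∷ w) = there (last∈ w)

  walk-nonempty : ∀ {u v xs} → Walk u v xs → 1 ≤ length xs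
  walk-nonempty [ v ]   = s≤s z≤n
  walk-nonempty (a ∷ w) = s≤s z≤n

  walk-prefix : ∀ {u v w xs} → Walk u v xs → w ∈ xs → ∃[ ys ] ∃[ zs ] xs ≡ ys ++ zs × Walk u w ys
  walk-prefix [ v ]   (here refl) = _ , [] , refl , [ v ]
  walk-prefix (_∷_ {xs = xs} a p) (here refl) = _ , xs , refl , [ _ ]
  walk-prefix (a ∷ p) (there w∈) = let ys , zs , eq , q = walk-prefix p w∈
                                   in _ ∷ ys , zs , cong (_ ∷_) eq , a ∷ q

  walk-split : ∀ {u v w xs} → Walk u v xs → w ∈ xs →
               u ≡ w ⊎ ∃[ ys ] ∃[ zs ] ∃[ x ] xs ≡ ys ++ zs × Walk u x ys × Adj x w × Walk w v zs
  walk-split [ v ]   (here refl) = inj₁ refl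
  walk-split (a ∷ p) (here refl) = inj₁ refl
  walk-split (_∷_ {u} a p) (there w∈) with walk-split p w∈
  ... | inj₁ refl = inj₂ (u ∷ [] , _ , u , refl , [ u ] , a , p)
  ... | inj₂ (ys , zs , x , eq , q , b , r) = inj₂ (u ∷ ys , zs , x , cong (u ∷_) eq , a ∷ q , b , r)

  walk-take : ∀ m {u v xs} → Walk u v xs → ∃[ w ] Walk u w (take (suc m) xs)
  walk-take m       [ v ]   rewrite List.take-[] {A = V} m = v , [ v ]
  walk-take zero    (a ∷ w) = _ , [ _ ]
  walk-take (suc m) (a ∷ w) = let z , w′ = walk-take m w in z , a ∷ w′

  walk? : ∀ xs → Dec (∃[ u ] ∃[ v ] Walk u v xs)
  walk? []           = no λ { (_ , _ , ()) }
  walk? (x ∷ [])     = yes (x , x , [ x ])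
  walk? (x ∷ y ∷ xs) with adj G x y Bool.≟ true | walk? (y ∷ xs)
  ... | no ¬a | _ = no λ { (_ , _ , (a ∷ [ _ ])) → ¬a a ; (_ , _ , (a ∷ (_ ∷ _))) → ¬a a }
  ... | yes a | no ¬w = no λ { (_ , _ , (_ ∷ w)) → ¬w (_ , _ , w) }
  ... | yes a | yes (_ , v , [ _ ])   = yes (x , v , a ∷ [ _ ])
  ... | yes a | yes (_ , v , (b ∷ w)) = yes (x , v , a ∷ (b ∷ w))

  IsPath : VSet n → List V → Set
  IsPath X xs = (∃[ u ] ∃[ v ] Walk u v xs) × Unique xs × Inside X xs

  HasPath : VSet n → ℕ → Set
  HasPath X m = ∃[ xs ] length xs ≡ m × IsPath X xs

  hasPath? : ∀ X m → Dec (HasPath X m)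
  hasPath? X m = listSearch m λ xs → walk? xs ×-dec
    (AllPairs.allPairs? (λ u v → ¬? (u Fin.≟ v)) xs ×-dec All.all? (λ v → X v Bool.≟ true) xs)

  path-take : ∀ m {X xs} → IsPath X xs → IsPath X (take (suc m) xs)
  path-take m ((u , v , w) , uniq , ins) =
    (u , walk-take m w) , Unique.take⁺ (suc m) uniq , All.take⁺ (suc m) ins

  path-shorten : ∀ m {X xs} → 1 ≤ m → m ≤ length xs → IsPath X xs →
                 ∃[ ys ] length ys ≡ m × IsPath X ys × (∀ {v} → v ∈ ys → v ∈ xs)
  path-shorten (suc m) {xs = xs} _ m≤ p =
    take (suc m) xs , trans (List.length-take (suc m) xs) (m≤n⇒m⊓n≡m m≤) , path-take m p ,
    λ v∈ → subst (_ ∈_) (List.take++drop≡id (suc m) xs) (∈-++⁺ˡ v∈)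

  HasPath-⊆ : ∀ {X Y m} → X ⊆ Y → HasPath X m → HasPath Y m
  HasPath-⊆ h (xs , len , w , u , i) = xs , len , w , u , Inside-⊆ h i

  longest : ∀ fuel X m → # X < fuel + m → HasPath X m → ∃[ k ] HasPath X k × ¬ HasPath X (suc k)
  longest zero X m lt (xs , len , w , u , i) =
    contradiction (≤-trans (≤-reflexive (sym len)) (length≤# X xs u i)) (<⇒≱ lt)
  longest (suc f) X m lt p with hasPath? X (suc m)
  ... | no ¬p = m , p , ¬p
  ... | yes p′ = longest f X (suc m) (subst (# X <_) (sym (+-suc f m)) lt) p′

  -- When `p` and `q` are the two ends of the walk, replacing the link from `x` to `y` by the edges
  -- from `p` to `y` and from `q` to `x` turns the walk into a cycle.
  record Crossing (p q u v : V) (xs : List V) : Set where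
    constructor crossing
    field
      {x y}    : V
      {ys zs}  : List V
      split    : xs ≡ ys ++ zs
      front    : Walk u x ys
      link     : Adj x y
      back     : Walk y v zs
      p~y      : Adj p y
      q~x      : Adj q x

  -- A link that is not a crossing admits only one of the two adjacencies in question, and there is
  -- one link fewer than vertices. The adjacencies of `p` to the first vertex and of `q` to the last
  -- belong to no link and are added separately.
  cross? : ∀ p q {u v xs} → Walk u v xs →
           Crossing p q u v xs ⊎ ladj p xs + ladj q xs + 1 ≤ a? p u + a? q v + length xs
  cross? p q [ v ] = inj₂ (≤-reflexive (regroup (a? p v) (a? q v)))
    where
    regroup : ∀ a b → a + 0 + (b + 0) + 1 ≡ a + b + 1
    regroup = solve-∀
  cross? p q (_∷_ {u} {u′} {v} {xs} a w) with cross? p q w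
  ... | inj₁ (crossing s f l b p~ q~) = inj₁ (crossing (cong (u ∷_) s) (a ∷ f) l b p~ q~)
  ... | inj₂ h with true-or-false (adj G p u′) | true-or-false (adj G q u)
  ...   | inj₁ p~ | inj₁ q~ = inj₁ (crossing refl [ u ] a w p~ q~)
  ...   | inj₂ p≁ | _ =
    inj₂ (lin 0 (h ⊕ ≤-reflexive (cong ⟦_⟧ p≁) ⊕ ⟦⟧≤1 (adj G q u)) (regroup (a? p u) (a? p u′) (a? q u) (ladj p xs) (ladj q xs) (a? q v) (length xs)))
    where
    regroup : ∀ x y z lp lq b l → x + b + suc l + (lp + lq + 1 + y + z) ≡ x + lp + (z + lq) + 1 + (y + b + l + 0 + 1) + 0
    regroup = solve-∀
  ...   | inj₁ _ | inj₂ q≁ =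
    inj₂ (lin 0 (h ⊕ ≤-reflexive (cong ⟦_⟧ q≁) ⊕ ⟦⟧≤1 (adj G p u′)) (regroup (a? p u) (a? p u′) (a? q u) (ladj p xs) (ladj q xs) (a? q v) (length xs)))
    where
    regroup : ∀ x y z lp lq b l → x + b + suc l + (lp + lq + 1 + z + y) ≡ x + lp + (z + lq) + 1 + (y + b + l + 0 + 1) + 0
    regroup = solve-∀

  -- The edge from `v` to `u` closes the walk to a cycle, which is then cut open just before `w`.
  rotate : ∀ {u v w xs} → Walk u v xs → Adj v u → w ∈ xs → ∃[ z ] ∃[ ys ] Walk w z ys × ys ↭ xs
  rotate p a w∈ with walk-split p w∈
  ... | inj₁ refl = _ , _ , p , ↭-refl
  ... | inj₂ (ys , zs , x , refl , q , _ , r) = x , zs ++ ys , walk-join r a q , Perm.++-comm zs ys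

  Unique-resp-↭ : ∀ {xs ys : List V} → xs ↭ ys → Unique xs → Unique ys
  Unique-resp-↭ perm = PermSetoid.Unique-resp-↭ (setoid V) (Perm.↭⇒↭ₛ perm)

  -- Pósa's argument: the ends of a longest path have their neighbours on the
  -- path, so if it has few vertices it closes up to a cycle, and maximality
  -- cuts the cycle off from the rest of X.
  longest-path-closed : ∀ X d k → (∀ v → X v ≡ true → d < deg X v) → k ≤ 2 + 2 * d →
    (p : HasPath X k) → ¬ HasPath X (suc k) →
    ∀ {x y} → x ∈ proj₁ p → (X ∖ proj₁ p) y ≡ true → adj G x y ≡ false
  longest-path-closed X d k mindeg k≤ (xs , len , (u , v , w) , uniq , ins) max {x} {y} x∈ y∈
    with cross? u v w
  ... | inj₂ few = contradiction few (<⇒≱ (begin-strict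
        a? u u + a? v v + length xs      ≡⟨ cong₂ (λ a b → ⟦ a ⟧ + ⟦ b ⟧ + length xs) (adj-irrefl G u) (adj-irrefl G v) ⟩
        length xs                        ≡⟨ len ⟩
        k                                ≤⟨ k≤ ⟩
        2 + 2 * d                        ≡⟨ regroup d ⟩
        suc d + suc d                    ≤⟨ +-mono-≤ (mindeg u (All.lookup ins (head∈ w))) (mindeg v (All.lookup ins (last∈ w))) ⟩
        deg X u + deg X v                ≤⟨ +-mono-≤ (Σₛ-≤lsum X xs (a? u) uEnd) (Σₛ-≤lsum X xs (a? v) vEnd) ⟩
        ladj u xs + ladj v xs            <⟨ ≤-reflexive (+-comm 1 _) ⟩
        ladj u xs + ladj v xs + 1        ∎))
    where
    open ≤-Reasoning
    regroup : ∀ d → 2 + 2 * d ≡ suc d + suc d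
    regroup = solve-∀
    extend : ∀ {s t z zs} → Walk s t zs → zs ↭ xs → X z ≡ true → Adj s z → z ∈ xs
    extend {z = z} {zs} q perm Xz a with z ∈? xs
    ... | yes z∈ = z∈
    ... | no z∉ = contradiction
          (z ∷ zs , cong suc (trans (Perm.↭-length perm) len) , (z , _ , adj-comm a ∷ q) ,
           All.tabulate (λ {t} t∈ z≡t → z∉ (Perm.∈-resp-↭ perm (subst (_∈ zs) (sym z≡t) t∈))) ∷ Unique-resp-↭ (↭-sym perm) uniq ,
           Xz ∷ Perm.All-resp-↭ (↭-sym perm) ins) max
    uEnd : ∀ z → X z ≡ true → 1 ≤ a? u z → z ∈ xs
    uEnd z Xz pos = extend w ↭-refl Xz (⟦⟧>0 _ pos)
    vEnd : ∀ z → X z ≡ true → 1 ≤ a? v z → z ∈ xs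
    vEnd z Xz pos = extend (walk-reverse w) (Perm.↭-reverse xs) Xz (⟦⟧>0 _ pos)
  ... | inj₁ (crossing {ys = ys} {zs} refl front link back p~ q~) with adj G x y in eq
  ...   | false = refl
  ...   | true = contradiction
            (y ∷ proj₁ (proj₂ rot) , cong suc (trans (Perm.↭-length perm) len) ,
             (y , _ , adj-comm eq ∷ proj₁ (proj₂ (proj₂ rot))) ,
             All.tabulate (λ {t} t∈ y≡t → proj₂ (∈∖⁻ X (ys ++ zs) y∈) (Perm.∈-resp-↭ perm (subst (_∈ proj₁ (proj₂ rot)) (sym y≡t) t∈))) ∷ Unique-resp-↭ (↭-sym perm) uniq ,
             proj₁ (∈∖⁻ X (ys ++ zs) y∈) ∷ Perm.All-resp-↭ (↭-sym perm) ins) max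
    where
    cyc = walk-join front (adj-comm q~) (walk-reverse back)
    permᶜ : ys ++ reverse zs ↭ ys ++ zs
    permᶜ = Perm.++⁺ˡ ys (Perm.↭-reverse zs)
    rot = rotate cyc (adj-comm p~) (Perm.∈-resp-↭ (↭-sym permᶜ) x∈)
    perm = ↭-trans (proj₂ (proj₂ (proj₂ rot))) permᶜ

  -- Induction on the order. A vertex of degree at most `d` costs at most `2 * d` and is deleted. If
  -- there is none, a longest path on fewer than `3 + 2 * d` vertices has no edges to the rest, and
  -- even a clique on its vertices has degree sum at most `2 * d + 1` per vertex.
  erdős–gallai : ∀ m d X → # X ≤ m → HasPath X (3 + 2 * d) ⊎ e2 X + # X ≤ 2 * suc d * # X
  erdős–gallai zero d X #X≤0 = inj₂ (subst₂ (λ a b → a + b ≤ 2 * suc d * b) (sym (Σₛ-∅ X (deg X) empty)) (sym #X≡0) z≤n)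
    where
    #X≡0 = n≤0⇒n≡0 #X≤0
    empty = #-empty X #X≡0
  erdős–gallai (suc m) d X #X≤ with Fin.any? (λ v → (X v Bool.≟ true) ×-dec (deg X v ≤? d))
  ... | yes (v , Xv , dv) with erdős–gallai m d (X - v) (s≤s⁻¹ (subst (_≤ suc m) (#-remove X Xv) #X≤))
  ...   | inj₁ p = inj₁ (HasPath-⊆ (λ u h → proj₁ (∈-⁻ X v h)) p)
  ...   | inj₂ h rewrite e2-remove X Xv | #-remove X Xv =
          inj₂ (lin 1 (h ⊕ *-monoʳ-≤ 2 dv) (regroup d (deg X v) (e2 (X - v)) (# (X - v))))
    where
    regroup : ∀ d x e k → 2 * suc d * suc k + (e + k + 2 * x) ≡ 2 * x + e + suc k + (2 * suc d * k + 2 * d) + 1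
    regroup = solve-∀
  erdős–gallai (suc m) d X #X≤ | no none with # X in #X
  ... | zero = inj₂ (subst₂ (λ a b → a + 0 ≤ b) (sym (Σₛ-∅ X (deg X) (#-empty X #X))) (sym (*-zeroʳ (2 * suc d))) z≤n)
  ... | suc k₀ with #-pos X (subst (1 ≤_) (sym #X) (s≤s z≤n))
  ...   | v₀ , Xv₀ with longest (# X) X 1 (≤-reflexive (+-comm 1 (# X))) (v₀ ∷ [] , refl , (v₀ , v₀ , [ v₀ ]) , [] ∷ [] , Xv₀ ∷ [])
  ...     | k , p@(xs , len , w , u , i) , max with 3 + 2 * d ≤? k
  ...       | yes long = let ys , len′ , q , _ = path-shorten (3 + 2 * d) (s≤s z≤n) (≤-trans long (≤-reflexive (sym len))) (w , u , i)
                         in inj₁ (ys , len′ , q)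
  ...       | no short with erdős–gallai m d (X ∖ xs) smaller
    where
    xs≥1 = walk-nonempty (proj₂ (proj₂ w))
    smaller : # (X ∖ xs) ≤ m
    smaller = lin 0 (≤-reflexive (sym (#-removeL X xs u i)) ⊕ ≤-reflexive #X ⊕ #X≤ ⊕ xs≥1)
      (regroup m (# (X ∖ xs)) (length xs) (# X) k₀)
      where
      regroup : ∀ m r l x k → m + (l + r + x + suc k + 1) ≡ r + (x + suc k + suc m + l) + 0
      regroup = solve-∀
  ...         | inj₁ q = inj₁ (HasPath-⊆ (∖⊆ X xs) q)
  ...         | inj₂ h = inj₂ (subst (λ a → e2 X + a ≤ 2 * suc d * a) (trans (sym eqX) #X) bound)
    where
    R = X ∖ xs
    k≤ : k ≤ 2 + 2 * d
    k≤ = s≤s⁻¹ (≰⇒> short)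
    mindeg : ∀ v → X v ≡ true → d < deg X v
    mindeg v Xv = ≰⇒> (λ le → none (v , Xv , le))
    closed : ∀ v → R v ≡ true → ladj v xs ≤ 0
    closed v Rv = ≤-trans (lsum-mono {g = λ _ → 0} xs (All.tabulate λ {x} x∈ →
        ≤-reflexive (cong ⟦_⟧ (trans (adj-sym G v x) (longest-path-closed X d k mindeg k≤ p max x∈ Rv)))))
      (≤-reflexive (lsum-const 0 xs))
    cut : lsum (deg R) xs ≤ 0
    cut = ≤-trans (≤-reflexive (lsum-deg R xs)) (Σₛ-≤const R 0 closed)
    eqX : # X ≡ length xs + # R
    eqX = #-removeL X xs u i
    bound : e2 X + (length xs + # R) ≤ 2 * suc d * (length xs + # R)
    bound = lin 0 (e2-cross xs X u i ⊕ ≤-reflexive (tri+ (length xs)) ⊕ *-monoˡ-≤ (length xs) (≤-trans (≤-reflexive len) k≤) ⊕ *-monoʳ-≤ 2 cut ⊕ h)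
      (regroup (e2 X) (length xs) (# R) (tri (length xs)) (lsum (deg R) xs) (e2 R) d)
      where
      regroup : ∀ e l r t s f d →
        2 * suc d * (l + r) + (e + (t + l) + l * l + 2 * s + (f + r)) ≡
        e + (l + r) + (t + 2 * s + f + l * l + (2 + 2 * d) * l + 0 + 2 * suc d * r) + 0
      regroup = solve-∀

-- Linear forests and common neighbourhoods

filter-split : ∀ {A : Set} {P : A → Set} (P? : ∀ x → Dec (P x)) xs →
               length (filter P? xs) + length (filter (¬? ∘ P?) xs) ≡ length xs
filter-split P? [] = refl
filter-split P? (x ∷ xs) with P? x
... | yes _ = cong suc (filter-split P? xs)
... | no  _ = trans (+-suc _ _) (cong suc (filter-split P? xs))

AllPairs-map-singleton : ∀ {A : Set} {xs : List A} → Unique xs → AllPairs Disjoint (map (_∷ []) xs)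
AllPairs-map-singleton []       = []
AllPairs-map-singleton (p ∷ ps) = All.map⁺ (All.map (λ x≢ → λ { (here refl , here eq) → x≢ eq }) p) ∷ AllPairs-map-singleton ps

unique-⊆-length : ∀ {n} {xs ys : List (Fin n)} → Unique xs → (∀ {v} → v ∈ xs → v ∈ ys) → length xs ≤ length ys
unique-⊆-length {xs = xs} {ys} u sub = ≤-trans
  (length≤# Y xs u (All.tabulate (λ v∈ → dec-true (_ ∈? ys) (sub v∈))))
  (≤-trans (Σₛ-≤lsum Y ys _ inY) (≤-reflexive (trans (lsum-const 1 ys) (*-identityˡ _))))
  where
  Y = λ v → does (v ∈? ys)
  inY : ∀ v → Y v ≡ true → 1 ≤ 1 → v ∈ ys
  inY v h _ with v ∈? ys
  ... | yes v∈ = v∈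

infix 5 _∖∖_
_∖∖_ : ∀ {n} → List (Fin n) → List (Fin n) → List (Fin n)
ws ∖∖ U = filter (λ v → ¬? (v ∈? U)) ws

module _ {n : ℕ} where

  ∖∖-length : ∀ {ws U : List (Fin n)} → Unique ws → length ws ≤ length (ws ∖∖ U) + length U
  ∖∖-length {ws} {U} u = begin
    length ws                                                     ≡⟨ sym (filter-split (_∈? U) ws) ⟩
    length (filter (_∈? U) ws) + length (ws ∖∖ U)                 ≤⟨ +-monoˡ-≤ _ (unique-⊆-length (Unique.filter⁺ (_∈? U) u) (λ v∈ → proj₂ (∈-filter⁻ (_∈? U) {xs = ws} v∈))) ⟩
    length U + length (ws ∖∖ U)                                   ≡⟨ +-comm (length U) _ ⟩
    length (ws ∖∖ U) + length U                                   ∎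
    where open ≤-Reasoning

  ∖∖-disjoint : ∀ {ws} (U : List (Fin n)) → Disjoint (ws ∖∖ U) U
  ∖∖-disjoint {ws} U (v∈ , v∈U) = proj₂ (∈-filter⁻ (λ v → ¬? (v ∈? U)) {xs = ws} v∈) v∈U

  ∖∖-⊆ : ∀ {ws U : List (Fin n)} {v} → v ∈ ws ∖∖ U → v ∈ ws
  ∖∖-⊆ {ws} {U} v∈ = proj₁ (∈-filter⁻ (λ v → ¬? (v ∈? U)) {xs = ws} v∈)

-- The order of the longest path that `b` connectors carry when they alternate with single common
-- neighbours. A path on ℓ vertices with ⌊ℓ/2⌋ = b is part of it, so bounds need to be proved for
-- these orders only.
odd : ℕ → ℕ
odd b = suc (2 * b)

≤odd-half : ∀ ℓ → ℓ ≤ odd ⌊ ℓ /2⌋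
≤odd-half 0             = z≤n
≤odd-half 1             = s≤s z≤n
≤odd-half (suc (suc ℓ)) = lin 0 (≤odd-half ℓ) (regroup ℓ ⌊ ℓ /2⌋)
  where
  regroup : ∀ l h → suc (2 * suc h) + l ≡ suc (suc l) + suc (2 * h) + 0
  regroup = solve-∀

halves : List ℕ → List ℕ
halves = map ⌊_/2⌋

module Forests {n : ℕ} (G : Graph n) where
  open Counting G public

  data Forest (X : VSet n) : List ℕ → List V → Set where
    []   : Forest X [] []
    cons : ∀ {xs U ℓ ls} → IsPath X xs → length xs ≡ ℓ → Forest X ls U → Disjoint xs U →
           Forest X (ℓ ∷ ls) (xs ++ U)

  HasForest : VSet n → List ℕ → Set
  HasForest X ls = ∃[ U ] Forest X ls U

  forest-length : ∀ {X ls U} → Forest X ls U → length U ≡ total ls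
  forest-length []                         = refl
  forest-length (cons {xs} {U} _ len f _)  = trans (List.length-++ xs) (cong₂ _+_ len (forest-length f))

  forest-inside : ∀ {X ls U} → Forest X ls U → Inside X U
  forest-inside []                         = []
  forest-inside (cons (_ , _ , i) _ f _)   = All.++⁺ i (forest-inside f)

  forest-⊆ : ∀ {X Y ls U} → X ⊆ Y → Forest X ls U → Forest Y ls U
  forest-⊆ h []                          = []
  forest-⊆ h (cons (w , u , i) len f d)  = cons (w , u , Inside-⊆ h i) len (forest-⊆ h f) d

  HasForest-⊆ : ∀ {X Y ls} → X ⊆ Y → HasForest X ls → HasForest Y ls
  HasForest-⊆ h (U , f) = U , forest-⊆ h f

  disjoint-++ʳ : ∀ {xs ys zs : List V} → Disjoint xs ys → Disjoint xs zs → Disjoint xs (ys ++ zs)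
  disjoint-++ʳ {ys = ys} d e (v∈ , v∈′) with ∈-++⁻ ys v∈′
  ... | inj₁ h = d (v∈ , h)
  ... | inj₂ h = e (v∈ , h)

  forest-↭ : ∀ {X ls ls′ U} → ls ↭ ls′ → Forest X ls U →
             ∃[ U′ ] Forest X ls′ U′ × (∀ {v} → v ∈ U′ → v ∈ U)
  forest-↭ Perm.refl f = _ , f , id
  forest-↭ (prep x p) (cons {xs} q len f d) with forest-↭ p f
  ... | U′ , f′ , sub = xs ++ U′ , cons q len f′ (λ (a , b) → d (a , sub b)) , incl
    where
    incl : ∀ {v} → v ∈ xs ++ U′ → v ∈ xs ++ _
    incl v∈ with ∈-++⁻ xs v∈
    ... | inj₁ h = ∈-++⁺ˡ h
    ... | inj₂ h = ∈-++⁺ʳ xs (sub h)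
  forest-↭ (swap x y p) (cons {xs} q len (cons {ys} q′ len′ f d′) d) with forest-↭ p f
  ... | U′ , f′ , sub = ys ++ (xs ++ U′) ,
      cons q′ len′ (cons q len f′ (λ (a , b) → d (a , ∈-++⁺ʳ ys (sub b))))
        (disjoint-++ʳ (λ (a , b) → d (b , ∈-++⁺ˡ a)) (λ (a , b) → d′ (a , sub b))) , incl
    where
    incl : ∀ {v} → v ∈ ys ++ (xs ++ U′) → v ∈ xs ++ (ys ++ _)
    incl v∈ with ∈-++⁻ ys v∈
    ... | inj₁ h = ∈-++⁺ʳ xs (∈-++⁺ˡ h)
    ... | inj₂ h with ∈-++⁻ xs h
    ...   | inj₁ k = ∈-++⁺ˡ k
    ...   | inj₂ k = ∈-++⁺ʳ xs (∈-++⁺ʳ ys (sub k))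
  forest-↭ (Perm.trans p q) f =
    let U′ , f′ , sub = forest-↭ p f ; U″ , f″ , sub′ = forest-↭ q f′ in U″ , f″ , sub ∘ sub′

  HasForest-↭ : ∀ {X ls ls′} → ls ↭ ls′ → HasForest X ls → HasForest X ls′
  HasForest-↭ p (U , f) = let U′ , f′ , _ = forest-↭ p f in U′ , f′

  forest-shorten : ∀ {X U} ls → All (1 ≤_) ls → Forest X (map odd (halves ls)) U →
                   ∃[ U′ ] Forest X ls U′ × (∀ {v} → v ∈ U′ → v ∈ U)
  forest-shorten [] [] [] = [] , [] , id
  forest-shorten (ℓ ∷ ls) (p ∷ ps) (cons {xs} {U} q len f d)
    with path-shorten ℓ p (≤-trans (≤odd-half ℓ) (≤-reflexive (sym len))) q | forest-shorten ls ps f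
  ... | ys , len′ , q′ , sub | U′ , f′ , sub′ =
    ys ++ U′ , cons q′ len′ f′ (λ (a , b) → d (sub a , sub′ b)) , incl
    where
    incl : ∀ {v} → v ∈ ys ++ U′ → v ∈ xs ++ U
    incl v∈ with ∈-++⁻ ys v∈
    ... | inj₁ h = ∈-++⁺ˡ (sub h)
    ... | inj₂ h = ∈-++⁺ʳ xs (sub′ h)

  HasForest-shorten : ∀ {X} ls → All (1 ≤_) ls → HasForest X (map odd (halves ls)) → HasForest X ls
  HasForest-shorten ls h (U , f) = let U′ , f′ , _ = forest-shorten ls h f in U′ , f′

  -- Long paths alternate between connectors and disjoint pieces: `Seg` is the passage through an
  -- inner piece, `Tail` the end inside the first or last piece.
  Seg : List V → V → V → Set
  Seg K c c′ = ∃[ u ] ∃[ v ] ∃[ xs ] Adj c u × Walk u v xs × Adj v c′ × Unique xs × (∀ {z} → z ∈ xs → z ∈ K)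

  Tail : ℕ → List V → V → Set
  Tail h K c = ∃[ u ] ∃[ v ] ∃[ xs ] Adj c u × Walk u v xs × Unique xs × (∀ {z} → z ∈ xs → z ∈ K) × h ≤ length xs

  -- Every connector and every inner piece contributes at least one vertex. That the path stays
  -- within connectors and pieces is expressed by the predicates it inherits; the recursion applies
  -- this to `c ≢_` and `_∉ K` to see that the part in front is disjoint from the rest.
  bridge : ∀ N h c cs Ks Kl → Unique (c ∷ cs) → All (_∈ N) (c ∷ cs) → length cs ≤ length Ks →
    All (λ K → ∀ c c′ → c ∈ N → c′ ∈ N → Seg K c c′) Ks → (∀ {c} → c ∈ N → Tail h Kl c) →
    AllPairs Disjoint (Kl ∷ Ks) → All (λ K → Disjoint K N) Ks → Disjoint Kl N →
    ∃[ y ] ∃[ xs ] Walk c y xs × Unique xs × suc (2 * length cs) + h ≤ length xs ×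
      (∀ (P : V → Set) → All P (c ∷ cs) → All (All P) Ks → All P Kl → All P xs)
  bridge N h c [] Ks Kl _ (c∈ ∷ _) _ _ tail _ _ dl =
    let u , v , xs , a , w , uq , sub , len = tail c∈
    in v , c ∷ xs , a ∷ w ,
       All.tabulate (λ z∈ c≡z → dl (sub z∈ , subst (_∈ N) c≡z c∈)) ∷ uq , s≤s len ,
       λ P pc _ pl → All.head pc ∷ All.tabulate (λ z∈ → All.lookup pl (sub z∈))
  bridge N h c (c′ ∷ cs) (K ∷ Ks) Kl (pc ∷ uc) (c∈ ∷ cs∈) (s≤s len) (seg ∷ segs) tail ((dlK ∷ dls) ∷ (dK ∷ dKs)) (dN ∷ dNs) dl
    with seg c c′ c∈ (All.head cs∈) | bridge N h c′ cs Ks Kl uc cs∈ len segs tail (dls ∷ dKs) dNs dl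
  ... | u , v , xs , a , w , b , ux , sub | y , ys , w′ , uy , len′ , cont =
    y , c ∷ (xs ++ ys) , a ∷ walk-join w b w′ ,
    All.++⁺ c∉xs c∉ys ∷ Unique.++⁺ ux uy disj , long , λ P pcs pKs pl →
      All.head pcs ∷ All.++⁺ (All.tabulate (λ z∈ → All.lookup (All.head pKs) (sub z∈)))
                             (cont P (All.tail pcs) (All.tail pKs) pl)
    where
    c∉xs : All (c ≢_) xs
    c∉xs = All.tabulate (λ z∈ c≡z → dN (sub z∈ , subst (_∈ N) c≡z c∈))
    c∉ys : All (c ≢_) ys
    c∉ys = cont (c ≢_) pc (All.map (λ d → All.tabulate (λ z∈ c≡z → d (z∈ , subst (_∈ N) c≡z c∈))) dNs)
                (All.tabulate (λ z∈ c≡z → dl (z∈ , subst (_∈ N) c≡z c∈)))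
    avoidsK : All (_∉ K) ys
    avoidsK = cont (_∉ K) (All.map (λ z∈N z∈K → dN (z∈K , z∈N)) cs∈)
                   (All.map (λ d → All.tabulate (λ z∈ z∈K → d (z∈K , z∈))) dK)
                   (All.tabulate (λ z∈ z∈K → dlK (z∈ , z∈K)))
    disj : Disjoint xs ys
    disj (z∈xs , z∈ys) = All.lookup avoidsK z∈ys (sub z∈xs)
    long : suc (2 * suc (length cs)) + h ≤ suc (length (xs ++ ys))
    long = lin 0 (walk-nonempty w ⊕ len′ ⊕ ≤-reflexive (sym (List.length-++ xs {ys}))) (regroup (length xs) (length ys) (length (xs ++ ys)) (length cs) h)
      where
      regroup : ∀ x y z k h → suc z + (1 + (suc (2 * k) + h) + (x + y)) ≡ suc (2 * suc k) + h + (x + y + z) + 0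
      regroup = solve-∀

  span : ∀ N h₀ h c cs K₀ Ks Kl → Unique (c ∷ cs) → All (_∈ N) (c ∷ cs) → length cs ≤ length Ks →
    Tail h₀ K₀ c →
    All (λ K → ∀ c c′ → c ∈ N → c′ ∈ N → Seg K c c′) Ks → (∀ {c} → c ∈ N → Tail h Kl c) →
    AllPairs Disjoint (K₀ ∷ Kl ∷ Ks) → All (λ K → Disjoint K N) Ks → Disjoint Kl N → Disjoint K₀ (c ∷ cs) →
    ∃[ xs ] (∃[ u ] ∃[ v ] Walk u v xs) × Unique xs × h₀ + (suc (2 * length cs) + h) ≤ length xs ×
      (∀ (P : V → Set) → All P (c ∷ cs) → All P K₀ → All (All P) Ks → All P Kl → All P xs)
  span N h₀ h c cs K₀ Ks Kl uc cs∈ len (u , v , xs , a , w , ux , sub , h₀≤) segs tail ((d₀l ∷ d₀) ∷ ds) dNs dl d₀N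
    with bridge N h c cs Ks Kl uc cs∈ len segs tail ds dNs dl
  ... | y , ys , w′ , uy , len′ , cont =
    reverse xs ++ ys , (v , y , walk-join (walk-reverse w) (adj-comm a) w′) ,
    Unique.++⁺ (Unique-resp-↭ (↭-sym (Perm.↭-reverse xs)) ux) uy disj ,
    ≤-trans (+-mono-≤ (≤-trans h₀≤ (≤-reflexive (sym (List.length-reverse xs)))) len′) (≤-reflexive (sym (List.length-++ (reverse xs)))) ,
    λ P pc p₀ pK pl → All.++⁺ (Perm.All-resp-↭ (↭-sym (Perm.↭-reverse xs)) (All.tabulate (λ z∈ → All.lookup p₀ (sub z∈)))) (cont P pc pK pl)
    where
    avoids : All (_∉ K₀) ys
    avoids = cont (_∉ K₀) (All.tabulate (λ z∈ z∈K → d₀N (z∈K , z∈)))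
      (All.map (λ d → All.tabulate (λ z∈ z∈K → d (z∈K , z∈))) d₀)
      (All.tabulate (λ z∈ z∈K → d₀l (z∈K , z∈)))
    disj : Disjoint (reverse xs) ys
    disj (z∈xs , z∈ys) = All.lookup avoids z∈ys (sub (Perm.∈-resp-↭ (Perm.↭-reverse xs) z∈xs))

  -- A complete bipartite subgraph with sides `A`, the connectors, and `ws`, a supply of common
  -- neighbours.
  record Hub (X : VSet n) (A ws : List V) : Set where
    field
      A-unique  : Unique A
      ws-unique : Unique ws
      A-inside  : Inside X A
      ws-inside : Inside X ws
      joined    : ∀ {a w} → a ∈ A → w ∈ ws → Adj a w

  open Hub public

  Hub-⊆ : ∀ {X Y A ws} → X ⊆ Y → Hub X A ws → Hub Y A ws
  Hub-⊆ h H = record { A-unique = A-unique H ; ws-unique = ws-unique H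
    ; A-inside = Inside-⊆ h (A-inside H) ; ws-inside = Inside-⊆ h (ws-inside H) ; joined = joined H }

  hub-∖∖ : ∀ {X A ws} U → Hub X A ws → Hub X A (ws ∖∖ U)
  hub-∖∖ U H = record { A-unique = A-unique H ; ws-unique = Unique.filter⁺ _ (ws-unique H)
    ; A-inside = A-inside H ; ws-inside = All.filter⁺ _ (ws-inside H)
    ; joined = λ a∈ w∈ → joined H a∈ (∖∖-⊆ {U = U} w∈) }

  hub-restrict : ∀ {X A ws A′} → Unique A′ → (∀ {v} → v ∈ A′ → v ∈ A) → Hub X A ws → Hub X A′ ws
  hub-restrict u sub H = record { A-unique = u ; ws-unique = ws-unique H
    ; A-inside = All.tabulate (λ v∈ → All.lookup (A-inside H) (sub v∈)) ; ws-inside = ws-inside H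
    ; joined = λ a∈ → joined H (sub a∈) }

  hub-disjoint : ∀ {X A ws} → Hub X A ws → Disjoint ws A
  hub-disjoint H (v∈ws , v∈A) = adj-≢ (joined H v∈A v∈ws) refl

  -- The common neighbours that lie in neither end piece serve as inner pieces of one vertex each.
  hub-span : ∀ {X c cs ws} h₀ h K₀ Kl → Hub X (c ∷ cs) ws → length cs + (length K₀ + length Kl) ≤ length ws →
    Tail h₀ K₀ c → (∀ {a} → a ∈ c ∷ cs → Tail h Kl a) → Disjoint K₀ Kl → Disjoint K₀ (c ∷ cs) → Disjoint Kl (c ∷ cs) →
    Inside X K₀ → Inside X Kl →
    ∃[ xs ] IsPath X xs × h₀ + (suc (2 * length cs) + h) ≤ length xs ×
      (∀ (P : V → Set) → All P (c ∷ cs) → All P K₀ → All P Kl → All P ws → All P xs)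
  hub-span {X} {c} {cs} {ws} h₀ h K₀ Kl H len t₀ tl d₀l d₀ dl i₀ il =
    let xs , w , u , long , cont = spanned in xs , (w , u , cont′ cont (λ v → X v ≡ true) (A-inside H) i₀ il (ws-inside H)) , long , cont′ cont
    where
    N = c ∷ cs
    ws′ = ws ∖∖ (K₀ ++ Kl)
    H′ : Hub X N ws′
    H′ = hub-∖∖ (K₀ ++ Kl) H
    Ks = map (_∷ []) ws′
    enough : length cs ≤ length Ks
    enough = lin 0 (len ⊕ ∖∖-length {ws = ws} {K₀ ++ Kl} (ws-unique H) ⊕ ≤-reflexive (List.length-++ K₀ {Kl}) ⊕ ≤-reflexive (sym (List.length-map (_∷ []) ws′)))
      (regroup (length cs) (length K₀) (length Kl) (length ws) (length ws′) (length (K₀ ++ Kl)) (length Ks))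
      where
      regroup : ∀ c k l w w′ kl m → m + (c + (k + l) + w + kl + w′) ≡ c + (w + (w′ + kl) + (k + l) + m) + 0
      regroup = solve-∀
    segs : All (λ K → ∀ c₁ c₂ → c₁ ∈ N → c₂ ∈ N → Seg K c₁ c₂) Ks
    segs = All.map⁺ (All.tabulate (λ {w} w∈ _ _ c∈ c′∈ → w , w , w ∷ [] , joined H′ c∈ w∈ , [ w ] , adj-comm (joined H′ c′∈ w∈) , [] ∷ [] , id))
    d₀s : All (Disjoint K₀) Ks
    d₀s = All.map⁺ (All.tabulate (λ {w} w∈ → λ { (z∈ , here refl) → ∖∖-disjoint {ws = ws} (K₀ ++ Kl) (w∈ , ∈-++⁺ˡ z∈) }))
    dls : All (Disjoint Kl) Ks
    dls = All.map⁺ (All.tabulate (λ {w} w∈ → λ { (z∈ , here refl) → ∖∖-disjoint {ws = ws} (K₀ ++ Kl) (w∈ , ∈-++⁺ʳ K₀ z∈) }))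
    dNs : All (λ K → Disjoint K N) Ks
    dNs = All.map⁺ (All.tabulate (λ w∈ → λ { (here refl , z∈) → hub-disjoint H′ (w∈ , z∈) }))
    Contained : List V → Set₁
    Contained xs = ∀ (P : V → Set) → All P N → All P K₀ → All (All P) Ks → All P Kl → All P xs
    spanned : ∃[ xs ] (∃[ u ] ∃[ v ] Walk u v xs) × Unique xs × h₀ + (suc (2 * length cs) + h) ≤ length xs × Contained xs
    spanned = span N h₀ h c cs K₀ Ks Kl (A-unique H) (All.tabulate id) enough t₀ segs tl
              ((d₀l ∷ d₀s) ∷ dls ∷ AllPairs-map-singleton (ws-unique H′)) dNs dl d₀
    cont′ : ∀ {xs} → Contained xs → ∀ (P : V → Set) → All P N → All P K₀ → All P Kl → All P ws → All P xs
    cont′ cont P pc p₀ pl pw = cont P pc p₀ (All.map⁺ (All.map (_∷ []) (All.filter⁺ (λ v → ¬? (v ∈? (K₀ ++ Kl))) pw))) pl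

  -- Two common neighbours form the ends, others separate consecutive connectors. Without connectors
  -- a single vertex is the required path of order `odd 0`.
  hub-path : ∀ {X A ws} → Hub X A ws → suc (suc (length A)) ≤ length ws →
    ∃[ xs ] IsPath X xs × odd (length A) ≤ length xs × (∀ (P : V → Set) → All P A → All P ws → All P xs)
  hub-path {A = []} {ws = w ∷ _} H _ =
    w ∷ [] , ((w , w , [ w ]) , [] ∷ [] , All.head (ws-inside H) ∷ []) , s≤s z≤n , λ P _ pw → All.head pw ∷ []
  hub-path {X = X} {A = c ∷ cs} {ws = w₀ ∷ w₁ ∷ ws} H (s≤s (s≤s len)) =
    let xs , p , long , cont = spanned in
    xs , p , ≤-trans (≤-reflexive (regroup (length cs))) long ,
    λ P pc pw → cont P pc (All.head pw ∷ []) (All.head (All.tail pw) ∷ []) pw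
    where
    single : ∀ {a w} → a ∈ c ∷ cs → w ∈ w₀ ∷ w₁ ∷ ws → Tail 1 (w ∷ []) a
    single {w = w} a∈ w∈ = w , w , w ∷ [] , joined H a∈ w∈ , [ w ] , [] ∷ [] , id , s≤s z≤n
    w₀≢w₁ : w₀ ≢ w₁
    w₀≢w₁ = All.head (AllPairs.head (ws-unique H))
    spanned : ∃[ xs ] IsPath X xs × 1 + (suc (2 * length cs) + 1) ≤ length xs ×
      (∀ (P : V → Set) → All P (c ∷ cs) → All P (w₀ ∷ []) → All P (w₁ ∷ []) → All P (w₀ ∷ w₁ ∷ ws) → All P xs)
    spanned = hub-span 1 1 (w₀ ∷ []) (w₁ ∷ []) H (≤-trans (≤-reflexive (+-comm (length cs) 2)) (s≤s (s≤s (≤-trans (n≤1+n _) len))))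
           (single (here refl) (here refl)) (λ a∈ → single a∈ (there (here refl)))
           (λ { (here refl , here eq) → w₀≢w₁ eq })
           (λ { (here refl , z∈) → hub-disjoint H (here refl , z∈) })
           (λ { (here refl , z∈) → hub-disjoint H (there (here refl) , z∈) })
           (All.head (ws-inside H) ∷ []) (All.head (All.tail (ws-inside H)) ∷ [])
    regroup : ∀ k → suc (2 * suc k) ≡ 1 + (suc (2 * k) + 1)
    regroup = solve-∀

  add-path : ∀ {X ls U m xs} → Forest X ls U → IsPath X xs → 1 ≤ m → m ≤ length xs → Disjoint xs U → HasForest X (m ∷ ls)
  add-path {m = m} f p 1≤m m≤ d with path-shorten m 1≤m m≤ p
  ... | ys , len , q , sub = _ , cons q len f (λ (a , b) → d (sub a , b))

  -- The forest avoids the connectors, so it can only use up common neighbours, at most `total ls`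
  -- of them.
  hub-extend : ∀ {X A ws ls U} ℓ → Hub X A ws → Forest X ls U → Disjoint U A →
    1 ≤ ℓ → ℓ ≤ odd (length A) → suc (suc (length A)) + total ls ≤ length ws → HasForest X (ℓ ∷ ls)
  hub-extend {X} {A} {ws} {ls} {U} ℓ H f dUA 1≤ℓ ℓ≤ len with hub-path (hub-∖∖ U H) enough
    where
    enough : suc (suc (length A)) ≤ length (ws ∖∖ U)
    enough = lin 0 (len ⊕ ∖∖-length {ws = ws} {U} (ws-unique H) ⊕ ≤-reflexive (forest-length f)) (regroup (length A) (total ls) (length ws) (length (ws ∖∖ U)) (length U))
      where
      regroup : ∀ a s w x u → x + (suc (suc a) + s + w + u) ≡ suc (suc a) + (w + (x + u) + s) + 0
      regroup = solve-∀
  ... | xs , p , long , cont = add-path f p 1≤ℓ (≤-trans ℓ≤ long) λ (z∈ , z∈U) →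
        All.lookup (cont (_∉ U) (All.tabulate (λ a∈ u∈ → dUA (u∈ , a∈))) (All.tabulate (λ w∈ u∈ → ∖∖-disjoint {ws = ws} U (w∈ , u∈)))) z∈ z∈U

  -- The predicates passed from `Q` to `A` and from `hs` to `ws` stand for inclusion.
  CommonNeighbours : List V → ℕ → ℕ → List V → Set₁
  CommonNeighbours Q b c hs =
    ∃[ A ] ∃[ ws ] length A ≡ b × Unique ws × c ≤ length ws × (Unique Q → Unique A) ×
      (∀ (P : V → Set) → All P Q → All P A) × (∀ (P : V → Set) → All P hs → All P ws) ×
      (∀ {a w} → a ∈ A → w ∈ ws → Adj a w)

  -- Pigeonhole over the possible neighbourhoods in `Q`, one vertex `q` at a time: of the vertices
  -- adjacent to `q` and those not adjacent to it, one class keeps at least half of the required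
  -- number. In the first case `q` is selected, in the second it is dropped and all `b` neighbours
  -- lie further on.
  common-neighbours : ∀ Q b c hs → 1 ≤ c → Unique hs → All (λ v → b ≤ ladj v Q) hs → c * 2 ^ length Q ≤ length hs →
    CommonNeighbours Q b c hs
  common-neighbours Q zero c hs 1≤c u adjs len =
    [] , hs , refl , u , ≤-trans (≤-trans (≤-reflexive (sym (*-identityʳ c))) (*-monoʳ-≤ c (m^n>0 2 (length Q)))) len ,
    (λ _ → []) , (λ _ _ → []) , (λ _ → id) , λ ()
  common-neighbours [] (suc b) c [] 1≤c u adjs len = contradiction (≤-trans 1≤c (≤-trans (≤-reflexive (sym (*-identityʳ c))) len)) λ ()
  common-neighbours [] (suc b) c (h ∷ hs) 1≤c u (() ∷ _) len
  common-neighbours (q ∷ Q) (suc b) c hs 1≤c u adjs len = split (c * 2 ^ length Q ≤? length near)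
    where
    near? = λ v → adj G v q Bool.≟ true
    near = filter near? hs
    far = filter (¬? ∘ near?) hs
    split : Dec (c * 2 ^ length Q ≤ length near) → CommonNeighbours (q ∷ Q) (suc b) c hs
    split (yes many) with common-neighbours Q b c near 1≤c (Unique.filter⁺ near? u)
        (All.tabulate (λ {v} v∈ → let v∈hs , v~q = ∈-filter⁻ near? {xs = hs} v∈ in
           s≤s⁻¹ (subst (λ t → suc b ≤ ⟦ t ⟧ + ladj v Q) v~q (All.lookup adjs v∈hs)))) many
    ... | A , ws , lenA , uw , lw , uA , cA , cw , j =
      q ∷ A , ws , cong suc lenA , uw , lw , (λ { (p ∷ ps) → cA (q ≢_) p ∷ uA ps }) ,
      (λ { P (p ∷ ps) → p ∷ cA P ps }) , (λ P ph → cw P (All.filter⁺ near? ph)) ,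
      λ { (here refl) w∈ → adj-comm (All.lookup (cw (λ w → Adj w q) (All.all-filter near? hs)) w∈) ; (there a∈) w∈ → j a∈ w∈ }
    split (no few) with common-neighbours Q (suc b) c far 1≤c (Unique.filter⁺ (¬? ∘ near?) u)
        (All.tabulate (λ {v} v∈ → let v∈hs , v≁q = ∈-filter⁻ (¬? ∘ near?) {xs = hs} v∈ in
           subst (λ t → suc b ≤ ⟦ t ⟧ + ladj v Q) (not-true⇒false v≁q) (All.lookup adjs v∈hs)))
        (lin 1 (len ⊕ ≰⇒> few ⊕ ≤-reflexive (sym (filter-split near? hs))) (regroup c (2 ^ length Q) (length hs) (length near) (length far)))
      where
      regroup : ∀ c p h x y → y + (c * (2 * p) + suc x + h) ≡ c * p + (h + c * p + (x + y)) + 1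
      regroup = solve-∀
    ... | A , ws , lenA , uw , lw , uA , cA , cw , j =
      A , ws , lenA , uw , lw , (λ { (p ∷ ps) → uA ps }) ,
      (λ { P (p ∷ ps) → cA P ps }) , (λ P ph → cw P (All.filter⁺ (¬? ∘ near?) ph)) , j

-- Edge bounds for graphs without a given linear forest

altC : ℕ → ℕ → ℕ → ℕ
altC c b C = tri (odd b) + 2 * odd b * (c * 2 ^ odd b) + C + 3 * odd b

-- The first argument of `altC` is the number of common neighbours that `hub-extend` asks for. The
-- final `b` pays for the `b` connectors, which are counted in the order of the graph but not in the
-- order of what remains after their deletion.
ubC : List ℕ → ℕ
ubC []       = 0
ubC (b ∷ bs) = altC (2 + b + total (map odd bs)) b (ubC bs) + b

module Bounds {n : ℕ} (G : Graph n) where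
  open Forests G public

  odd-path : ∀ b X → 1 ≤ b → HasPath X (odd b) ⊎ e2 X + # X ≤ 2 * b * # X
  odd-path (suc d) X _ = [ inj₁ ∘ subst (HasPath X) (regroup d) , inj₂ ]′ (erdős–gallai (# X) d X ≤-refl)
    where
    regroup : ∀ d → 3 + 2 * d ≡ odd (suc d)
    regroup d = sym (cong (λ m → suc (suc m)) (+-suc d (d + 0)))

  ladj≤length : ∀ v Q → ladj v Q ≤ length Q
  ladj≤length v Q = ≤-trans (lsum-mono {g = λ _ → 1} Q (All.tabulate (λ {w} _ → ⟦⟧≤1 (adj G v w))))
    (≤-reflexive (trans (lsum-const 1 Q) (*-identityˡ (length Q))))

  -- An upper bound on the edges: the average degree is at most `2 * B - k`, up to the constant `C`.
  -- The average of the extremal structure for a forest with halves summing to `B` is `2 * B - 2`,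
  -- so `k = 1` just fails to exclude it and `k = 3` excludes it.
  Dense : ℕ → ℕ → ℕ → VSet n → Set
  Dense k B C X = e2 X + k * # X ≤ 2 * B * # X + C

  UpperBound : List ℕ → ℕ → Set
  UpperBound bs C = ∀ Y → ¬ HasForest Y (map odd bs) → Dense 1 (total bs) C Y

  HasHub : VSet n → ℕ → ℕ → Set
  HasHub X b c = ∃[ A ] ∃[ ws ] Hub X A ws × length A ≡ b × c ≤ length ws

  -- Among the vertices off a fixed path, count those with b neighbours on it: if
  -- there are many, b vertices of the path share many neighbours; if there are
  -- few, the path meets few edges.
  alternative : ∀ b bs c C X → 1 ≤ b → 1 ≤ c → UpperBound bs C → ¬ HasForest X (map odd (b ∷ bs)) →
    Dense 1 b 0 X ⊎ HasHub X b c ⊎ Dense 3 (b + total bs) (altC c b C) X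
  alternative (suc d) bs c C X 1≤b 1≤c ub free with odd-path (suc d) X 1≤b
  ... | inj₂ sparse = inj₁ (lin 0 sparse (regroup (e2 X) (# X) (2 * suc d * # X)))
    where
    regroup : ∀ e x y → y + 0 + (e + x) ≡ e + 1 * x + y + 0
    regroup = solve-∀
  ... | inj₁ (Q , lenQ , path@(w , u , i)) = decide (c * 2 ^ length Q ≤? length hs)
    where
    b = suc d
    R = X ∖ Q
    Rich : VSet n
    Rich v = does (b ≤? ladj v Q)
    hs = elems (R ∩ Rich)
    R-free : ¬ HasForest R (map odd bs)
    R-free (U , f) = free (_ , cons path lenQ (forest-⊆ (∖⊆ X Q) f)
      λ (z∈Q , z∈U) → Inside-∖-disjoint X Q (forest-inside f) (z∈U , z∈Q))
    decide : Dec (c * 2 ^ length Q ≤ length hs) →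
      Dense 1 b 0 X ⊎ HasHub X b c ⊎ Dense 3 (b + total bs) (altC c b C) X
    decide (yes many) = inj₂ (inj₁ (A , ws , H , lenA , c≤))
      where
      big : ∀ {v} → (R ∩ Rich) v ≡ true → b ≤ ladj v Q
      big {v} h = does⁻ (b ≤? ladj v Q) (proj₂ (∧-true⁻ (R v) h))
      found = common-neighbours Q b c hs 1≤c (elems-unique (R ∩ Rich)) (All.map big (elems-inside (R ∩ Rich))) many
      A = proj₁ found
      ws = proj₁ (proj₂ found)
      lenA = proj₁ (proj₂ (proj₂ found))
      rest = proj₂ (proj₂ (proj₂ found))
      c≤ = proj₁ (proj₂ rest)
      H : Hub X A ws
      H = record
        { A-unique  = proj₁ (proj₂ (proj₂ rest)) u
        ; ws-unique = proj₁ rest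
        ; A-inside  = proj₁ (proj₂ (proj₂ (proj₂ rest))) _ i
        ; ws-inside = Inside-∖⁻ X Q (proj₁ (proj₂ (proj₂ (proj₂ (proj₂ rest)))) _
                        (All.map (λ {v} h → proj₁ (∧-true⁻ (R v) h)) (elems-inside (R ∩ Rich))))
        ; joined    = proj₂ (proj₂ (proj₂ (proj₂ (proj₂ rest))))
        }
    -- A vertex of `R` accounts for at most `2 * d` through the path and, by `ub`, for
    -- `2 * total bs - 1` inside `R`; together this is three below `2 * (b + total bs)`. The
    -- constant collects the edges inside the path, those to the rich vertices, `C`, and three for
    -- each vertex of the path.
    decide (no few) = inj₂ (inj₂ (subst (λ x → e2 X + 3 * x ≤ 2 * (b + total bs) * x + altC c b C) (sym eqX)
      (lin (2 * (b + total bs) * q)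
        (subst (λ m → e2 X ≤ tri m + 2 * lsum (deg R) Q + e2 R) lenQ (e2-cross Q X u i) ⊕ *-monoʳ-≤ 2 cross ⊕ *-monoʳ-≤ (2 * q) (<⇒≤ few′) ⊕ ub R R-free)
        (regroup (e2 X) (# R) q (total bs) d (tri q) (c * 2 ^ q) C (lsum (deg R) Q) (e2 R) (# (R ∩ Rich))))))
      where
      q = odd b
      regroup : ∀ e r q B d t T C l f h →
        2 * (suc d + B) * (q + r) + (t + 2 * q * T + C + 3 * q) + (e + 2 * l + 2 * q * h + (f + 1 * r)) ≡
        e + 3 * (q + r) + (t + 2 * l + f + 2 * (q * h + d * r) + 2 * q * T + (2 * B * r + C)) + 2 * (suc d + B) * q
      regroup = solve-∀
      eqX : # X ≡ q + # R
      eqX = trans (#-removeL X Q u i) (cong (_+ # R) lenQ)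
      few′ : # (R ∩ Rich) < c * 2 ^ q
      few′ = subst₂ (λ a b → a < c * 2 ^ b) (sym (#-elems (R ∩ Rich))) lenQ (≰⇒> few)
      small : ∀ v → (R ∩ᶜ Rich) v ≡ true → ladj v Q ≤ d
      small v h = s≤s⁻¹ (≰⇒> (not-does⁻ (b ≤? ladj v Q) (proj₂ (∧-true⁻ (R v) h))))
      cross : lsum (deg R) Q ≤ q * # (R ∩ Rich) + d * # R
      cross = begin
        lsum (deg R) Q                ≡⟨ lsum-deg R Q ⟩
        Σₛ R (λ v → ladj v Q)         ≡⟨ Σₛ-split R Rich (λ v → ladj v Q) ⟩
        Σₛ (R ∩ Rich) (λ v → ladj v Q) + Σₛ (R ∩ᶜ Rich) (λ v → ladj v Q)
          ≤⟨ +-mono-≤ (Σₛ-≤const (R ∩ Rich) q (λ v _ → ≤-trans (ladj≤length v Q) (≤-reflexive lenQ))) (Σₛ-≤const (R ∩ᶜ Rich) d small) ⟩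
        q * # (R ∩ Rich) + d * # (R ∩ᶜ Rich) ≤⟨ +-monoʳ-≤ (q * # (R ∩ Rich)) (*-monoʳ-≤ d (#-⊆ (λ v h → proj₁ (∧-true⁻ (R v) h)))) ⟩
        q * # (R ∩ Rich) + d * # R        ∎
        where open ≤-Reasoning

  hub-cost : ∀ {X A ws} → Hub X A ws → e2 X ≤ e2 (X ∖ A) + 2 * length A * # X
  hub-cost {X} {A} H = ≤-trans (e2-removeL A X (A-unique H) (A-inside H)) (+-monoʳ-≤ (e2 (X ∖ A)) (begin
    2 * lsum (deg X) A              ≤⟨ *-monoʳ-≤ 2 (lsum-mono {g = λ _ → # X} A (All.tabulate (λ {v} _ → deg≤# X v))) ⟩
    2 * lsum (λ _ → # X) A          ≡⟨ cong (2 *_) (lsum-const (# X) A) ⟩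
    2 * (# X * length A)            ≡⟨ regroup (# X) (length A) ⟩
    2 * length A * # X              ∎))
    where
    open ≤-Reasoning
    regroup : ∀ x a → 2 * (x * a) ≡ 2 * a * x
    regroup = solve-∀

  hub-free : ∀ {X A ws ls} ℓ → Hub X A ws → 1 ≤ ℓ → ℓ ≤ odd (length A) →
    suc (suc (length A)) + total ls ≤ length ws → ¬ HasForest X (ℓ ∷ ls) → ¬ HasForest (X ∖ A) ls
  hub-free {X} {A} ℓ H 1≤ℓ ℓ≤ len free (U , f) = free (hub-extend ℓ H (forest-⊆ (∖⊆ X A) f)
    (Inside-∖-disjoint X A (forest-inside f)) 1≤ℓ ℓ≤ len)

  -- Connectors with enough common neighbours can supply their path last, so without them the graph
  -- has no copy of the shorter forest; deleting them costs at most `2 * b` per vertex. The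
  -- coefficient `2 * total bs - 1` also holds for a single path, where it is that of Erdős-Gallai.
  upper-bound : ∀ bs → All (1 ≤_) bs → UpperBound bs (ubC bs)
  upper-bound [] [] Y free = contradiction ([] , []) free
  upper-bound (b ∷ bs) (1≤b ∷ 1≤bs) Y free
    with alternative b bs (2 + b + total (map odd bs)) (ubC bs) Y 1≤b (s≤s z≤n) (upper-bound bs 1≤bs) free
  ... | inj₁ sparse = lin (2 * total bs * # Y + (altC (2 + b + total (map odd bs)) b (ubC bs) + b)) sparse
          (regroup (e2 Y) (# Y) b (total bs) (altC (2 + b + total (map odd bs)) b (ubC bs) + b))
    where
    regroup : ∀ e y b B C → 2 * (b + B) * y + C + (e + 1 * y) ≡ e + 1 * y + (2 * b * y + 0) + (2 * B * y + C)
    regroup = solve-∀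
  ... | inj₂ (inj₂ dense) = lin (2 * # Y + b) dense
          (regroup (e2 Y) (# Y) b (total bs) (altC (2 + b + total (map odd bs)) b (ubC bs)))
    where
    regroup : ∀ e y b B C → 2 * (b + B) * y + (C + b) + (e + 3 * y) ≡ e + 1 * y + (2 * (b + B) * y + C) + (2 * y + b)
    regroup = solve-∀
  ... | inj₂ (inj₁ (A , ws , H , refl , len)) =
    lin (t + s + 2 * total bs * b)
      (hub-cost H ⊕ upper-bound bs 1≤bs (Y ∖ A) (hub-free (odd b) H (s≤s z≤n) ≤-refl len free) ⊕
       ≤-reflexive eqY ⊕ *-monoʳ-≤ (2 * total bs) (≤-reflexive (sym eqY)))
      (regroup (e2 Y) (# Y) b (total bs) (ubC bs) t s (e2 (Y ∖ A)) (# (Y ∖ A)))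
    where
    c = 2 + b + total (map odd bs)
    t = tri (odd b) + 2 * odd b * (c * 2 ^ odd b)
    s = 3 * odd b
    eqY : # Y ≡ b + # (Y ∖ A)
    eqY = #-removeL Y A (A-unique H) (A-inside H)
    regroup : ∀ e y b B C t s f z →
      2 * (b + B) * y + (t + C + s + b) + (e + (f + 1 * z) + y + 2 * B * (b + z)) ≡
      e + 1 * y + (f + 2 * b * y + (2 * B * z + C) + (b + z) + 2 * B * y) + (t + s + 2 * B * b)
    regroup = solve-∀

-- Growing connectors and pieces

-- A sublist, encoded by the predicates it inherits.
Sub : {A : Set} → List A → List A → Set₁
Sub {A} ys xs = (∀ (P : A → Set) → All P xs → All P ys) × (∀ (R : A → A → Set) → AllPairs R xs → AllPairs R ys)

module _ {A : Set} where

  Sub-refl : ∀ {xs : List A} → Sub xs xs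
  Sub-refl = (λ _ → id) , (λ _ → id)

  Sub-trans : ∀ {xs ys zs : List A} → Sub xs ys → Sub ys zs → Sub xs zs
  Sub-trans (a , b) (c , d) = (λ P → a P ∘ c P) , (λ R → b R ∘ d R)

  Sub-skip : ∀ {x} {xs ys : List A} → Sub xs ys → Sub xs (x ∷ ys)
  Sub-skip (a , b) = (λ P → a P ∘ All.tail) , (λ R → b R ∘ AllPairs.tail)

  Sub-filter : ∀ {P : A → Set} (P? : ∀ x → Dec (P x)) xs → Sub (filter P? xs) xs
  Sub-filter P? xs = (λ _ → All.filter⁺ P?) , (λ _ → AllPairs.filter⁺ P?)

  module _ {n : ℕ} (f : A → List (Fin n)) where

    DisjointOn : A → A → Set
    DisjointOn p q = Disjoint (f p) (f q)

    miss? : ∀ u p → Dec (u ∉ f p)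
    miss? u p = ¬? (u ∈? f p)

    hit-once : ∀ u ps → AllPairs DisjointOn ps → length ps ≤ suc (length (filter (miss? u) ps))
    hit-once u [] _ = z≤n
    hit-once u (p ∷ ps) (d ∷ ds) with u ∈? f p
    ... | no _ = s≤s (hit-once u ps ds)
    ... | yes u∈ = s≤s (≤-reflexive (cong length (sym (List.filter-all (miss? u) (All.map (λ dis u∈′ → dis (u∈ , u∈′)) d)))))

    avoiding : ∀ U ps → AllPairs DisjointOn ps →
               ∃[ qs ] Sub qs ps × length ps ≤ length qs + length U × All (λ q → Disjoint (f q) U) qs
    avoiding [] ps ds = ps , Sub-refl , ≤-reflexive (sym (+-identityʳ _)) , All.tabulate (λ _ → λ { (_ , ()) })
    avoiding (u ∷ U) ps ds with avoiding U (filter (miss? u) ps) (AllPairs.filter⁺ (miss? u) ds)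
    ... | qs , sub , len , dis = qs , Sub-trans sub (Sub-filter (miss? u) ps) ,
      ≤-trans (hit-once u ps ds) (≤-trans (s≤s len) (≤-reflexive (sym (+-suc (length qs) (length U))))) ,
      All.zipWith (λ { (u∉ , d) (z∈ , here refl) → u∉ z∈ ; (u∉ , d) (z∈ , there z∈U) → d (z∈ , z∈U) })
        (proj₁ sub (λ p → u ∉ f p) (All.all-filter (miss? u) ps) , dis)

module _ {n : ℕ} where

  -- A piece paired with a candidate for its next vertex.
  Marked : Set
  Marked = Fin n × List (Fin n)

  Popular : ℕ → List Marked → Set₁
  Popular m zs = ∃[ z ] ∃[ ys ] Sub ys zs × m ≤ length ys × All (λ p → proj₁ p ≡ z) ys

  Scattered : ℕ → List Marked → Set₁
  Scattered m zs = ∃[ ys ] Sub ys zs × m ≤ length ys × AllPairs (λ p q → Disjoint (proj₁ p ∷ proj₂ p) (proj₁ q ∷ proj₂ q)) ys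

  popular-⊆ : ∀ {m ys zs} → Sub ys zs → Popular m ys → Popular m zs
  popular-⊆ s (z , xs , t , rest) = z , xs , Sub-trans t s , rest

  pigeonhole : ∀ vs m zs → All (λ p → proj₁ p ∈ vs) zs → length vs * m < length zs → Popular m zs
  pigeonhole [] m [] _ ()
  pigeonhole [] m (z ∷ zs) (() ∷ _) _
  pigeonhole (v ∷ vs) m zs ins len = decide (m ≤? length same)
    where
    same? : (p : Marked) → Dec (proj₁ p ≡ v)
    same? p = proj₁ p Fin.≟ v
    same = filter same? zs
    differ = filter (¬? ∘ same?) zs
    decide : Dec (m ≤ length same) → Popular m zs
    decide (yes many) = v , same , Sub-filter same? zs , many , All.all-filter same? zs
    decide (no few) = popular-⊆ (Sub-filter (¬? ∘ same?) zs) (pigeonhole vs m differ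
      (All.zipWith (λ { (here eq , ne) → contradiction eq ne ; (there v∈ , _) → v∈ })
        (All.filter⁺ (¬? ∘ same?) ins , All.all-filter (¬? ∘ same?) zs))
      (lin 0 (len ⊕ <⇒≤ (≰⇒> few) ⊕ ≤-reflexive (sym (filter-split same? zs)))
        (regroup (length vs * m) m (length zs) (length same) (length differ))))
      where
      regroup : ∀ v m z s d → d + (suc (m + v) + s + z) ≡ suc v + (z + m + (s + d)) + 0
      regroup = solve-∀

  -- Greedy selection. If too many marks fall into the chosen piece or on its own mark, one of these
  -- vertices is popular by pigeonhole. Otherwise a choice uses up itself, at most `suc k * M`
  -- entries whose marks clash with it, and at most one piece through `z`, since the pieces are
  -- disjoint; this is the factor `suc k * M + 2`.
  popular-or-scattered : ∀ m M k zs → All (λ p → length (proj₂ p) ≤ k × proj₁ p ∉ proj₂ p) zs →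
    AllPairs (DisjointOn proj₂) zs → m * (suc k * M + 2) ≤ length zs → Popular M zs ⊎ Scattered m zs
  popular-or-scattered zero M k zs _ _ _ = inj₂ ([] , ((λ _ _ → []) , (λ _ _ → [])) , z≤n , [])
  popular-or-scattered (suc m) M k [] _ _ len = contradiction (≤-trans (≤-trans (m≤n+m 2 (suc k * M)) (m≤m+n _ _)) len) λ ()
  popular-or-scattered (suc m) M k ((z , K) ∷ rest) ((|K|≤ , z∉K) ∷ oks) (d ∷ ds) len = decide (suc (length K) * M <? length bad)
    where
    clash? : (p : Marked) → Dec (proj₁ p ∈ z ∷ K)
    clash? p = proj₁ p ∈? (z ∷ K)
    bad = filter clash? rest
    good = filter (¬? ∘ clash?) rest
    best = filter (miss? proj₂ z) good
    sub-best : Sub best rest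
    sub-best = Sub-trans (Sub-filter (miss? proj₂ z) good) (Sub-filter (¬? ∘ clash?) rest)
    decide : Dec (suc (length K) * M < length bad) → Popular M ((z , K) ∷ rest) ⊎ Scattered (suc m) ((z , K) ∷ rest)
    decide (yes many) = inj₁ (popular-⊆ (Sub-skip (Sub-filter clash? rest)) (pigeonhole (z ∷ K) M bad (All.all-filter clash? rest) many))
    decide (no few) with popular-or-scattered m M k best (proj₁ sub-best _ oks) (proj₂ sub-best _ ds) enough
      where
      enough : m * (suc k * M + 2) ≤ length best
      enough = lin 0
        (len ⊕ ≮⇒≥ few ⊕ *-monoˡ-≤ M (s≤s |K|≤) ⊕ hit-once proj₂ z good (AllPairs.filter⁺ (¬? ∘ clash?) ds) ⊕ ≤-reflexive (sym (filter-split clash? rest)))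
        (regroup (m * (suc k * M + 2)) (suc k * M) (length rest) (length bad) (length good) (length best) (suc (length K) * M))
        where
        regroup : ∀ x s r b g t y → t + (s + 2 + x + b + y + g + r) ≡ x + (suc r + y + s + suc t + (b + g)) + 0
        regroup = solve-∀
    ... | inj₁ pop = inj₁ (popular-⊆ (Sub-skip sub-best) pop)
    ... | inj₂ (ys , sub , len′ , sc) = inj₂ ((z , K) ∷ ys ,
          ((λ { P (p ∷ ps) → p ∷ proj₁ all P ps }) , (λ { R (r ∷ rs) → proj₁ all (R (z , K)) r ∷ proj₂ all R rs })) ,
          s≤s len′ ,
          All.zipWith separate (proj₁ all _ d , proj₁ sub _ (All.zip (All.all-filter (miss? proj₂ z) good , All.filter⁺ (miss? proj₂ z) (All.all-filter (¬? ∘ clash?) rest)))) ∷ sc)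
      where
      all : Sub ys rest
      all = Sub-trans sub sub-best
      separate : ∀ {p : Marked} → Disjoint K (proj₂ p) × (z ∉ proj₂ p × proj₁ p ∉ z ∷ K) → Disjoint (z ∷ K) (proj₁ p ∷ proj₂ p)
      separate (dK , z∉ , nc) (here refl , here eq)   = nc (here (sym eq))
      separate (dK , z∉ , nc) (here refl , there z∈)  = z∉ z∈
      separate (dK , z∉ , nc) (there v∈ , here refl)  = nc (there v∈)
      separate (dK , z∉ , nc) (there v∈ , there v∈′)  = dK (v∈ , v∈′)

unique-++ˡ : ∀ {A : Set} (xs : List A) {ys} → Unique (xs ++ ys) → Unique xs
unique-++ˡ []       _        = []
unique-++ˡ (x ∷ xs) (p ∷ ps) = All.++⁻ˡ xs p ∷ unique-++ˡ xs ps

unique-++ʳ : ∀ {A : Set} (xs : List A) {ys} → Unique (xs ++ ys) → Unique ys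
unique-++ʳ []       u        = u
unique-++ʳ (x ∷ xs) (_ ∷ ps) = unique-++ʳ xs ps

unique-++-disjoint : ∀ {A : Set} (xs : List A) {ys} → Unique (xs ++ ys) → Disjoint xs ys
unique-++-disjoint (x ∷ xs) (p ∷ ps) (here refl , v∈) = All.lookup (All.++⁻ʳ xs p) v∈ refl
unique-++-disjoint (x ∷ xs) (p ∷ ps) (there v∈ , v∈′) = unique-++-disjoint xs ps (v∈ , v∈′)

-- The number of pieces from which `m` survive `f` steps, a single step thinning
-- `m * (suc b * m + 2)` pieces to `m`.
growth : ℕ → ℕ → ℕ → ℕ
growth b zero    m = m
growth b (suc f) m = growth b f m * (suc b * growth b f m + 2)

module Connectors {n : ℕ} (G : Graph n) where
  open Bounds G public

  -- Deleting a vertex of degree below `k` lowers `e2` by at most `2 * k - 2`, so the excess of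
  -- `e2 + 2 * #` over `2 * k * #` does not decrease. The summand `2 * #` is what later forces the
  -- core of a large set to be large.
  min-degree-core : ∀ fuel k X → # X ≤ fuel →
    ∃[ Y ] Y ⊆ X × (∀ v → Y v ≡ true → k ≤ deg Y v) × e2 X + 2 * # X + 2 * k * # Y ≤ e2 Y + 2 * # Y + 2 * k * # X
  min-degree-core fuel k X le with Fin.any? (λ v → (X v Bool.≟ true) ×-dec (deg X v <? k))
  ... | no none = X , (λ _ → id) , (λ v Xv → ≮⇒≥ (λ lt → none (v , Xv , lt))) , ≤-refl
  min-degree-core zero k X le | yes (v , Xv , lt) = true≢false Xv (#-empty X (n≤0⇒n≡0 le) v)
  min-degree-core (suc f) k X le | yes (v , Xv , lt)
    with min-degree-core f k (X - v) (s≤s⁻¹ (subst (_≤ suc f) (#-remove X Xv) le))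
  ... | Y , sub , md , h = Y , (λ u Yu → proj₁ (∈-⁻ X v (sub u Yu))) , md , bound
    where
    bound : e2 X + 2 * # X + 2 * k * # Y ≤ e2 Y + 2 * # Y + 2 * k * # X
    bound rewrite e2-remove X Xv | #-remove X Xv =
      lin 0 (h ⊕ *-monoʳ-≤ 2 lt) (regroup (deg X v) (e2 (X - v)) (# (X - v)) k (# Y) (e2 Y))
      where
      regroup : ∀ d e x k y f → f + 2 * y + 2 * k * suc x + (e + 2 * x + 2 * k * y + 2 * suc d) ≡
        2 * d + e + 2 * suc x + 2 * k * y + (f + 2 * y + 2 * k * x + 2 * k) + 0
      regroup = solve-∀

  subwalk : ∀ {x w u v K} → Walk x w K → Unique K → u ∈ K → v ∈ K →
            ∃[ xs ] Walk u v xs × Unique xs × (∀ {z} → z ∈ xs → z ∈ K)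
  subwalk [ _ ] uq (here refl) (here refl) = _ , [ _ ] , uq , id
  subwalk (a ∷ p) uq (here refl) v∈ = let ys , zs , eq , q = walk-prefix (a ∷ p) v∈ in
    ys , q , unique-++ˡ ys (subst Unique eq uq) , λ {z} z∈ → subst (z ∈_) (sym eq) (∈-++⁺ˡ z∈)
  subwalk (a ∷ p) uq (there u∈) (here refl) = let ys , zs , eq , q = walk-prefix (a ∷ p) (there u∈) in
    reverse ys , walk-reverse q , Unique-resp-↭ (↭-sym (Perm.↭-reverse ys)) (unique-++ˡ ys (subst Unique eq uq)) ,
    λ {z} z∈ → subst (z ∈_) (sym eq) (∈-++⁺ˡ (Perm.∈-resp-↭ (Perm.↭-reverse ys) z∈))
  subwalk (a ∷ p) (_ ∷ uq) (there u∈) (there v∈) with subwalk p uq u∈ v∈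
  ... | xs , q , uq′ , sub = xs , q , uq′ , there ∘ sub

  walk-neighbour : ∀ {x w u K} → Walk x w K → 2 ≤ length K → u ∈ K → ∃[ v ] v ∈ K × Adj u v
  walk-neighbour [ _ ] (s≤s ()) u∈
  walk-neighbour (a ∷ p) _ (here refl) = _ , there (head∈ p) , a
  walk-neighbour (a ∷ [ _ ]) _ (there (here refl)) = _ , here refl , adj-comm a
  walk-neighbour (a ∷ (b ∷ p)) _ (there u∈) with walk-neighbour (b ∷ p) (s≤s (walk-nonempty p)) u∈
  ... | v , v∈ , u~v = v , there v∈ , u~v

  PieceFor : ℕ → List V → List V → Set
  PieceFor h N K = (∀ c c′ → c ∈ N → c′ ∈ N → Seg K c c′) × (∀ {c} → c ∈ N → Tail h K c) × Disjoint K N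

  pieces-path : ∀ N h c cs Ks → Unique (c ∷ cs) → All (_∈ N) (c ∷ cs) → 2 + length cs ≤ length Ks →
    All (PieceFor h N) Ks → AllPairs Disjoint Ks →
    ∃[ xs ] (∃[ u ] ∃[ v ] Walk u v xs) × Unique xs × h + (suc (2 * length cs) + h) ≤ length xs ×
      (∀ (P : V → Set) → All P (c ∷ cs) → All (All P) Ks → All P xs)
  pieces-path N h c cs (K₀ ∷ Kl ∷ Ks) u ins (s≤s (s≤s len)) ((_ , t₀ , d₀) ∷ (_ , tl , dl) ∷ ps) ds =
    let xs , w , ux , long , cont = span N h h c cs K₀ Ks Kl u ins len (t₀ (All.head ins)) (All.map proj₁ ps) tl ds
                                      (All.map (proj₂ ∘ proj₂) ps) dl (λ (z∈ , z∈c) → d₀ (z∈ , All.lookup ins z∈c))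
    in xs , w , ux , long , λ { P pc (p₀ ∷ pl ∷ pK) → cont P pc p₀ pK pl }

  -- `A` holds the original connectors, `Y` those found during the growth. The piece grows at `tip`,
  -- while all of `A` stays attached to `foot`; a member of `Y` may touch the piece anywhere. Hence
  -- tails of full length are available only at `A`.
  record Piece (X : VSet n) (A Y : List V) (k : ℕ) (K : List V) : Set where
    field
      {tip foot} : V
      walk    : Walk tip foot K
      unique  : Unique K
      inside  : Inside X K
      size    : length K ≡ k
      avoids  : Disjoint K (Y ++ A)
      planted : ∀ {a} → a ∈ A → Adj a foot
      touched : ∀ {y} → y ∈ Y → ∃[ u ] u ∈ K × Adj y u

  record State (X : VSet n) (A Y : List V) (k m : ℕ) : Set where
    field
      connectors-unique : Unique (Y ++ A)
      connectors-inside : Inside X (Y ++ A)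
      pieces            : List (List V)
      pieces-ok         : All (Piece X A Y k) pieces
      pieces-disjoint   : AllPairs Disjoint pieces
      enough            : m ≤ length pieces

  module Growth (X : VSet n) (A : List V) (δ : ℕ) (min-degree : ∀ v → X v ≡ true → δ ≤ deg X v) where

    Sprout : List V → ℕ → Marked → Set
    Sprout Y k (z , K) = Σ[ p ∈ Piece X A Y k K ] X z ≡ true × Adj (Piece.tip p) z × z ∉ Y ++ A × z ∉ K

    -- The new vertex has to avoid the connectors and the `k - 1` vertices of the piece other than
    -- the tip, one fewer than the degree of the tip is known to be.
    sprout : ∀ {Y k K} → length (Y ++ A) + k ≤ δ → Piece X A Y k K → ∃[ z ] Sprout Y k (z , K)
    sprout {Y} {k} {K} le p = build (find-neighbour X tip (Y ++ A ++ rest K) short)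
      where
      open Piece p
      rest : List V → List V
      rest []       = []
      rest (_ ∷ xs) = xs
      rest-length : ∀ {u v xs} → Walk u v xs → suc (length (rest xs)) ≡ length xs
      rest-length [ _ ]   = refl
      rest-length (_ ∷ _) = refl
      split∈ : ∀ {u v z xs} → Walk u v xs → z ∈ xs → z ≡ u ⊎ z ∈ rest xs
      split∈ [ _ ]   (here eq) = inj₁ eq
      split∈ (_ ∷ _) (here eq) = inj₁ eq
      split∈ (_ ∷ _) (there h) = inj₂ h
      short : length (Y ++ A ++ rest K) < deg X tip
      short = ≤-trans (lin 0 (le ⊕ ≤-reflexive (rest-length walk) ⊕ ≤-reflexive size ⊕ ≤-reflexive (List.length-++ Y) ⊕ ≤-reflexive (List.length-++ A) ⊕ ≤-reflexive (sym (List.length-++ Y)))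
         (regroup (length Y) (length A) (length (rest K)) (length K) k δ (length (Y ++ A)) (length (Y ++ A ++ rest K)) (length (A ++ rest K))))
        (min-degree tip (All.lookup inside (head∈ walk)))
        where
        regroup : ∀ y a r K k d s t u → d + (s + k + suc r + K + t + u + (y + a)) ≡ suc t + (d + K + k + (y + u) + (a + r) + s) + 0
        regroup = solve-∀
      build : ∃[ z ] X z ≡ true × Adj tip z × z ∉ Y ++ A ++ rest K → ∃[ z ] Sprout Y k (z , K)
      build (z , Xz , a , z∉) = z , p , Xz , a ,
        (λ z∈ → z∉ (subst (z ∈_) (List.++-assoc Y A (rest K)) (∈-++⁺ˡ z∈))) ,
        (λ z∈ → [ (λ eq → adj-≢ a (sym eq)) , (λ z∈′ → z∉ (∈-++⁺ʳ Y (∈-++⁺ʳ A z∈′))) ]′ (split∈ walk z∈))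

    sprouts : ∀ {Y k Ks} → length (Y ++ A) + k ≤ δ → All (Piece X A Y k) Ks →
              ∃[ zs ] All (Sprout Y k) zs × map proj₂ zs ≡ Ks
    sprouts le [] = [] , [] , refl
    sprouts le (p ∷ ps) = let z , s = sprout le p ; zs , ss , eq = sprouts le ps in (z , _) ∷ zs , s ∷ ss , cong (_ ∷_) eq

    -- The tip of a piece has more neighbours than the connectors and the piece can
    -- account for. If the new neighbours often coincide, they give a further
    -- connector; otherwise they extend disjoint pieces.
    step : ∀ {Y k} b m → k ≤ b → length (Y ++ A) + k ≤ δ → 1 ≤ m → State X A Y k (m * (suc b * m + 2)) →
           (∃[ z ] State X A (z ∷ Y) k m) ⊎ State X A Y (suc k) m
    step {Y} {k} b m k≤b le 1≤m S with sprouts le (State.pieces-ok S)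
    ... | zs , ss , refl = decide (popular-or-scattered m m b zs (All.map (λ (p , _ , _ , _ , z∉K) → ≤-trans (≤-reflexive (Piece.size p)) k≤b , z∉K) ss)
                                     (AllPairs.map⁻ (State.pieces-disjoint S)) (≤-trans (State.enough S) (≤-reflexive (List.length-map proj₂ zs))))
      where
      decide : Popular m zs ⊎ Scattered m zs → (∃[ z ] State X A (z ∷ Y) k m) ⊎ State X A Y (suc k) m
      decide (inj₁ (z , [] , sub , len , same)) = contradiction (≤-trans 1≤m len) λ ()
      decide (inj₁ (z , ys@(_ ∷ _) , sub , len , same)) = inj₁ (z , record
        { connectors-unique = All.tabulate (λ v∈ z≡v → proj₁ fresh (subst (_∈ Y ++ A) (sym z≡v) v∈)) ∷ State.connectors-unique S
        ; connectors-inside = proj₂ fresh ∷ State.connectors-inside S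
        ; pieces            = map proj₂ ys
        ; pieces-ok         = All.map⁺ (All.zipWith attach (proj₁ sub _ ss , same))
        ; pieces-disjoint   = AllPairs.map⁺ (proj₂ sub _ (AllPairs.map⁻ (State.pieces-disjoint S)))
        ; enough            = ≤-trans len (≤-reflexive (sym (List.length-map proj₂ ys)))
        })
        where
        fresh : z ∉ Y ++ A × X z ≡ true
        fresh with All.head same | All.head (proj₁ sub _ ss)
        ... | refl | p , Xz , _ , z∉ , _ = z∉ , Xz
        attach : ∀ {q} → Sprout Y k q × proj₁ q ≡ z → Piece X A (z ∷ Y) k (proj₂ q)
        attach ((p , Xz , a , z∉N , z∉K) , refl) = record
          { walk = walk ; unique = unique ; inside = inside ; size = size
          ; avoids  = λ { (v∈ , here refl) → z∉K v∈ ; (v∈ , there v∈′) → avoids (v∈ , v∈′) }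
          ; planted = planted
          ; touched = λ { (here refl) → _ , head∈ walk , adj-comm a ; (there y∈) → touched y∈ }
          } where open Piece p
      decide (inj₂ (ys , sub , len , sc)) = inj₂ (record
        { connectors-unique = State.connectors-unique S
        ; connectors-inside = State.connectors-inside S
        ; pieces            = map (λ p → proj₁ p ∷ proj₂ p) ys
        ; pieces-ok         = All.map⁺ (All.map extend (proj₁ sub _ ss))
        ; pieces-disjoint   = AllPairs.map⁺ sc
        ; enough            = ≤-trans len (≤-reflexive (sym (List.length-map _ ys)))
        })
        where
        extend : ∀ {q} → Sprout Y k q → Piece X A Y (suc k) (proj₁ q ∷ proj₂ q)
        extend {z , K} (p , Xz , a , z∉N , z∉K) = record
          { walk = adj-comm a ∷ walk
          ; unique  = All.tabulate (λ v∈ z≡v → z∉K (subst (_∈ K) (sym z≡v) v∈)) ∷ unique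
          ; inside  = Xz ∷ inside
          ; size    = cong suc size
          ; avoids  = λ { (here refl , v∈) → z∉N v∈ ; (there v∈ , v∈′) → avoids (v∈ , v∈′) }
          ; planted = planted
          ; touched = λ y∈ → let u , u∈ , c = touched y∈ in u , there u∈ , c
          } where open Piece p

    growth-pos : ∀ b f {m} → 1 ≤ m → 1 ≤ growth b f m
    growth-pos b zero    1≤m = 1≤m
    growth-pos b (suc f) {m} 1≤m = *-mono-≤ (growth-pos b f 1≤m) (≤-trans (s≤s z≤n) (m≤n+m 2 (suc b * growth b f m)))

    -- A step either adds a connector or lengthens the surviving pieces by one, so the number of
    -- connectors plus the piece length rises by exactly one; `f` is its distance from `suc δ`,
    -- where a new neighbour is no longer guaranteed.
    iterate : ∀ f m {Y k} → 1 ≤ m → length (Y ++ A) + k + f ≡ suc δ → 1 ≤ k → State X A Y k (growth (suc δ) f m) →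
      ∃[ Y′ ] ∃[ k′ ] length (Y′ ++ A) + k′ ≡ suc δ × 1 ≤ k′ × State X A Y′ k′ m
    iterate zero m {Y} {k} 1≤m eq 1≤k S = Y , k , trans (sym (+-identityʳ _)) eq , 1≤k , S
    iterate (suc f) m {Y} {k} 1≤m eq 1≤k S = decide (step {Y} {k} (suc δ) (growth (suc δ) f m) (≤-trans (m≤n+m k (length (Y ++ A))) (≤-trans le (n≤1+n δ))) le (growth-pos (suc δ) f 1≤m) S)
      where
      eq′ : suc (length (Y ++ A) + k + f) ≡ suc δ
      eq′ = trans (sym (+-suc _ f)) eq
      le : length (Y ++ A) + k ≤ δ
      le = s≤s⁻¹ (≤-trans (s≤s (m≤m+n _ f)) (≤-reflexive eq′))
      decide : _ ⊎ _ → _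
      decide (inj₁ (z , S′)) = iterate f m 1≤m eq′ 1≤k S′
      decide (inj₂ S′) = iterate f m 1≤m (trans (cong (_+ f) (+-suc (length (Y ++ A)) k)) eq′) (s≤s z≤n) S′

-- From grown pieces to two paths or a larger hub

split-at : ∀ {A : Set} j (xs : List A) → suc j ≤ length xs → ∃[ c ] ∃[ cs ] ∃[ ds ] xs ≡ c ∷ cs ++ ds × length cs ≡ j
split-at zero    (x ∷ xs) _ = x , [] , xs , refl , refl
split-at (suc j) (x ∷ xs) (s≤s le) = let c , cs , ds , eq , len = split-at j xs le in x , c ∷ cs , ds , cong (x ∷_) eq , cong suc len

singletons : ∀ {A : Set} (xss : List (List A)) → All (λ xs → length xs ≡ 1) xss → ∃[ ws ] xss ≡ map (_∷ []) ws
singletons [] [] = [] , refl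
singletons ((x ∷ []) ∷ xss) (_ ∷ ps) = let ws , eq = singletons xss ps in x ∷ ws , cong ((x ∷ []) ∷_) eq

-- `m` pieces are for a hub, `odd p` for those that the first path may meet and the second must
-- avoid, and the rest suffices for building either path.
piecesNeeded : ℕ → ℕ → ℕ → ℕ
piecesNeeded p q₀ m = m + (odd p + (2 + (p + q₀)))

-- Here `suc q₀` is the smaller half. Growth starts from `p` connectors and pieces of one vertex,
-- and reaches the sum `suc (p + q₀)` after `q₀` steps.
hubNeeded : ℕ → ℕ → ℕ → ℕ
hubNeeded p q₀ m = growth (suc (p + q₀)) q₀ (piecesNeeded p q₀ m)

twoPathsC : ℕ → ℕ → ℕ → ℕ → ℕ
twoPathsC p q₀ m E = suc (4 * (E + altC (hubNeeded p q₀ m) p (ubC (suc q₀ ∷ []))) + ubC (p ∷ suc q₀ ∷ []))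

module TwoPaths {n : ℕ} (G : Graph n) where
  open Connectors G public

  module _ {X : VSet n} {A Y : List V} {k : ℕ} where

    piece-touch : ∀ {K} → Piece X A Y k K → ∀ {c} → c ∈ Y ++ A → ∃[ u ] u ∈ K × Adj c u
    piece-touch p c∈ with ∈-++⁻ Y c∈
    ... | inj₁ c∈Y = Piece.touched p c∈Y
    ... | inj₂ c∈A = _ , last∈ (Piece.walk p) , Piece.planted p c∈A

    piece-seg : ∀ {K} → Piece X A Y k K → ∀ {c c′} → c ∈ Y ++ A → c′ ∈ Y ++ A → Seg K c c′
    piece-seg p c∈ c′∈ =
      let u , u∈ , a = piece-touch p c∈ ; v , v∈ , b = piece-touch p c′∈
          xs , w , ux , sub = subwalk (Piece.walk p) (Piece.unique p) u∈ v∈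
      in u , v , xs , a , w , adj-comm b , ux , sub

    -- Wherever a connector touches the piece, the touched vertex has a neighbour on it, which gives
    -- a tail of two vertices.
    any-piece : ∀ {K N} → 2 ≤ k → (∀ {v} → v ∈ N → v ∈ Y ++ A) → Piece X A Y k K → PieceFor 2 N K
    any-piece {K} {N} 2≤k sub p = (λ _ _ c∈ c′∈ → piece-seg p (sub c∈) (sub c′∈)) , tail , λ (a , b) → Piece.avoids p (a , sub b)
      where
      tail : ∀ {c} → c ∈ N → Tail 2 K c
      tail c∈ =
        let u , u∈ , a = piece-touch p (sub c∈)
            v , v∈ , b = walk-neighbour (Piece.walk p) (≤-trans 2≤k (≤-reflexive (sym (Piece.size p)))) u∈
        in u , v , u ∷ v ∷ [] , a , b ∷ [ v ] , (adj-≢ b ∷ []) ∷ [] ∷ [] , (λ { (here refl) → u∈ ; (there (here refl)) → v∈ }) , ≤-refl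

    -- From a member of `A` the whole piece can be traversed, starting at its foot.
    planted-piece : ∀ {K N} → (∀ {v} → v ∈ N → v ∈ A) → Piece X A Y k K → PieceFor k N K
    planted-piece {K} {N} sub p = (λ _ _ c∈ c′∈ → piece-seg p (∈-++⁺ʳ Y (sub c∈)) (∈-++⁺ʳ Y (sub c′∈))) , tail ,
      λ (a , b) → Piece.avoids p (a , ∈-++⁺ʳ Y (sub b))
      where
      tail : ∀ {c} → c ∈ N → Tail k K c
      tail c∈ = _ , _ , reverse K , Piece.planted p (sub c∈) , walk-reverse (Piece.walk p) ,
        Unique-resp-↭ (↭-sym (Perm.↭-reverse K)) (Piece.unique p) , Perm.∈-resp-↭ (Perm.↭-reverse K) ,
        ≤-reflexive (sym (trans (List.length-reverse K) (Piece.size p)))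

  path-through : ∀ {X} h c cs Ks m → Unique (c ∷ cs) → Inside X (c ∷ cs) → All (Inside X) Ks → 2 + length cs ≤ length Ks →
    All (PieceFor h (c ∷ cs)) Ks → AllPairs Disjoint Ks → 1 ≤ m → m ≤ h + (suc (2 * length cs) + h) →
    ∃[ xs ] length xs ≡ m × IsPath X xs × (∀ (P : V → Set) → All P (c ∷ cs) → All (All P) Ks → All P xs)
  path-through h c cs Ks m u ins insK len ok ds 1≤m m≤ =
    let xs , w , ux , long , cont = pieces-path (c ∷ cs) h c cs Ks u (All.tabulate id) len ok ds
        ys , len-ys , path , sub  = path-shorten m 1≤m (≤-trans m≤ long) (w , ux , cont _ ins insK)
    in ys , len-ys , path , λ P pc pK → All.tabulate (λ v∈ → All.lookup (cont P pc pK) (sub v∈))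

  Separated : List V → List V → List V → Set
  Separated C N A = (∀ {v} → v ∈ C → v ∈ A) × Disjoint C N

  long-first-path : ∀ {X A Y k M} c cs N p → State X A Y k M → Unique (c ∷ cs) → Separated (c ∷ cs) N A →
    (∀ {v} → v ∈ N → v ∈ Y ++ A) → length cs + k ≡ p → 2 + length cs ≤ M →
    ∃[ xs ] length xs ≡ odd p × IsPath X xs × Disjoint xs N
  long-first-path {X} {A} {Y} {k} c cs N p S u (inA , apart) N⊆ eq many =
    let xs , len , path , cont = path-through k c cs (State.pieces S) (odd p) u
           (All.tabulate (λ v∈ → All.lookup (State.connectors-inside S) (∈-++⁺ʳ Y (inA v∈))))
           (All.map Piece.inside (State.pieces-ok S)) (≤-trans many (State.enough S))
           (All.map (planted-piece inA) (State.pieces-ok S)) (State.pieces-disjoint S) (s≤s z≤n)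
           (≤-reflexive (trans (cong odd (sym eq)) (regroup (length cs) k)))
    in xs , len , path , λ (v∈ , v∈N) →
      All.lookup (cont (_∉ N) (All.tabulate (λ a b → apart (a , b)))
        (All.map (λ pc → All.tabulate (λ z∈ z∈N → Piece.avoids pc (z∈ , N⊆ z∈N))) (State.pieces-ok S))) v∈ v∈N
    where
    regroup : ∀ j k → suc (2 * (j + k)) ≡ k + (suc (2 * j) + k)
    regroup = solve-∀

  long-second-path : ∀ {X A Y k M} N q₀ xs → State X A Y k M → 2 ≤ k → Unique N → (∀ {v} → v ∈ N → v ∈ Y ++ A) →
    suc (length N) ≡ suc q₀ → 1 ≤ q₀ → Disjoint xs N → 2 + q₀ + length xs ≤ M →
    ∃[ ys ] length ys ≡ odd (suc q₀) × IsPath X ys × Disjoint xs ys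
  long-second-path [] q₀ xs S 2≤k u N⊆ refl () dis many
  long-second-path {X} {A} {Y} {k} {M} (c ∷ cs) q₀ xs S 2≤k u N⊆ eq 1≤q₀ dis many =
    let qs , sub , len , away = avoiding id xs (State.pieces S) (State.pieces-disjoint S)
        ys , len-ys , path , cont = path-through 2 c cs qs (odd (suc q₀)) u (All.tabulate (λ v∈ → All.lookup (State.connectors-inside S) (N⊆ v∈)))
           (proj₁ sub _ (All.map Piece.inside (State.pieces-ok S)))
           (lin 1 (many ⊕ State.enough S ⊕ len ⊕ ≤-reflexive eq) (count (length cs) (length xs) M (length (State.pieces S)) (length qs) q₀))
           (proj₁ sub _ (All.map (any-piece 2≤k N⊆) (State.pieces-ok S))) (proj₂ sub _ (State.pieces-disjoint S)) (s≤s z≤n)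
           (≤-reflexive (trans (cong odd (sym eq)) (regroup (length cs))))
    in ys , len-ys , path , λ (v∈xs , v∈ys) →
      All.lookup (cont (_∉ xs) (All.tabulate (λ a b → dis (b , a))) (All.map (λ d → All.tabulate (λ z∈ z∈xs → d (z∈ , z∈xs))) away)) v∈ys v∈xs
    where
    count : ∀ c x m p q k → q + (2 + k + x + m + p + suc (suc c)) ≡ 2 + c + (m + p + (q + x) + suc k) + 1
    count = solve-∀
    regroup : ∀ c → 1 + 2 * (2 + c) ≡ 2 + (1 + 2 * c + 2)
    regroup = solve-∀

  -- With k + |connectors| one more than a hub of the required size needs, tails of
  -- length k save the first path k - 1 connectors, and tails of length 2 save the
  -- second path one.
  long-pieces-forest : ∀ {X A Y k m p q₀} → length A ≡ p → suc q₀ ≤ p → length (Y ++ A) + k ≡ suc (p + q₀) → 2 ≤ k →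
    State X A Y k (piecesNeeded p q₀ m) → HasForest X (odd p ∷ odd (suc q₀) ∷ [])
  long-pieces-forest {X} {A} {Y} {k} {m} {p} {q₀} lenA q≤p total≡ 2≤k S =
    build (split-at j A (≤-trans (≤-trans (≤-reflexive (+-comm 1 j)) (+-monoʳ-≤ j (≤-trans (s≤s z≤n) 2≤k))) (≤-reflexive (trans j+k (sym lenA)))))
    where
    open State S
    Y+k : length Y + k ≡ suc q₀
    Y+k = +-cancelˡ-≡ p _ _ (trans (regroup p (length Y) k) (trans (cong (λ a → length Y + a + k) (sym lenA))
            (trans (cong (_+ k) (sym (List.length-++ Y))) (trans total≡ (sym (+-suc p q₀))))))
      where
      regroup : ∀ p y k → p + (y + k) ≡ y + p + k
      regroup = solve-∀
    k≤q : k ≤ suc q₀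
    k≤q = ≤-trans (m≤n+m k (length Y)) (≤-reflexive Y+k)
    j = p ∸ k
    j+k : j + k ≡ p
    j+k = m∸n+n≡m (≤-trans k≤q q≤p)
    build : ∃[ c ] ∃[ cs ] ∃[ ds ] A ≡ c ∷ cs ++ ds × length cs ≡ j → HasForest X (odd p ∷ odd (suc q₀) ∷ [])
    build (c , cs , ds , A≡ , len-cs) = combine (long-first-path c cs N p S (unique-++ˡ (c ∷ cs) A-uniq) (in₁ , apart) N⊆ (trans (cong (_+ k) len-cs) j+k) many₁)
      where
      N = Y ++ ds
      in₁ : ∀ {v} → v ∈ c ∷ cs → v ∈ A
      in₁ v∈ = subst (_ ∈_) (sym A≡) (∈-++⁺ˡ v∈)
      in₂ : ∀ {v} → v ∈ ds → v ∈ A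
      in₂ v∈ = subst (_ ∈_) (sym A≡) (∈-++⁺ʳ (c ∷ cs) v∈)
      A-uniq : Unique (c ∷ cs ++ ds)
      A-uniq = subst Unique A≡ (unique-++ʳ Y connectors-unique)
      N⊆ : ∀ {v} → v ∈ N → v ∈ Y ++ A
      N⊆ v∈ with ∈-++⁻ Y v∈
      ... | inj₁ h = ∈-++⁺ˡ h
      ... | inj₂ h = ∈-++⁺ʳ Y (in₂ h)
      N-uniq : Unique N
      N-uniq = Unique.++⁺ (unique-++ˡ Y connectors-unique) (unique-++ʳ (c ∷ cs) A-uniq)
                  (λ (a , b) → unique-++-disjoint Y connectors-unique (a , in₂ b))
      apart : Disjoint (c ∷ cs) N
      apart = disjoint-++ʳ (λ (a , b) → unique-++-disjoint Y connectors-unique (b , in₁ a)) (unique-++-disjoint (c ∷ cs) A-uniq)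
      len-N : length N ≡ q₀
      len-N = +-cancelʳ-≡ (suc (j + k)) _ _ (begin
        length N + suc (j + k)                     ≡⟨ cong (_+ suc (j + k)) (List.length-++ Y) ⟩
        length Y + length ds + suc (j + k)         ≡⟨ regroup (length Y) (length ds) j k ⟩
        length Y + k + (suc j + length ds)         ≡⟨ cong₂ _+_ Y+k (trans (cong (λ t → suc t + length ds) (sym len-cs)) (sym (List.length-++ (c ∷ cs)))) ⟩
        suc q₀ + length (c ∷ cs ++ ds)             ≡⟨ cong (suc q₀ +_) (trans (cong length (sym A≡)) (trans lenA (sym j+k))) ⟩
        suc q₀ + (j + k)                           ≡⟨ sym (+-suc q₀ (j + k)) ⟩
        q₀ + suc (j + k)                           ∎)
        where
        open ≡-Reasoning
        regroup : ∀ y d j k → y + d + suc (j + k) ≡ y + k + (suc j + d)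
        regroup = solve-∀
      many₁ : 2 + length cs ≤ piecesNeeded p q₀ m
      many₁ = lin (m + odd p + q₀ + k) (≤-reflexive len-cs ⊕ ≤-reflexive j+k) (regroup m (odd p) p q₀ j k (length cs))
        where
        regroup : ∀ m o p q j k l → m + (o + (2 + (p + q))) + (l + (j + k)) ≡ 2 + l + (j + p) + (m + o + q + k)
        regroup = solve-∀
      combine : ∃[ xs ] length xs ≡ odd p × IsPath X xs × Disjoint xs N → HasForest X (odd p ∷ odd (suc q₀) ∷ [])
      combine (xs , len , path , dis) =
        finish (long-second-path N q₀ xs S 2≤k N-uniq N⊆ (cong suc len-N) (s≤s⁻¹ (≤-trans 2≤k k≤q)) dis many₂)
        where
        many₂ : 2 + q₀ + length xs ≤ piecesNeeded p q₀ m
        many₂ = lin (m + p) (≤-reflexive len) (regroup m (odd p) p q₀ (length xs))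
          where
          regroup : ∀ m o p q x → m + (o + (2 + (p + q))) + x ≡ 2 + q + x + o + (m + p)
          regroup = solve-∀
        finish : ∃[ ys ] length ys ≡ odd (suc q₀) × IsPath X ys × Disjoint xs ys → HasForest X (odd p ∷ odd (suc q₀) ∷ [])
        finish (ys , len′ , path′ , dis′) = _ , cons path len (cons path′ len′ [] λ { (_ , ()) }) disj
          where
          disj : Disjoint xs (ys ++ [])
          disj (v∈ , v∈′) with ∈-++⁻ ys v∈′
          ... | inj₁ h = dis′ (v∈ , h)

  short-pieces-hub : ∀ {X A Y m M d} → length (Y ++ A) + 1 ≡ suc d → m ≤ M → State X A Y 1 M → HasHub X d m
  short-pieces-hub {X} {A} {Y} {m} total≡ m≤M S = build (singletons pieces (All.map Piece.size pieces-ok)) pieces-ok pieces-disjoint (≤-trans m≤M enough)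
    where
    open State S
    unique-heads : ∀ ws → AllPairs Disjoint (map (_∷ []) ws) → Unique {A = V} ws
    unique-heads ws ds = AllPairs.map (λ d x≡y → d (here refl , here x≡y)) (AllPairs.map⁻ ds)
    build : ∃[ ws ] pieces ≡ map (_∷ []) ws → All (Piece X A Y 1) pieces → AllPairs Disjoint pieces → m ≤ length pieces → HasHub X _ m
    build (ws , refl) ok ds len = Y ++ A , ws , record
      { A-unique = connectors-unique ; ws-unique = unique-heads ws ds ; A-inside = connectors-inside
      ; ws-inside = All.map (All.head ∘ Piece.inside) (All.map⁻ ok)
      ; joined = λ a∈ w∈ → case piece-touch (All.lookup (All.map⁻ ok) w∈) a∈ of λ { (_ , here refl , a) → a } } ,
      suc-injective (trans (+-comm 1 _) total≡) , ≤-trans len (≤-reflexive (List.length-map (_∷ []) ws))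

  -- When growth stops, connectors and piece length add up to `suc (p + q₀)`. Pieces of one vertex
  -- are then common neighbours of `p + q₀` connectors, and longer pieces would yield the forbidden
  -- forest.
  grow-hub : ∀ {X A ws p q₀} m → length A ≡ p → suc q₀ ≤ p → (∀ v → X v ≡ true → p + q₀ ≤ deg X v) →
    Hub X A ws → hubNeeded p q₀ m ≤ length ws → ¬ HasForest X (odd p ∷ odd (suc q₀) ∷ []) → HasHub X (p + q₀) m
  grow-hub {X} {A} {ws} {p} {q₀} m lenA q≤p md H many free =
    decide (Growth.iterate X A (p + q₀) md q₀ (piecesNeeded p q₀ m) {[]} {1} positive start ≤-refl initial)
    where
    positive : 1 ≤ piecesNeeded p q₀ m
    positive = ≤-trans (s≤s z≤n) (m≤n+m _ m)
    start : length A + 1 + q₀ ≡ suc (p + q₀)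
    start = trans (cong (λ a → a + 1 + q₀) lenA) (cong (_+ q₀) (+-comm p 1))
    initial : State X A [] 1 (growth (suc (p + q₀)) q₀ (piecesNeeded p q₀ m))
    initial = record
      { connectors-unique = A-unique H ; connectors-inside = A-inside H
      ; pieces = map (_∷ []) ws
      ; pieces-ok = All.map⁺ (All.tabulate (λ {w} w∈ → record
          { walk = [ w ] ; unique = [] ∷ [] ; inside = All.lookup (ws-inside H) w∈ ∷ [] ; size = refl
          ; avoids = λ { (here refl , v∈) → hub-disjoint H (w∈ , v∈) }
          ; planted = λ a∈ → joined H a∈ w∈ ; touched = λ () }))
      ; pieces-disjoint = AllPairs-map-singleton (ws-unique H)
      ; enough = ≤-trans many (≤-reflexive (sym (List.length-map (_∷ []) ws))) }
    decide : ∃[ Y ] ∃[ k ] length (Y ++ A) + k ≡ suc (p + q₀) × 1 ≤ k × State X A Y k (piecesNeeded p q₀ m) → HasHub X (p + q₀) m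
    decide (Y , suc zero , eq , _ , S) = short-pieces-hub eq (m≤m+n m _) S
    decide (Y , suc (suc k) , eq , _ , S) = contradiction (long-pieces-forest {m = m} lenA q≤p eq (s≤s (s≤s z≤n)) S) free

  two-paths : ∀ p q₀ m E X → 1 ≤ m → suc q₀ ≤ p → ¬ HasForest X (odd p ∷ odd (suc q₀) ∷ []) →
    2 * (p + q₀) * # X ≤ e2 X + E → twoPathsC p q₀ m E ≤ # X → HasHub X (p + q₀) m
  two-paths p q₀ m E X 1≤m q≤p free dense large with min-degree-core (# X) (p + q₀) X ≤-refl
  ... | Y , Y⊆X , md , core = decide (alternative p (suc q₀ ∷ []) h C Y 1≤p 1≤h (upper-bound (suc q₀ ∷ []) (s≤s z≤n ∷ [])) freeY)
    where
    h = hubNeeded p q₀ m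
    C = ubC (suc q₀ ∷ [])
    C₂ = ubC (p ∷ suc q₀ ∷ [])
    C₃ = altC h p C
    1≤p = ≤-trans (s≤s z≤n) q≤p
    1≤h : 1 ≤ h
    1≤h = Growth.growth-pos Y [] 0 (λ _ _ → z≤n) (suc (p + q₀)) q₀ (≤-trans 1≤m (m≤m+n m _))
    freeY : ¬ HasForest Y (odd p ∷ odd (suc q₀) ∷ [])
    freeY f = free (HasForest-⊆ Y⊆X f)
    ub = upper-bound (p ∷ suc q₀ ∷ []) (1≤p ∷ s≤s z≤n ∷ []) Y freeY
    denseY : 2 * (p + q₀) * # Y ≤ e2 Y + E
    denseY = lin 0 (core ⊕ dense ⊕ *-monoʳ-≤ 2 (#-⊆ Y⊆X)) (regroup (e2 X) (# X) (p + q₀) (# Y) (e2 Y) E)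
      where
      regroup : ∀ e x k y f E → f + E + (e + 2 * x + 2 * k * y + 2 * k * x + 2 * y) ≡ 2 * k * y + (f + 2 * y + 2 * k * x + (e + E) + 2 * x) + 0
      regroup = solve-∀
    largeY : E + C₃ < # Y
    -- `core`, `dense` and `ub` combine to `2 * # X ≤ 3 * # Y + E + C₂`; hence the factor 3, and
    -- `twoPathsC` is chosen generously enough to absorb it.
    largeY = *-cancelˡ-< 3 _ _ (lin (4 * E + 5 * C₃ + C₂ + 1) (core ⊕ dense ⊕ ub ⊕ *-monoʳ-≤ 2 large) (regroup (e2 X) (# X) p q₀ (# Y) (e2 Y) E C₃ C₂))
      where
      regroup : ∀ e x p q y f E c d →
        3 * y + (e + 2 * x + 2 * (p + q) * y + 2 * (p + q) * x + (f + 1 * y) + 2 * suc (4 * (E + c) + d)) ≡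
        suc (3 * (E + c)) + (f + 2 * y + 2 * (p + q) * x + (e + E) + (2 * (p + (suc q + 0)) * y + d) + 2 * x) + ((4 * E + 5 * c + d + 1))
      regroup = solve-∀
    small : # Y ≤ E + C₃ → HasHub X (p + q₀) m
    small le = contradiction le (<⇒≱ largeY)
    decide : Dense 1 p 0 Y ⊎ HasHub Y p h ⊎ Dense 3 (p + (suc q₀ + 0)) C₃ Y → HasHub X (p + q₀) m
    decide (inj₁ sparse) = small (lin (2 * q₀ * # Y + C₃) (sparse ⊕ denseY) (regroup (e2 Y) (# Y) p q₀ E C₃))
      where
      regroup : ∀ f y p q E c → E + c + (f + 1 * y + 2 * (p + q) * y) ≡ y + (2 * p * y + 0 + (f + E)) + (2 * q * y + c)
      regroup = solve-∀
    decide (inj₂ (inj₂ sparse)) = small (lin 0 (sparse ⊕ denseY) (regroup (e2 Y) (# Y) p q₀ E C₃))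
      where
      regroup : ∀ f y p q E c → E + c + (f + 3 * y + 2 * (p + q) * y) ≡ y + (2 * (p + (suc q + 0)) * y + c + (f + E)) + 0
      regroup = solve-∀
    decide (inj₂ (inj₁ (A , ws , H , lenA , many))) =
      let A′ , ws′ , H′ , len′ , many′ = grow-hub m lenA q≤p md H many freeY in A′ , ws′ , Hub-⊆ Y⊆X H′ , len′ , many′

-- Extremal structure

-- What is left of an extremal graph once its dominating vertices are removed.
data Kind : Set where
  bare edge match : Kind

-- Twice the number of edges in a remainder of order `m`. For a matching of odd order this is one
-- too many, which `slack` makes up for.
gap : Kind → ℕ → ℕ
gap bare  m = 0
gap edge  m = 2
gap match m = m

slack : Kind → ℕ
slack bare  = 0
slack edge  = 0
slack match = 1

-- φ m k is twice the number of edges of K k ∨ K̄ m.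
φ : ℕ → ℕ → ℕ
φ m zero    = 0
φ m (suc k) = φ m k + 2 * (k + m)

φ≡tri : ∀ m k → φ m k ≡ tri k + 2 * k * m
φ≡tri m zero    = refl
φ≡tri m (suc k) = trans (cong (_+ 2 * (k + m)) (φ≡tri m k)) (regroup (tri k) k m)
  where
  regroup : ∀ t k m → t + 2 * k * m + 2 * (k + m) ≡ t + 2 * k + 2 * suc k * m
  regroup = solve-∀

module Structure {n : ℕ} (G : Graph n) where
  open TwoPaths G public

  -- The constructors follow the recursion of `matching`, so that an isomorphism can be read off
  -- edge by edge.
  data Matched (R : VSet n) : Set where
    nil  : (∀ v → R v ≡ false) → Matched R
    one  : ∀ {v} → R v ≡ true → (∀ u → R u ≡ true → u ≡ v) → Matched R
    pair : ∀ {x y} → R x ≡ true → R y ≡ true → Adj x y → (∀ u → R u ≡ true → Adj x u → u ≡ y) →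
           (∀ u → R u ≡ true → Adj y u → u ≡ x) → Matched (R - x - y) → Matched R

  Base : Kind → VSet n → Set
  Base bare  R = ∀ u v → R u ≡ true → R v ≡ true → ¬ Adj u v
  Base edge  R = ∃[ x ] ∃[ y ] R x ≡ true × R y ≡ true × Adj x y ×
                 (∀ u v → R u ≡ true → R v ≡ true → Adj u v → u ≡ x × v ≡ y ⊎ u ≡ y × v ≡ x)
  Base match R = Matched R

  data Struct (κ : Kind) : ℕ → VSet n → Set where
    base : ∀ {R} → Base κ R → Struct κ 0 R
    join : ∀ {k X a} → X a ≡ true → (∀ v → (X - a) v ≡ true → Adj a v) → Struct κ k (X - a) → Struct κ (suc k) X

  deg-zero : ∀ Y v → (∀ u → Y u ≡ true → ¬ Adj v u) → deg Y v ≤ 0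
  deg-zero Y v none = Σₛ-≤const Y 0 (λ u Yu → ≤-reflexive (cong ⟦_⟧ (not-true⇒false (none u Yu))))

  deg-one : ∀ Y v → (∀ u w → Y u ≡ true → Y w ≡ true → Adj v u → Adj v w → u ≡ w) → deg Y v ≤ 1
  deg-one Y v uniq with Fin.any? (λ u → (Y u Bool.≟ true) ×-dec (adj G v u Bool.≟ true))
  ... | yes (u , Yu , v~u) = ≤-trans (Σₛ-≤lsum Y (u ∷ []) (a? v) (λ w Yw pos → here (uniq w u Yw Yu (⟦⟧>0 _ pos) v~u)))
          (≤-trans (≤-reflexive (+-identityʳ (a? v u))) (⟦⟧≤1 (adj G v u)))
  ... | no none = ≤-trans (deg-zero Y v (λ u Yu v~u → none (u , Yu , v~u))) z≤n

  deg-positive : ∀ Y v → 1 ≤ deg Y v → ∃[ u ] Y u ≡ true × Adj v u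
  deg-positive Y v pos = let u , Yu , p = Σₛ-pos Y (a? v) pos in u , Yu , ⟦⟧>0 _ p

  deg-full : ∀ Y a → # Y ≤ deg Y a → ∀ v → Y v ≡ true → Adj a v
  deg-full Y a le v Yv with adj G a v in eq
  ... | true = refl
  ... | false = contradiction le (<⇒≱ (begin-strict
      deg Y a                    ≡⟨ deg-remove Y a Yv ⟩
      a? a v + deg (Y - v) a     ≡⟨ cong (λ b → ⟦ b ⟧ + deg (Y - v) a) eq ⟩
      deg (Y - v) a              ≤⟨ deg≤# (Y - v) a ⟩
      # (Y - v)                  <⟨ ≤-reflexive (sym (#-remove Y Yv)) ⟩
      # Y                        ∎))
    where open ≤-Reasoning

  pair-e2 : ∀ {R x y} → R x ≡ true → R y ≡ true → Adj x y → (∀ u → R u ≡ true → Adj x u → u ≡ y) →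
            (∀ u → R u ≡ true → Adj y u → u ≡ x) → e2 R ≤ 2 + e2 (R - x - y)
  pair-e2 {R} {x} {y} Rx Ry a hx hy = begin
    e2 R                                               ≡⟨ e2-remove R Rx ⟩
    2 * deg R x + e2 (R - x)                           ≡⟨ cong (2 * deg R x +_) (e2-remove (R - x) (∈-⁺ R x Ry (≢-sym (adj-≢ a)))) ⟩
    2 * deg R x + (2 * deg (R - x) y + e2 (R - x - y)) ≤⟨ +-mono-≤ (*-monoʳ-≤ 2 dx) (+-monoˡ-≤ (e2 (R - x - y)) (*-monoʳ-≤ 2 dy)) ⟩
    2 + e2 (R - x - y)                                 ∎
    where
    open ≤-Reasoning
    dx : deg R x ≤ 1
    dx = deg-one R x (λ u w Ru Rw p q → trans (hx u Ru p) (sym (hx w Rw q)))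
    dy : deg (R - x) y ≤ 0
    dy = deg-zero (R - x) y (λ u Ru p → let Ru′ , u≢x = ∈-⁻ R x Ru in u≢x (hy u Ru′ p))

  pair-# : ∀ {R x y} → R x ≡ true → R y ≡ true → Adj x y → # R ≡ 2 + # (R - x - y)
  pair-# {R} {x} {y} Rx Ry a = trans (#-remove R Rx) (cong suc (#-remove (R - x) (∈-⁺ R x Ry (≢-sym (adj-≢ a)))))

  base-upper : ∀ κ R → Base κ R → e2 R ≤ gap κ (# R)
  base-upper bare R b = ≤-trans (Σₛ-≤const R 0 (λ v Rv → deg-zero R v (λ u Ru → b v u Rv Ru))) z≤n
  base-upper edge R (x , y , Rx , Ry , x~y , only) = begin
    e2 R                              ≤⟨ Σₛ-≤lsum R (x ∷ y ∷ []) (deg R) ends ⟩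
    deg R x + (deg R y + 0)           ≤⟨ +-mono-≤ (deg-one R x fx) (+-monoˡ-≤ 0 (deg-one R y fy)) ⟩
    2                                 ∎
    where
    open ≤-Reasoning
    ends : ∀ v → R v ≡ true → 1 ≤ deg R v → v ∈ x ∷ y ∷ []
    ends v Rv pos with deg-positive R v pos
    ... | u , Ru , v~u with only v u Rv Ru v~u
    ...   | inj₁ (eq , _) = here eq
    ...   | inj₂ (eq , _) = there (here eq)
    nx : ∀ u → R u ≡ true → Adj x u → u ≡ y
    nx u Ru p with only x u Rx Ru p
    ... | inj₁ (_ , eq) = eq
    ... | inj₂ (eq , _) = contradiction eq (adj-≢ x~y)
    ny : ∀ u → R u ≡ true → Adj y u → u ≡ x
    ny u Ru p with only y u Ry Ru p
    ... | inj₁ (eq , _) = contradiction (sym eq) (adj-≢ x~y)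
    ... | inj₂ (_ , eq) = eq
    fx = λ u w Ru Rw p q → trans (nx u Ru p) (sym (nx w Rw q))
    fy = λ u w Ru Rw p q → trans (ny u Ru p) (sym (ny w Rw q))
  base-upper match R (nil h) = ≤-trans (≤-reflexive (Σₛ-∅ R (deg R) h)) z≤n
  base-upper match R (one {v} Rv h) = ≤-trans (Σₛ-≤const R 0 (λ u Ru → deg-zero R u (λ w Rw u~w → adj-≢ u~w (trans (h u Ru) (sym (h w Rw)))))) z≤n
  base-upper match R (pair Rx Ry a hx hy M) = ≤-trans (pair-e2 Rx Ry a hx hy)
    (≤-trans (s≤s (s≤s (base-upper match _ M))) (≤-reflexive (sym (pair-# Rx Ry a))))

  struct-upper : ∀ {κ k m X} → Struct κ k X → # X ≡ k + m → e2 X ≤ φ m k + gap κ m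
  struct-upper {κ} {X = X} (base b) refl = base-upper κ X b
  struct-upper {κ} {suc k} {m} {X} (join {a = a} Xa dom S) eq =
    lin 0 (≤-reflexive (e2-remove X Xa) ⊕ *-monoʳ-≤ 2 (≤-reflexive (deg-self X Xa)) ⊕ *-monoʳ-≤ 2 (deg≤# (X - a) a) ⊕ *-monoʳ-≤ 2 (≤-reflexive eq′) ⊕ struct-upper S eq′)
      (regroup (φ m k) (k + m) (gap κ m) (e2 X) (deg X a) (deg (X - a) a) (# (X - a)) (e2 (X - a)))
    where
    eq′ : # (X - a) ≡ k + m
    eq′ = suc-injective (trans (sym (#-remove X Xa)) eq)
    regroup : ∀ f k g e d d′ x e′ → f + 2 * k + g + (e + 2 * d + 2 * d′ + 2 * x + e′) ≡ e + (2 * d + e′ + 2 * d′ + 2 * x + 2 * k + (f + g)) + 0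
    regroup = solve-∀

  -- The number of edges required for the extremal structure on k + m vertices,
  -- up to the rounding in the size of a maximum matching.
  Rich : Kind → ℕ → ℕ → VSet n → Set
  Rich κ k m X = # X ≡ k + m × φ m k + gap κ m ≤ e2 X + slack κ

  slack≤1 : ∀ κ → slack κ ≤ 1
  slack≤1 bare  = z≤n
  slack≤1 edge  = z≤n
  slack≤1 match = ≤-refl

  -- Deleting `a` takes away at most `k + m` edges, so the rest stays rich and is structured by
  -- `rec`. The edge count of that structure then leaves no room for a vertex not adjacent to `a`:
  -- it would cost 2 in the degree sum, and the slack is at most 1.
  peel : ∀ {κ k m X a} → X a ≡ true → Rich κ (suc k) m X → (Rich κ k m (X - a) → Struct κ k (X - a)) → Struct κ (suc k) X
  peel {κ} {k} {m} {X} {a} Xa (eq , rich) rec = join Xa (deg-full (X - a) a (≤-trans (≤-reflexive eq′) full-degree)) S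
    where
    eq′ : # (X - a) ≡ k + m
    eq′ = suc-injective (trans (sym (#-remove X Xa)) eq)
    d = deg (X - a) a
    e2-X : e2 X ≡ 2 * d + e2 (X - a)
    e2-X = trans (e2-remove X Xa) (cong (λ t → 2 * t + e2 (X - a)) (deg-self X Xa))
    rich′ : φ m k + gap κ m ≤ e2 (X - a) + slack κ
    rich′ = lin 0 (rich ⊕ ≤-reflexive e2-X ⊕ *-monoʳ-≤ 2 (≤-trans (deg≤# (X - a) a) (≤-reflexive eq′)))
      (regroup (φ m k) (k + m) (gap κ m) (e2 X) d (e2 (X - a)) (slack κ))
      where
      regroup : ∀ f k g e d e′ s → e′ + s + (f + 2 * k + g + e + 2 * d) ≡ f + g + (e + s + (2 * d + e′) + 2 * k) + 0
      regroup = solve-∀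
    S = rec (eq′ , rich′)
    full-degree : k + m ≤ d
    full-degree = s≤s⁻¹ (*-cancelˡ-< 2 _ _ (lin 0
      (rich ⊕ ≤-reflexive e2-X ⊕ struct-upper S eq′ ⊕ slack≤1 κ)
      (regroup (φ m k) (k + m) (gap κ m) (e2 X) d (e2 (X - a)) (slack κ))))
      where
      regroup : ∀ f k g e d e′ s → 2 * suc d + (f + 2 * k + g + e + e′ + s) ≡ suc (2 * k) + (e + s + (2 * d + e′) + (f + g) + 1) + 0
      regroup = solve-∀

  peelL : ∀ {κ k m} A X → Unique A → Inside X A → Rich κ (length A + k) m X →
          (Rich κ k m (X ∖ A) → Struct κ k (X ∖ A)) → Struct κ (length A + k) X
  peelL [] X _ _ rich rec = rec rich
  peelL (a ∷ A) X (p ∷ ps) (q ∷ qs) rich rec = peel q rich (λ rich′ → peelL A (X - a) ps (All-∖⁺ X a p qs) rich′ rec)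

  -- Below, D v counts the neighbours of v in a set of k vertices that has been
  -- removed, and R is the set of the remaining vertices.
  module Remainder (R : VSet n) (D : V → ℕ) (k : ℕ) (D≤k : ∀ v → R v ≡ true → D v ≤ k) where

    attached : VSet n
    attached v = does (1 ≤? D v)

    R₁ Z : VSet n
    R₁ = R ∩ attached
    Z  = R ∩ᶜ attached

    R₁⁻ : ∀ v → R₁ v ≡ true → R v ≡ true × 1 ≤ D v
    R₁⁻ v h = let Rv , p = ∧-true⁻ (R v) h in Rv , does⁻ (1 ≤? D v) p

    Z⁻ : ∀ v → Z v ≡ true → R v ≡ true × D v ≤ 0
    Z⁻ v h = let Rv , p = ∧-true⁻ (R v) h in Rv , s≤s⁻¹ (≰⇒> (not-does⁻ (1 ≤? D v) p))

    R₁-or-Z : ∀ v → R v ≡ true → R₁ v ≡ true ⊎ Z v ≡ true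
    R₁-or-Z v Rv with true-or-false (attached v)
    ... | inj₁ t = inj₁ (∧-true⁺ Rv t)
    ... | inj₂ f = inj₂ (∧-true⁺ Rv (cong not f))

    R₁≢Z : ∀ {u v} → R₁ u ≡ true → Z v ≡ true → u ≢ v
    R₁≢Z {u} p q refl = contradiction (proj₂ (R₁⁻ u p)) (≤⇒≯ (proj₂ (Z⁻ u q)))

    #R : # R ≡ # R₁ + # Z
    #R = Σₛ-split R attached (λ _ → 1)

    ΣD : Σₛ R D ≤ Σₛ R₁ D
    ΣD = begin
      Σₛ R D                ≡⟨ Σₛ-split R attached D ⟩
      Σₛ R₁ D + Σₛ Z D      ≤⟨ +-monoʳ-≤ (Σₛ R₁ D) (Σₛ-≤const Z 0 (λ v Zv → proj₂ (Z⁻ v Zv))) ⟩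
      Σₛ R₁ D + 0           ≡⟨ +-identityʳ _ ⟩
      Σₛ R₁ D               ∎
      where open ≤-Reasoning

    deg-R : ∀ v → deg R v ≡ deg R₁ v + deg Z v
    deg-R v = Σₛ-split R attached (a? v)

    deg-symm : ∀ X Y → Σₛ X (deg Y) ≡ Σₛ Y (deg X)
    deg-symm X Y = trans (Σₛ-swap X Y a?) (Σₛ-cong Y (λ u _ → Σₛ-cong X (λ v _ → cong ⟦_⟧ (adj-sym G v u))))

    sparse : 1 ≤ k → ∀ Y → ¬ HasPath Y (odd k) → e2 Y + # Y ≤ 2 * k * # Y
    sparse 1≤k Y none = [ (λ p → contradiction p none) , id ]′ (odd-path k Y 1≤k)

    -- All edges lie inside `Z`, where Erdős-Gallai allows at most `2 * k - 1` per vertex, while a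
    -- vertex of `R₁` accounts for at most `2 * k` through `D`. The required average `2 * k` forces
    -- `Z` to be empty.
    bare-remainder : 1 ≤ k → (∀ x y → R₁ x ≡ true → R y ≡ true → ¬ Adj x y) → ¬ HasPath Z (odd k) →
      2 * k * # R ≤ 2 * Σₛ R D + e2 R → Base bare R
    bare-remainder 1≤k no-edge no-path rich u v Ru Rv u~v with R₁-or-Z u Ru
    ... | inj₁ u∈R₁ = no-edge u v u∈R₁ Rv u~v
    ... | inj₂ u∈Z = contradiction (#-remove Z u∈Z) (λ eq → contradiction (≤-trans (≤-reflexive (sym eq)) Z-empty) λ ())
      where
      e2-R : e2 R ≤ e2 Z
      e2-R = begin
        e2 R                            ≡⟨ Σₛ-split R attached (deg R) ⟩
        Σₛ R₁ (deg R) + Σₛ Z (deg R)    ≤⟨ +-mono-≤ (Σₛ-≤const R₁ 0 (λ x p → deg-zero R x (λ y Ry → no-edge x y p Ry)))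
                                              (Σₛ-mono Z (λ z Zz → ≤-trans (≤-reflexive (deg-R z))
                                                (+-monoˡ-≤ (deg Z z) (deg-zero R₁ z (λ x p z~x → no-edge x z p (proj₁ (Z⁻ z Zz)) (adj-comm z~x)))))) ⟩
        e2 Z                            ∎
        where open ≤-Reasoning
      Z-empty : # Z ≤ 0
      Z-empty = lin 0 (rich ⊕ *-monoʳ-≤ 2 ΣD ⊕ *-monoʳ-≤ 2 (Σₛ-≤const R₁ k (λ v p → D≤k v (proj₁ (R₁⁻ v p)))) ⊕ e2-R ⊕ sparse 1≤k Z no-path ⊕ *-monoʳ-≤ (2 * k) (≤-reflexive (sym #R)))
        (regroup (# R) (# R₁) (# Z) k (Σₛ R D) (Σₛ R₁ D) (e2 R) (e2 Z))
        where
        regroup : ∀ r a z k s t e f → 0 + (2 * k * r + 2 * s + 2 * t + e + (f + z) + 2 * k * (a + z)) ≡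
          z + (2 * s + e + 2 * t + 2 * (k * a) + f + 2 * k * z + 2 * k * r) + 0
        regroup = solve-∀

    -- All degrees are at most one, since there is no path on three vertices, and the count leaves
    -- at most one vertex of degree zero. Any edge can thus be split off together with its two ends.
    matched : ∀ fuel Y → # Y ≤ fuel → (∀ x y z → Y x ≡ true → Y y ≡ true → Y z ≡ true → Adj x y → Adj y z → x ≡ z) →
              # Y ≤ e2 Y + 1 → Matched Y
    matched fuel Y le no-cherry rich with # Y in eq
    ... | zero = nil (#-empty Y eq)
    ... | suc zero with #-pos Y (≤-reflexive (sym eq))
    ...   | v , Yv = one Yv λ u Yu → case u Fin.≟ v of λ
            { (yes u≡v) → u≡v
            ; (no u≢v) → true≢false (∈-⁺ Y v Yu u≢v) (#-empty (Y - v) (suc-injective (trans (sym (#-remove Y Yv)) eq)) u) }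
    matched (suc f) Y le no-cherry rich | suc (suc j) with Σₛ-pos Y (deg Y) (s≤s⁻¹ (≤-trans (≤-trans (s≤s (s≤s z≤n)) rich) (≤-reflexive (+-comm (e2 Y) 1))))
    ...   | x , Yx , pos with deg-positive Y x pos
    ...     | y , Yy , x~y = pair Yx Yy x~y hx hy (matched f Y′ small (λ a b c p q r → no-cherry a b c (up a p) (up b q) (up c r)) rich′)
      where
      Y′ = Y - x - y
      up : Y′ ⊆ Y
      up v h = proj₁ (∈-⁻ Y x (proj₁ (∈-⁻ (Y - x) y h)))
      hx : ∀ u → Y u ≡ true → Adj x u → u ≡ y
      hx u Yu x~u = no-cherry u x y Yu Yx Yy (adj-comm x~u) x~y
      hy : ∀ u → Y u ≡ true → Adj y u → u ≡ x
      hy u Yu y~u = no-cherry u y x Yu Yy Yx (adj-comm y~u) (adj-comm x~y)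
      #Y′ : suc (suc j) ≡ 2 + # Y′
      #Y′ = trans (sym eq) (pair-# Yx Yy x~y)
      small : # Y′ ≤ f
      small = s≤s⁻¹ (≤-trans (n≤1+n _) (≤-trans (≤-reflexive (sym #Y′)) le))
      rich′ : # Y′ ≤ e2 Y′ + 1
      rich′ = s≤s⁻¹ (s≤s⁻¹ (≤-trans (≤-reflexive (sym #Y′)) (≤-trans rich (+-monoˡ-≤ 1 (pair-e2 Yx Yy x~y hx hy)))))

    match-remainder : (∀ x y z → R x ≡ true → R y ≡ true → R z ≡ true → Adj x y → Adj y z → x ≡ z) → k ≡ 1 →
      2 * k * # R + # R ≤ 2 * Σₛ R D + e2 R + 1 → Base match R
    match-remainder no-cherry refl rich = matched (# R) R ≤-refl no-cherry
      (lin 0 (rich ⊕ *-monoʳ-≤ 2 (Σₛ-≤const R 1 D≤k)) (regroup (# R) (Σₛ R D) (e2 R)))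
      where
      regroup : ∀ r s e → e + 1 + (2 * r + r + 2 * s) ≡ r + (2 * s + e + 1 + 2 * (1 * r)) + 0
      regroup = solve-∀

    module _ (2≤k : 2 ≤ k)
             (no-walk : ∀ x y z → R₁ x ≡ true → R y ≡ true → R z ≡ true → Adj x y → Adj y z → x ≡ z)
             (no-path : ¬ HasPath Z (odd k))
             (no-edges : ∀ x y x′ y′ → R x ≡ true → R y ≡ true → R x′ ≡ true → R y′ ≡ true → k ≤ D x → k ≤ D x′ →
               Adj x y → Adj x′ y′ → x ≢ x′ → x ≢ y′ → y ≢ x′ → y ≢ y′ → ⊥)
             where

      near joined-all : VSet n
      near v = does (1 ≤? deg R₁ v)
      joined-all v = does (k ≤? D v)

      F N Z₁ Z₂ : VSet n
      F = R₁ ∩ joined-all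
      N = R₁ ∩ᶜ joined-all
      Z₁ = Z ∩ near
      Z₂ = Z ∩ᶜ near

      R₁⊆R : R₁ ⊆ R
      R₁⊆R v h = proj₁ (R₁⁻ v h)

      Z⊆R : Z ⊆ R
      Z⊆R v h = proj₁ (Z⁻ v h)

      Z₁⁻ : ∀ v → Z₁ v ≡ true → Z v ≡ true × ∃[ x ] R₁ x ≡ true × Adj v x
      Z₁⁻ v h = let Zv , p = ∧-true⁻ (Z v) h in Zv , deg-positive R₁ v (does⁻ (1 ≤? deg R₁ v) p)

      Z₂⁻ : ∀ v → Z₂ v ≡ true → Z v ≡ true × deg R₁ v ≤ 0
      Z₂⁻ v h = let Zv , p = ∧-true⁻ (Z v) h in Zv , s≤s⁻¹ (≰⇒> (not-does⁻ (1 ≤? deg R₁ v) p))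

      -- A vertex of `Z₁` is a leaf hanging from `R₁`: a second neighbour would complete a forbidden
      -- walk starting in `R₁`.
      deg-Z₁ : ∀ v → Z₁ v ≡ true → deg R v ≤ 1
      deg-Z₁ v h =
        let Zv , x , x∈ , v~x = Z₁⁻ v h
            nbr = λ u Ru v~u → no-walk x v u x∈ (Z⊆R v Zv) Ru (adj-comm v~x) v~u
        in deg-one R v (λ u w Ru Rw p q → trans (sym (nbr u Ru p)) (nbr w Rw q))

      -- An edge to `Z₁` would complete such a walk as well: from `R₁` through the vertex of `Z₁` to
      -- `v`.
      deg-Z₂ : ∀ v → Z₂ v ≡ true → deg R v ≤ deg Z₂ v
      deg-Z₂ v h =
        let Zv , none = Z₂⁻ v h
            far = deg-zero Z₁ v λ u u∈ v~u → let Zu , x , x∈ , u~x = Z₁⁻ u u∈ in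
              R₁≢Z x∈ Zv (no-walk x u v x∈ (Z⊆R u Zu) (Z⊆R v Zv) (adj-comm u~x) (adj-comm v~u))
        in ≤-trans (≤-reflexive (trans (deg-R v) (cong (deg R₁ v +_) (Σₛ-split Z near (a? v))))) (+-mono-≤ none (+-monoˡ-≤ (deg Z₂ v) far))

      deg-R₁ : ∀ x → R₁ x ≡ true → deg R₁ x ≤ 1
      deg-R₁ x x∈ = deg-one R₁ x λ u w u∈ w∈ p q → no-walk u x w u∈ (R₁⊆R x x∈) (R₁⊆R w w∈) (adj-comm p) q

      -- Edges between `R₁` and `Z` end in leaves from `Z₁`, one per leaf, and are counted at both
      -- ends.
      e2-R : e2 R ≤ Σₛ R₁ (deg R₁) + 2 * # Z₁ + e2 Z₂
      e2-R = lin 0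
        (≤-reflexive (Σₛ-split R attached (deg R)) ⊕ ≤-reflexive (Σₛ-cong R₁ (λ v _ → deg-R v)) ⊕ ≤-reflexive (Σₛ-+ R₁ (deg R₁) (deg Z)) ⊕ ≤-reflexive (deg-symm R₁ Z) ⊕
         ≤-reflexive (Σₛ-split Z near (deg R₁)) ⊕ ≤-reflexive (Σₛ-split Z near (deg R)) ⊕
         Σₛ-≤const Z₁ 1 (λ v h → ≤-trans (deg-⊆ R₁⊆R v) (deg-Z₁ v h)) ⊕ Σₛ-≤const Z₂ 0 (λ v h → proj₂ (Z₂⁻ v h)) ⊕
         Σₛ-≤const Z₁ 1 deg-Z₁ ⊕ Σₛ-mono Z₂ deg-Z₂)
        (regroup (e2 R) (Σₛ R₁ (deg R)) (Σₛ Z (deg R)) (Σₛ R₁ (λ v → deg R₁ v + deg Z v)) (Σₛ R₁ (deg R₁)) (Σₛ R₁ (deg Z)) (Σₛ Z (deg R₁))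
          (Σₛ Z₁ (deg R₁)) (Σₛ Z₂ (deg R₁)) (Σₛ Z₁ (deg R)) (Σₛ Z₂ (deg R)) (# Z₁) (e2 Z₂))
        where
        regroup : ∀ e a b c d f g h i j l z w →
          d + 2 * z + w + (e + a + c + f + g + b + h + i + j + l) ≡
          e + (a + b + c + (d + f) + g + (h + i) + (j + l) + 1 * z + 0 + 1 * z + w) + 0
        regroup = solve-∀

      #R′ : # R ≡ # F + # N + (# Z₁ + # Z₂)
      #R′ = trans #R (cong₂ _+_ (Σₛ-split R₁ joined-all _) (Σₛ-split Z near _))

      -- Vertices of N, Z₁ and Z₂ each cost more than they contribute.
      deficit : 2 * k * # R + 2 ≤ 2 * Σₛ R D + e2 R → 2 + # N + # Z₁ + # Z₂ ≤ Σₛ F (deg R₁)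
      deficit rich = lin (# Z₁ + (k₀ * # Z₁ * 2))
        (rich ⊕ *-monoʳ-≤ 2 ΣD ⊕ *-monoʳ-≤ 2 (≤-reflexive (Σₛ-split R₁ joined-all D)) ⊕
         *-monoʳ-≤ 2 (Σₛ-≤const F k (λ v h → D≤k v (R₁⊆R v (F⊆ v h)))) ⊕
         *-monoʳ-≤ 2 (Σₛ-≤const N (suc k₀) small) ⊕
         e2-R ⊕ ≤-reflexive (Σₛ-split R₁ joined-all (deg R₁)) ⊕ Σₛ-≤const N 1 (λ v h → deg-R₁ v (N⊆ v h)) ⊕
         sparse (≤-trans (s≤s z≤n) 2≤k) Z₂ (λ p → no-path (HasPath-⊆ (λ v h → proj₁ (∧-true⁻ (Z v) h)) p)) ⊕
         *-monoʳ-≤ (2 * k) (≤-reflexive (sym #R′)) ⊕ *-monoˡ-≤ (2 * # N + 2 * # Z₁) (≤-reflexive k≡))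
        (regroup k k₀ (# R) (# F) (# N) (# Z₁) (# Z₂) (Σₛ R D) (Σₛ R₁ D) (Σₛ F D) (Σₛ N D) (e2 R) (e2 Z₂) (Σₛ R₁ (deg R₁)) (Σₛ F (deg R₁)) (Σₛ N (deg R₁)))
        where
        k₀ = k ∸ 2
        k≡ : suc (suc k₀) ≡ k
        k≡ = m+[n∸m]≡n 2≤k
        F⊆ : F ⊆ R₁
        F⊆ v h = proj₁ (∧-true⁻ (R₁ v) h)
        N⊆ : N ⊆ R₁
        N⊆ v h = proj₁ (∧-true⁻ (R₁ v) h)
        small : ∀ v → N v ≡ true → D v ≤ suc k₀
        small v h = s≤s⁻¹ (≤-trans (≰⇒> (not-does⁻ (k ≤? D v) (proj₂ (∧-true⁻ (R₁ v) h)))) (≤-reflexive (sym k≡)))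
        regroup : ∀ k k₀ r f n z w s t sf sn e e′ d df dn →
          df + (2 * k * r + 2 + 2 * s + 2 * t + 2 * sf + 2 * sn + e + d + dn + (e′ + w) + 2 * k * (f + n + (z + w)) + suc (suc k₀) * (2 * n + 2 * z)) ≡
          2 + n + z + w + (2 * s + e + 2 * t + 2 * (sf + sn) + 2 * (k * f) + 2 * (suc k₀ * n) + (d + 2 * z + e′) + (df + dn) + 1 * n + 2 * k * w + 2 * k * r + k * (2 * n + 2 * z)) + (z + k₀ * z * 2)
        regroup = solve-∀

      -- By `deficit` the degrees in `F` sum to at least two. By `no-edges` two disjoint edges
      -- cannot both have an end in `F`, so the sum is at most two. Equality empties `N`, `Z₁` and
      -- `Z₂` and leaves a single edge.
      edge-remainder : 2 * k * # R + 2 ≤ 2 * Σₛ R D + e2 R → Base edge R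
      edge-remainder rich = found (Σₛ-pos F (deg R₁) (≤-trans (s≤s z≤n) bound))
        where
        bound = deficit rich
        found : ∃[ x ] F x ≡ true × 1 ≤ deg R₁ x → Base edge R
        found (x , Fx , pos) = build (deg-positive R₁ x pos)
          where
          R₁x : R₁ x ≡ true
          R₁x = proj₁ (∧-true⁻ (R₁ x) Fx)
          k≤D : ∀ v → F v ≡ true → k ≤ D v
          k≤D v Fv = does⁻ (k ≤? D v) (proj₂ (∧-true⁻ (R₁ v) Fv))
          build : ∃[ y ] R₁ y ≡ true × Adj x y → Base edge R
          build (y , R₁y , x~y) = x , y , R₁⊆R x R₁x , R₁⊆R y R₁y , x~y , only
            where
            partner : ∀ {v u w} → R₁ v ≡ true → R₁ u ≡ true → R₁ w ≡ true → Adj v u → Adj v w → u ≡ w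
            partner {v} {u} {w} v∈ u∈ w∈ p q = no-walk u v w u∈ (R₁⊆R v v∈) (R₁⊆R w w∈) (adj-comm p) q
            ends : ∀ v → F v ≡ true → 1 ≤ deg R₁ v → v ∈ x ∷ y ∷ []
            ends v Fv pos′ with v Fin.≟ x | v Fin.≟ y
            ... | yes v≡x | _ = here v≡x
            ... | no _ | yes v≡y = there (here v≡y)
            ... | no v≢x | no v≢y =
              let v′ , R₁v′ , v~v′ = deg-positive R₁ v pos′
                  R₁v = proj₁ (∧-true⁻ (R₁ v) Fv)
              in contradiction (no-edges x y v v′ (R₁⊆R x R₁x) (R₁⊆R y R₁y) (R₁⊆R v R₁v) (R₁⊆R v′ R₁v′) (k≤D x Fx) (k≤D v Fv) x~y v~v′
                  (≢-sym v≢x)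
                  (λ x≡v′ → v≢y (partner R₁x R₁v R₁y (adj-comm (subst (Adj v) (sym x≡v′) v~v′)) x~y))
                  (≢-sym v≢y)
                  (λ y≡v′ → v≢x (partner R₁y R₁v R₁x (adj-comm (subst (Adj v) (sym y≡v′) v~v′)) (adj-comm x~y)))) λ ()
            at-most-two : Σₛ F (deg R₁) ≤ 2
            at-most-two = ≤-trans (Σₛ-≤lsum F (x ∷ y ∷ []) (deg R₁) ends) (+-mono-≤ (deg-R₁ x R₁x) (+-monoˡ-≤ 0 (deg-R₁ y R₁y)))
            nothing-else : # N + # Z₁ + # Z₂ ≤ 0
            nothing-else = s≤s⁻¹ (s≤s⁻¹ (≤-trans bound at-most-two))
            no-member : ∀ Y → # Y ≤ 0 → ∀ {v} → Y v ≡ true → ∀ {A : Set} → A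
            no-member Y le {v} Yv = true≢false Yv (#-empty Y (n≤0⇒n≡0 le) v)
            in-F : ∀ v → R v ≡ true → F v ≡ true
            in-F v Rv with R₁-or-Z v Rv
            ... | inj₁ p with true-or-false (joined-all v)
            ...   | inj₁ t = ∧-true⁺ p t
            ...   | inj₂ f = no-member N (≤-trans (≤-trans (m≤m+n (# N) (# Z₁)) (m≤m+n (# N + # Z₁) (# Z₂))) nothing-else) (∧-true⁺ p (cong not f))
            in-F v Rv | inj₂ p with true-or-false (near v)
            ...   | inj₁ t = no-member Z₁ (≤-trans (≤-trans (m≤n+m (# Z₁) (# N)) (m≤m+n (# N + # Z₁) (# Z₂))) nothing-else) (∧-true⁺ p t)
            ...   | inj₂ f = no-member Z₂ (≤-trans (m≤n+m (# Z₂) (# N + # Z₁)) nothing-else) (∧-true⁺ p (cong not f))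
            in-R₁ : ∀ v → R v ≡ true → R₁ v ≡ true
            in-R₁ v Rv = proj₁ (∧-true⁻ (R₁ v) (in-F v Rv))
            only : ∀ u v → R u ≡ true → R v ≡ true → Adj u v → u ≡ x × v ≡ y ⊎ u ≡ y × v ≡ x
            only u v Ru Rv u~v with ends u (in-F u Ru) (≤-trans (≤-reflexive (cong ⟦_⟧ (sym u~v))) (Σₛ-∈ R₁ (a? u) (in-R₁ v Rv)))
            ... | here refl = inj₁ (refl , partner R₁x (in-R₁ v Rv) R₁y u~v x~y)
            ... | there (here refl) = inj₂ (refl , partner R₁y (in-R₁ v Rv) R₁x u~v (adj-comm x~y))

-- Two paths

half-double : ∀ e → ⌊ 2 * e /2⌋ ≡ e
half-double zero    = refl
half-double (suc e) = trans (cong (λ m → ⌊ suc m /2⌋) (+-suc e (e + 0))) (cong suc (half-double e))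

half-odd : ∀ e → ⌊ odd e /2⌋ ≡ e
half-odd zero    = refl
half-odd (suc e) = trans (cong (λ m → ⌊ suc (suc m) /2⌋) (+-suc e (e + 0))) (cong suc (half-odd e))

-- Pairs of path lengths that decide which extremal graph occurs.
data Lengths : Kind → ℕ → ℕ → Set where
  even-any : ∀ e {ℓ} → 2 ≤ ℓ → Lengths bare (2 * suc e) ℓ
  odd-odd  : ∀ e f → Lengths edge (odd (2 + e)) (odd (suc f))
  three    : Lengths match 3 3

pick : ∀ {A : Set} {a : A} {xs : List A} j → a ∈ xs → suc j ≤ length xs → ∃[ cs ] ∃[ ds ] a ∷ cs ++ ds ↭ xs × length cs ≡ j
pick {a = a} j a∈ le with ∈-∃++ a∈
... | ys , zs , refl = take j (ys ++ zs) , drop j (ys ++ zs) ,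
  ↭-trans (prep a (Perm.↭-reflexive (List.take++drop≡id j (ys ++ zs)))) (↭-sym (Perm.shift a ys zs)) ,
  trans (List.length-take j (ys ++ zs)) (m≤n⇒m⊓n≡m (s≤s⁻¹ (≤-trans le (≤-reflexive (Perm.↭-length (Perm.shift a ys zs))))))

-- The structure on `k + m` vertices has degree sum at least `2 * k * m`. The summand `2 * k * k`
-- raises this to `2 * k` per vertex, and the 1 covers the rounding in a matching.
edgeC : ℕ → ℕ
edgeC k = 2 * k * k + 1

-- Both orders are included because `two-paths` expects the larger half first.
findC : ℕ → ℕ → ℕ → ℕ → ℕ
findC u v m E = twoPathsC u (v ∸ 1) m E + twoPathsC v (u ∸ 1) m E

commonNeeded : ℕ → ℕ → ℕ
commonNeeded ℓ k = 10 + ℓ + k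

pairC : ℕ → ℕ → ℕ → ℕ
pairC ℓ₁ ℓ₂ k = findC ⌊ ℓ₁ /2⌋ ⌊ ℓ₂ /2⌋ (commonNeeded ℓ₁ k) (edgeC k)

stepC : ℕ → List ℕ → ℕ → ℕ → ℕ
stepC x ls k N = suc (edgeC (⌊ x /2⌋ + k) + altC (2 + ⌊ x /2⌋ + total ls) ⌊ x /2⌋ (ubC (halves ls)) + N + ⌊ x /2⌋)

module Extremal {n : ℕ} (G : Graph n) where
  open Structure G public

  ladj-positive : ∀ v A → 1 ≤ ladj v A → ∃[ a ] a ∈ A × Adj v a
  ladj-positive v (a ∷ A) pos with true-or-false (adj G v a)
  ... | inj₁ v~a = a , here refl , v~a
  ... | inj₂ v≁a = let b , b∈ , v~b = ladj-positive v A (subst (λ t → 1 ≤ ⟦ t ⟧ + ladj v A) v≁a pos) in b , there b∈ , v~b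

  ladj-full : ∀ v A → length A ≤ ladj v A → ∀ {a} → a ∈ A → Adj v a
  ladj-full v (a ∷ A) le a∈ with true-or-false (adj G v a)
  ... | inj₂ v≁a = contradiction (subst (λ t → suc (length A) ≤ ⟦ t ⟧ + ladj v A) v≁a le) (<⇒≱ (s≤s (ladj≤length v A)))
  ladj-full v (a ∷ A) le (here refl) | inj₁ v~a = v~a
  ladj-full v (a ∷ A) le (there a∈)  | inj₁ v~a = ladj-full v A (s≤s⁻¹ (subst (λ t → suc (length A) ≤ ⟦ t ⟧ + ladj v A) v~a le)) a∈

  complete : ∀ {X A ws xs} ℓ₁ ℓ₂ → Hub X A ws → IsPath X xs → Disjoint xs A → 1 ≤ ℓ₁ → ℓ₁ ≤ length xs → 1 ≤ ℓ₂ → ℓ₂ ≤ odd (length A) →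
    2 + length A + ℓ₁ ≤ length ws → HasForest X (ℓ₁ ∷ ℓ₂ ∷ [])
  complete {A = A} ℓ₁ ℓ₂ H path dis 1≤ℓ₁ ℓ₁≤ 1≤ℓ₂ ℓ₂≤ many =
    let ys , len , path′ , sub = path-shorten ℓ₁ 1≤ℓ₁ ℓ₁≤ path in
    HasForest-↭ (swap ℓ₂ ℓ₁ ↭-refl) (hub-extend ℓ₂ H (cons path′ len [] λ { (_ , ()) })
      (λ (v∈ , v∈A) → case ∈-++⁻ ys v∈ of λ { (inj₁ h) → dis (sub h , v∈A) }) 1≤ℓ₂ ℓ₂≤
      (≤-trans (≤-reflexive (cong (2 + length A +_) (+-identityʳ ℓ₁))) many))

  -- `suc j` connectors, beginning with `a`, carry the first path between the two tails; the other
  -- `d` carry the second one with common neighbours alone.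
  forest-by-tails : ∀ {X A ws a} h h′ j d ℓ₁ ℓ₂ K₀ Kl → Hub X A ws → a ∈ A → Tail h K₀ a → (∀ {c} → c ∈ A → Tail h′ Kl c) →
    Disjoint K₀ Kl → Disjoint K₀ A → Disjoint Kl A → Inside X K₀ → Inside X Kl →
    suc j + d ≡ length A → 1 ≤ ℓ₁ → ℓ₁ ≤ h + (suc (2 * j) + h′) → 1 ≤ ℓ₂ → ℓ₂ ≤ odd d →
    j + (length K₀ + length Kl) ≤ length ws → 2 + d + ℓ₁ ≤ length ws → HasForest X (ℓ₁ ∷ ℓ₂ ∷ [])
  forest-by-tails {X} {A} {ws} {a} h h′ j d ℓ₁ ℓ₂ K₀ Kl H a∈ t₀ tl d₀l d₀ dl i₀ il sum≡ 1≤ℓ₁ ℓ₁≤ 1≤ℓ₂ ℓ₂≤ many many′ =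
    build (pick j a∈ (≤-trans (m≤m+n (suc j) d) (≤-reflexive sum≡)))
    where
    build : ∃[ cs ] ∃[ ds ] a ∷ cs ++ ds ↭ A × length cs ≡ j → HasForest X (ℓ₁ ∷ ℓ₂ ∷ [])
    build (cs , ds , perm , refl) =
      let xs , path , long , cont = hub-span h h′ K₀ Kl (hub-restrict (unique-++ˡ (a ∷ cs) uniq) in₁ H) many t₀ (λ c∈ → tl (in₁ c∈))
                                      d₀l (λ (p , q) → d₀ (p , in₁ q)) (λ (p , q) → dl (p , in₁ q)) i₀ il
          away = cont (_∉ ds) (All.tabulate (λ p q → unique-++-disjoint (a ∷ cs) uniq (p , q)))
                   (All.tabulate (λ p q → d₀ (p , in₂ q))) (All.tabulate (λ p q → dl (p , in₂ q))) (All.tabulate (λ p q → hub-disjoint H (p , in₂ q)))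
      in complete ℓ₁ ℓ₂ (hub-restrict (unique-++ʳ (a ∷ cs) uniq) in₂ H) path (λ (p , q) → All.lookup away p q) 1≤ℓ₁ (≤-trans ℓ₁≤ long) 1≤ℓ₂
           (≤-trans ℓ₂≤ (≤-reflexive (cong odd (sym len-ds)))) (≤-trans (≤-reflexive (cong (λ t → 2 + t + ℓ₁) len-ds)) many′)
      where
      uniq : Unique (a ∷ cs ++ ds)
      uniq = Unique-resp-↭ (↭-sym perm) (A-unique H)
      in₁ : ∀ {v} → v ∈ a ∷ cs → v ∈ A
      in₁ v∈ = Perm.∈-resp-↭ perm (∈-++⁺ˡ v∈)
      in₂ : ∀ {v} → v ∈ ds → v ∈ A
      in₂ v∈ = Perm.∈-resp-↭ perm (∈-++⁺ʳ (a ∷ cs) v∈)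
      len-ds : length ds ≡ d
      len-ds = +-cancelˡ-≡ (suc (length cs)) _ _ (trans (sym (List.length-++ (a ∷ cs))) (trans (Perm.↭-length perm) (sym sum≡)))

  forest-by-tail : ∀ {X A ws a} h j d ℓ₁ ℓ₂ K₀ → Hub X A ws → a ∈ A → Tail h K₀ a → Disjoint K₀ A → Inside X K₀ → length K₀ ≤ 3 →
    suc j + d ≡ length A → 1 ≤ ℓ₁ → ℓ₁ ≤ h + (suc (2 * j) + 1) → 1 ≤ ℓ₂ → ℓ₂ ≤ odd d →
    commonNeeded ℓ₁ (length A) ≤ length ws → HasForest X (ℓ₁ ∷ ℓ₂ ∷ [])
  forest-by-tail {X} {A} {ws} {a} h j d ℓ₁ ℓ₂ K₀ H a∈ t₀ d₀ i₀ short sum≡ 1≤ℓ₁ ℓ₁≤ 1≤ℓ₂ ℓ₂≤ many = build (ws ∖∖ K₀) refl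
    where
    build : ∀ us → us ≡ ws ∖∖ K₀ → HasForest X (ℓ₁ ∷ ℓ₂ ∷ [])
    build [] eq = contradiction (≤-trans (≤-trans (≤-trans (≤-trans (s≤s (s≤s (s≤s (s≤s z≤n)))) many) (∖∖-length {ws = ws} {K₀} (ws-unique H)))
      (≤-reflexive (cong (λ us → length us + length K₀) (sym eq)))) short) λ { (s≤s (s≤s (s≤s ()))) }
    build (w ∷ us) eq = forest-by-tails h 1 j d ℓ₁ ℓ₂ K₀ (w ∷ []) H a∈ t₀
      (λ c∈ → w , w , w ∷ [] , joined H c∈ w∈ws , [ w ] , [] ∷ [] , id , ≤-refl)
      (λ { (v∈ , here refl) → ∖∖-disjoint {ws = ws} K₀ (w∈ , v∈) }) d₀ (λ { (here refl , v∈) → hub-disjoint H (w∈ws , v∈) }) i₀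
      (All.lookup (ws-inside H) w∈ws ∷ []) sum≡ 1≤ℓ₁ ℓ₁≤ 1≤ℓ₂ ℓ₂≤
      (lin (7 + ℓ₁ + d) (many ⊕ ≤-reflexive sum≡ ⊕ short) (count₁ j d ℓ₁ (length K₀) (length A) (length ws)))
      (lin (9 + j) (many ⊕ ≤-reflexive sum≡) (count₂ j d ℓ₁ (length A) (length ws)))
      where
      w∈ : w ∈ ws ∖∖ K₀
      w∈ = subst (w ∈_) eq (here refl)
      w∈ws = ∖∖-⊆ {ws = ws} {K₀} w∈
      count₁ : ∀ j d l k a w → w + (10 + l + a + suc (j + d) + k) ≡ j + (k + 1) + (w + a + 3) + (7 + l + d)
      count₁ = solve-∀
      count₂ : ∀ j d l a w → w + (10 + l + a + suc (j + d)) ≡ 2 + d + l + (w + a) + (9 + j)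
      count₂ = solve-∀

  module OverHub {X : VSet n} {A ws : List V} (H : Hub X A ws) where
    R : VSet n
    R = X ∖ A

    outside : ∀ {v} → R v ≡ true → v ∉ A
    outside Rv = proj₂ (∈∖⁻ X A Rv)

    within : R ⊆ X
    within = ∖⊆ X A

    D : V → ℕ
    D v = ladj v A

    D≤k : ∀ v → R v ≡ true → D v ≤ length A
    D≤k v _ = ladj≤length v A

    open Remainder R D (length A) D≤k public

    rich-remainder : ∀ {κ m} → Rich κ (length A) m X → 2 * length A * # R + gap κ (# R) ≤ 2 * Σₛ R D + e2 R + slack κ
    rich-remainder {κ} {m} (#X , rich) = subst (λ t → 2 * length A * t + gap κ t ≤ 2 * Σₛ R D + e2 R + slack κ) (sym #R≡m)
      (lin 0 (rich ⊕ e2-cross A X (A-unique H) (A-inside H) ⊕ ≤-reflexive (sym (φ≡tri m (length A))) ⊕ *-monoʳ-≤ 2 (≤-reflexive (lsum-deg R A)))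
        (regroup (φ m (length A)) (2 * length A * m) (gap κ m) (slack κ) (e2 X) (tri (length A)) (lsum (deg R) A) (e2 R) (Σₛ R D)))
      where
      #R≡m : # R ≡ m
      #R≡m = +-cancelˡ-≡ (length A) _ _ (trans (sym (#-removeL X A (A-unique H) (A-inside H))) #X)
      regroup : ∀ f c g s e t l r d → 2 * d + r + s + (f + g + e + (t + c) + 2 * l) ≡ c + g + (e + s + (t + 2 * l + r) + f + 2 * d) + 0
      regroup = solve-∀

    finish : ∀ {κ m} → Rich κ (length A) m X → Base κ R → Struct κ (length A) X
    finish {κ} {m} rich b = subst (λ k → Struct κ k X) (+-identityʳ _)
      (peelL A X (A-unique H) (A-inside H) (subst (λ k → Rich κ k m X) (sym (+-identityʳ _)) rich) (λ _ → base b))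

    no-long-path : ∀ {ℓ₁ ℓ₂} → 1 ≤ ℓ₁ → 1 ≤ ℓ₂ → ℓ₁ ≤ odd (length A) → ℓ₂ ≤ odd (length A) → commonNeeded ℓ₁ (length A) ≤ length ws →
      ¬ HasForest X (ℓ₁ ∷ ℓ₂ ∷ []) → ¬ HasPath Z (odd (length A))
    no-long-path {ℓ₁} {ℓ₂} 1≤ℓ₁ 1≤ℓ₂ ℓ₁≤ ℓ₂≤ many free (xs , len , w , u , i) =
      free (complete ℓ₁ ℓ₂ H (w , u , Inside-⊆ (λ v Zv → within v (proj₁ (Z⁻ v Zv))) i)
        (λ (p , q) → outside (proj₁ (Z⁻ _ (All.lookup i p))) q) 1≤ℓ₁ (≤-trans ℓ₁≤ (≤-reflexive (sym len))) 1≤ℓ₂ ℓ₂≤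
        (≤-trans (lin 8 (≤-refl {0}) (count (length A) ℓ₁)) many))
      where
      count : ∀ a l → 10 + l + a + 0 ≡ 2 + a + l + 0 + 8
      count = solve-∀

    in-R₁ : ∀ {v} → R₁ v ≡ true → R v ≡ true × ∃[ a ] a ∈ A × Adj v a
    in-R₁ {v} h = let Rv , pos = R₁⁻ v h in Rv , ladj-positive v A pos

    from-tail : ∀ {ℓ₁ ℓ₂ x xs z} h j d → (∃[ a ] a ∈ A × Adj x a) → Walk x z xs → Unique xs → Inside R xs → length xs ≡ h → h ≤ 3 →
      suc j + d ≡ length A → 1 ≤ ℓ₁ → ℓ₁ ≤ h + (suc (2 * j) + 1) → 1 ≤ ℓ₂ → ℓ₂ ≤ odd d →
      commonNeeded ℓ₁ (length A) ≤ length ws → HasForest X (ℓ₁ ∷ ℓ₂ ∷ [])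
    from-tail {ℓ₁} {ℓ₂} {x} {xs} {z} h j d (a , a∈ , x~a) w u i refl h≤3 =
      forest-by-tail h j d ℓ₁ ℓ₂ xs H a∈ (x , z , xs , adj-comm x~a , w , u , id , ≤-refl)
        (λ (p , q) → outside (All.lookup i p) q) (Inside-⊆ within i) h≤3

  -- The hub is one connector short of carrying both paths. An excluded configuration in the
  -- remainder makes up for this: either it lengthens the ends of the first path so that one
  -- connector is saved, or it is the first path itself.
  pair-struct : ∀ {κ ℓ₁ ℓ₂ X A ws m} → Lengths κ ℓ₁ ℓ₂ → Hub X A ws → suc (length A) ≡ ⌊ ℓ₁ /2⌋ + ⌊ ℓ₂ /2⌋ →
    commonNeeded ℓ₁ (length A) ≤ length ws → ¬ HasForest X (ℓ₁ ∷ ℓ₂ ∷ []) → Rich κ (length A) m X → Struct κ (length A) X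
  pair-struct {ℓ₂ = ℓ₂} {X} {A} {ws} {m} (even-any e 2≤ℓ₂) H size many free rich =
    O.finish {bare} {m} rich (O.bare-remainder 1≤A no-edge (O.no-long-path {2 * suc e} {ℓ₂} (s≤s z≤n) (≤-trans (s≤s z≤n) 2≤ℓ₂) long₁ long₂ many free)
      (lin 0 (O.rich-remainder {bare} {m} rich) (regroup (2 * length A * # O.R) (2 * Σₛ O.R O.D + e2 O.R))))
    where
    module O = OverHub H
    f = ⌊ ℓ₂ /2⌋
    size′ : e + f ≡ length A
    size′ = suc-injective (trans (cong (_+ f) (sym (half-double (suc e)))) (sym size))
    1≤f : 1 ≤ f
    1≤f = ⌊n/2⌋-mono 2≤ℓ₂
    1≤A : 1 ≤ length A
    1≤A = ≤-trans (≤-trans 1≤f (m≤n+m f e)) (≤-reflexive size′)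
    long₁ : 2 * suc e ≤ odd (length A)
    long₁ = lin 0 (*-monoʳ-≤ 2 (≤-trans (+-monoʳ-≤ e 1≤f) (≤-reflexive size′)) ⊕ z≤n {1}) (count e (length A))
      where
      count : ∀ e a → suc (2 * a) + (2 * (e + 1) + 0) ≡ 2 * suc e + (2 * a + 1) + 0
      count = solve-∀
    long₂ : ℓ₂ ≤ odd (length A)
    long₂ = ≤-trans (≤odd-half ℓ₂) (s≤s (*-monoʳ-≤ 2 (≤-trans (m≤n+m f e) (≤-reflexive size′))))
    no-edge : ∀ x y → O.R₁ x ≡ true → O.R y ≡ true → ¬ Adj x y
    no-edge x y h Ry x~y = let Rx , a = O.in-R₁ h in free (by-size e refl Rx a)
      where
      by-size : ∀ e′ → e′ ≡ e → O.R x ≡ true → (∃[ a ] a ∈ A × Adj x a) → HasForest X (2 * suc e ∷ ℓ₂ ∷ [])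
      by-size zero refl Rx a = complete 2 ℓ₂ H ((x , y , x~y ∷ [ y ]) , (adj-≢ x~y ∷ []) ∷ [] ∷ [] , O.within x Rx ∷ O.within y Ry ∷ [])
        (λ { (here refl , q) → O.outside Rx q ; (there (here refl) , q) → O.outside Ry q }) (s≤s z≤n) ≤-refl (≤-trans (s≤s z≤n) 2≤ℓ₂) long₂
        (≤-trans (lin 8 (≤-refl {0}) (count (length A))) many)
        where
        count : ∀ a → 10 + 2 + a + 0 ≡ 2 + a + 2 + 0 + 8
        count = solve-∀
      by-size (suc j) refl Rx a = O.from-tail 2 j f a (x~y ∷ [ y ]) ((adj-≢ x~y ∷ []) ∷ [] ∷ []) (Rx ∷ Ry ∷ []) refl (s≤s (s≤s z≤n))
        size′ (s≤s z≤n) (≤-reflexive (count j)) (≤-trans (s≤s z≤n) 2≤ℓ₂) (≤odd-half ℓ₂) many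
        where
        count : ∀ j → 2 * (2 + j) ≡ 2 + (1 + 2 * j + 1)
        count = solve-∀
    regroup : ∀ a b → b + (a + 0) ≡ a + (b + 0) + 0
    regroup = solve-∀
  pair-struct {X = X} {A} {ws} {m} (odd-odd e f) H size many free rich =
    O.finish {edge} {m} rich (O.edge-remainder 2≤A no-walk (O.no-long-path {ℓ₁} {ℓ₂} (s≤s z≤n) (s≤s z≤n) long₁ long₂ many free) no-edges
      (lin 0 (O.rich-remainder {edge} {m} rich) (regroup (2 * length A * # O.R) (2 * Σₛ O.R O.D + e2 O.R))))
    where
    module O = OverHub H
    ℓ₁ = odd (2 + e)
    ℓ₂ = odd (suc f)
    size′ : suc e + suc f ≡ length A
    size′ = suc-injective (trans (cong₂ _+_ (sym (half-odd (2 + e))) (sym (half-odd (suc f)))) (sym size))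
    2≤A : 2 ≤ length A
    2≤A = ≤-trans (≤-trans (s≤s (s≤s z≤n)) (≤-reflexive (sym (cong suc (+-suc e f))))) (≤-reflexive size′)
    long₁ : ℓ₁ ≤ odd (length A)
    long₁ = s≤s (*-monoʳ-≤ 2 (≤-trans (≤-trans (s≤s (s≤s (m≤m+n e f))) (≤-reflexive (sym (cong suc (+-suc e f))))) (≤-reflexive size′)))
    long₂ : ℓ₂ ≤ odd (length A)
    long₂ = s≤s (*-monoʳ-≤ 2 (≤-trans (m≤n+m (suc f) (suc e)) (≤-reflexive size′)))
    no-walk : ∀ x y z → O.R₁ x ≡ true → O.R y ≡ true → O.R z ≡ true → Adj x y → Adj y z → x ≡ z
    no-walk x y z h Ry Rz x~y y~z with x Fin.≟ z
    ... | yes eq = eq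
    ... | no x≢z = let Rx , a = O.in-R₁ h in contradiction
      (O.from-tail 3 e (suc f) a (x~y ∷ (y~z ∷ [ z ])) ((adj-≢ x~y ∷ x≢z ∷ []) ∷ (adj-≢ y~z ∷ []) ∷ [] ∷ []) (Rx ∷ Ry ∷ Rz ∷ []) refl ≤-refl
        size′ (s≤s z≤n) (≤-reflexive (count e)) (s≤s z≤n) ≤-refl many) free
      where
      count : ∀ e → 1 + 2 * (2 + e) ≡ 3 + (1 + 2 * e + 1)
      count = solve-∀
    no-edges : ∀ x y x′ y′ → O.R x ≡ true → O.R y ≡ true → O.R x′ ≡ true → O.R y′ ≡ true → length A ≤ O.D x → length A ≤ O.D x′ →
               Adj x y → Adj x′ y′ → x ≢ x′ → x ≢ y′ → y ≢ x′ → y ≢ y′ → ⊥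
    no-edges x y x′ y′ Rx Ry Rx′ Ry′ full full′ x~y x′~y′ p q r s =
      let a , a∈ , x~a = ladj-positive x A (≤-trans (≤-trans (s≤s z≤n) 2≤A) full) in
      free (forest-by-tails 2 2 e (suc f) ℓ₁ ℓ₂ (x ∷ y ∷ []) (x′ ∷ y′ ∷ []) H a∈
        (x , y , x ∷ y ∷ [] , adj-comm x~a , x~y ∷ [ y ] , (adj-≢ x~y ∷ []) ∷ [] ∷ [] , id , ≤-refl)
        (λ c∈ → x′ , y′ , x′ ∷ y′ ∷ [] , adj-comm (ladj-full x′ A full′ c∈) , x′~y′ ∷ [ y′ ] , (adj-≢ x′~y′ ∷ []) ∷ [] ∷ [] , id , ≤-refl)
        (λ { (here refl , here eq) → p eq ; (here refl , there (here eq)) → q eq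
           ; (there (here refl) , here eq) → r eq ; (there (here refl) , there (here eq)) → s eq })
        (λ { (here refl , h) → O.outside Rx h ; (there (here refl) , h) → O.outside Ry h })
        (λ { (here refl , h) → O.outside Rx′ h ; (there (here refl) , h) → O.outside Ry′ h })
        (O.within x Rx ∷ O.within y Ry ∷ []) (O.within x′ Rx′ ∷ O.within y′ Ry′ ∷ [])
        size′ (s≤s z≤n) (≤-reflexive (count e)) (s≤s z≤n) ≤-refl
        (lin (8 + f + ℓ₁) (many ⊕ ≤-reflexive size′) (count₁ e f ℓ₁ (length A) (length ws)))
        (lin (8 + suc e) (many ⊕ ≤-reflexive size′) (count₂ e f ℓ₁ (length A) (length ws))))
      where
      count : ∀ e → 1 + 2 * (2 + e) ≡ 2 + (1 + 2 * e + 2)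
      count = solve-∀
      count₁ : ∀ e f l a w → w + (10 + l + a + (suc e + suc f)) ≡ e + 4 + (w + a) + (8 + f + l)
      count₁ = solve-∀
      count₂ : ∀ e f l a w → w + (10 + l + a + (suc e + suc f)) ≡ 2 + suc f + l + (w + a) + (8 + suc e)
      count₂ = solve-∀
    regroup : ∀ a b → b + (a + 2) ≡ a + 2 + (b + 0) + 0
    regroup = solve-∀
  pair-struct {X = X} {A} {ws} {m} three H size many free rich =
    O.finish {match} {m} rich (O.match-remainder no-cherry one′ (O.rich-remainder {match} {m} rich))
    where
    module O = OverHub H
    one′ : length A ≡ 1
    one′ = suc-injective size
    no-cherry : ∀ x y z → O.R x ≡ true → O.R y ≡ true → O.R z ≡ true → Adj x y → Adj y z → x ≡ z
    no-cherry x y z Rx Ry Rz x~y y~z with x Fin.≟ z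
    ... | yes eq = eq
    ... | no x≢z = contradiction (complete 3 3 H
      ((x , z , x~y ∷ (y~z ∷ [ z ])) , (adj-≢ x~y ∷ x≢z ∷ []) ∷ (adj-≢ y~z ∷ []) ∷ [] ∷ [] , O.within x Rx ∷ O.within y Ry ∷ O.within z Rz ∷ [])
      (λ { (here refl , h) → O.outside Rx h ; (there (here refl) , h) → O.outside Ry h ; (there (there (here refl)) , h) → O.outside Rz h })
      (s≤s z≤n) ≤-refl (s≤s z≤n) (≤-reflexive (cong odd (sym one′)))
      (≤-trans (lin 8 (≤-refl {0}) (count (length A))) many)) free
      where
      count : ∀ a → 10 + 3 + a + 0 ≡ 2 + a + 3 + 0 + 8
      count = solve-∀

-- Induction on the number of paths

hubSize : List ℕ → ℕ → ℕ → ℕ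
hubSize []       p q = ⌊ p /2⌋ + ⌊ q /2⌋ ∸ 1
hubSize (x ∷ ls) p q = ⌊ x /2⌋ + hubSize ls p q

hubSize≡ : ∀ ls p q → 2 ≤ p → suc (hubSize ls p q) ≡ total (halves (ls ++ p ∷ q ∷ []))
hubSize≡ [] p q 2≤p = trans (m+[n∸m]≡n (≤-trans (⌊n/2⌋-mono 2≤p) (m≤m+n _ _))) (cong (⌊ p /2⌋ +_) (sym (+-identityʳ _)))
hubSize≡ (x ∷ ls) p q 2≤p = trans (sym (+-suc ⌊ x /2⌋ _)) (cong (⌊ x /2⌋ +_) (hubSize≡ ls p q 2≤p))

extremalC : List ℕ → ℕ → ℕ → ℕ
extremalC []       p q = pairC p q (hubSize [] p q)
extremalC (x ∷ ls) p q = stepC x (ls ++ p ∷ q ∷ []) (hubSize ls p q) (extremalC ls p q)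

module LinearForests {n : ℕ} (G : Graph n) where
  open Extremal G public

  rich-dense : ∀ {κ k m X} → Rich κ k m X → 2 * k * # X ≤ e2 X + edgeC k
  rich-dense {κ} {k} {m} {X} (#X , rich) = subst (λ t → 2 * k * t ≤ e2 X + edgeC k) (sym #X)
    (lin (tri k + gap κ m) (rich ⊕ slack≤1 κ ⊕ ≤-reflexive (sym (φ≡tri m k))) (regroup (e2 X) (φ m k) (gap κ m) (slack κ) (tri k) k m))
    where
    regroup : ∀ e f g s t k m → e + (2 * k * k + 1) + (f + g + s + (t + 2 * k * m)) ≡ 2 * k * (k + m) + (e + s + 1 + f) + (t + g)
    regroup = solve-∀

  find-hub : ∀ ℓ₁ ℓ₂ k m E X → 2 ≤ ℓ₁ → 2 ≤ ℓ₂ → suc k ≡ ⌊ ℓ₁ /2⌋ + ⌊ ℓ₂ /2⌋ → 1 ≤ m → ¬ HasForest X (ℓ₁ ∷ ℓ₂ ∷ []) →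
    2 * k * # X ≤ e2 X + E → findC ⌊ ℓ₁ /2⌋ ⌊ ℓ₂ /2⌋ m E ≤ # X → HasHub X k m
  find-hub ℓ₁ ℓ₂ k m E X 2≤ℓ₁ 2≤ℓ₂ size 1≤m free dense large =
    decide ⌊ ℓ₁ /2⌋ ⌊ ℓ₂ /2⌋ (⌊n/2⌋-mono 2≤ℓ₁) (⌊n/2⌋-mono 2≤ℓ₂) size large
      (λ f → free (HasForest-shorten (ℓ₁ ∷ ℓ₂ ∷ []) (≤-trans (s≤s z≤n) 2≤ℓ₁ ∷ ≤-trans (s≤s z≤n) 2≤ℓ₂ ∷ []) f))
    where
    decide : ∀ u v → 1 ≤ u → 1 ≤ v → suc k ≡ u + v → findC u v m E ≤ # X → ¬ HasForest X (odd u ∷ odd v ∷ []) → HasHub X k m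
    decide (suc u) (suc v) _ _ size large free with ≤-total (suc v) (suc u)
    ... | inj₁ v≤u = subst (λ k → HasHub X k m) (sym k≡)
          (two-paths (suc u) v m E X 1≤m v≤u free (subst (λ k → 2 * k * # X ≤ e2 X + E) k≡ dense) (≤-trans (m≤m+n _ _) large))
      where
      k≡ : k ≡ suc u + v
      k≡ = suc-injective (trans size (+-suc (suc u) v))
    ... | inj₂ u≤v = subst (λ k → HasHub X k m) (sym k≡)
          (two-paths (suc v) u m E X 1≤m u≤v (λ f → free (HasForest-↭ (swap _ _ ↭-refl) f)) (subst (λ k → 2 * k * # X ≤ e2 X + E) k≡ dense)
            (≤-trans (m≤n+m _ (twoPathsC (suc u) v m E)) large))
      where
      k≡ : k ≡ suc v + u
      k≡ = suc-injective (trans size (trans (+-comm (suc u) (suc v)) (+-suc (suc v) u)))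

  pair-extremal : ∀ {κ m} ℓ₁ ℓ₂ k X → Lengths κ ℓ₁ ℓ₂ → 2 ≤ ℓ₁ → 2 ≤ ℓ₂ → suc k ≡ ⌊ ℓ₁ /2⌋ + ⌊ ℓ₂ /2⌋ →
    pairC ℓ₁ ℓ₂ k ≤ # X → ¬ HasForest X (ℓ₁ ∷ ℓ₂ ∷ []) → Rich κ k m X → Struct κ k X
  pair-extremal {κ} {m} ℓ₁ ℓ₂ k X lens 2≤ℓ₁ 2≤ℓ₂ size large free rich =
    use (find-hub ℓ₁ ℓ₂ k (commonNeeded ℓ₁ k) (edgeC k) X 2≤ℓ₁ 2≤ℓ₂ size (s≤s z≤n) free (rich-dense {κ} {k} {m} rich) large)
    where
    use : HasHub X k (commonNeeded ℓ₁ k) → Struct κ k X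
    use (A , ws , H , refl , many) = pair-struct {m = m} lens H size many free rich

  -- Since `total (halves ls)` is `suc k`, the two sparse outcomes have average degree at most
  -- `2 * b - 1` and `2 * (b + k) - 1`, up to constants. Both lie below the required `2 * (b + k)`,
  -- so `X` would be small. What is left is a hub, which is peeled off.
  step-extremal : ∀ {κ m} x ls k N X → 2 ≤ x → All (2 ≤_) ls → suc k ≡ total (halves ls) →
    (∀ Y → N ≤ # Y → ¬ HasForest Y ls → Rich κ k m Y → Struct κ k Y) →
    stepC x ls k N ≤ # X → ¬ HasForest X (x ∷ ls) → Rich κ (⌊ x /2⌋ + k) m X → Struct κ (⌊ x /2⌋ + k) X
  step-extremal {κ} {m} x ls k N X 2≤x 2≤ls size rec large free rich =
    decide (alternative b (halves ls) c C X (⌊n/2⌋-mono 2≤x) (s≤s z≤n) (upper-bound (halves ls) (All.map⁺ (All.map ⌊n/2⌋-mono 2≤ls)))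
      (λ f → free (HasForest-shorten (x ∷ ls) (≤-trans (s≤s z≤n) 2≤x ∷ All.map (≤-trans (s≤s z≤n)) 2≤ls) f)))
    where
    b = ⌊ x /2⌋
    c = 2 + b + total ls
    C = ubC (halves ls)
    E = edgeC (b + k)
    C₃ = altC c b C
    dense : 2 * (b + k) * # X ≤ e2 X + E
    dense = rich-dense {κ} {b + k} {m} rich
    too-big : # X ≤ E + C₃ → Struct κ (b + k) X
    too-big le = contradiction (≤-trans large (≤-trans le (≤-trans (m≤m+n (E + C₃) N) (m≤m+n (E + C₃ + N) b)))) (<⇒≱ (n<1+n _))
    decide : Dense 1 b 0 X ⊎ HasHub X b c ⊎ Dense 3 (b + total (halves ls)) C₃ X → Struct κ (b + k) X
    decide (inj₁ sparse) = too-big (lin (2 * k * # X + C₃) (sparse ⊕ dense) (regroup (e2 X) (# X) b k E C₃))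
      where
      regroup : ∀ e x b k E c → E + c + (e + 1 * x + 2 * (b + k) * x) ≡ x + (2 * b * x + 0 + (e + E)) + (2 * k * x + c)
      regroup = solve-∀
    decide (inj₂ (inj₂ sparse)) = too-big (lin 0 (subst (λ t → e2 X + 3 * # X ≤ 2 * (b + t) * # X + C₃) (sym size) sparse ⊕ dense) (regroup (e2 X) (# X) b k E C₃))
      where
      regroup : ∀ e x b k E c → E + c + (e + 3 * x + 2 * (b + k) * x) ≡ x + (2 * (b + suc k) * x + c + (e + E)) + 0
      regroup = solve-∀
    decide (inj₂ (inj₁ (A , ws , H , lenA , many))) = subst (λ a → Struct κ (a + k) X) lenA
      (peelL A X (A-unique H) (A-inside H) (subst (λ a → Rich κ (a + k) m X) (sym lenA) rich)
        (rec (X ∖ A) enough (hub-free x H (≤-trans (s≤s z≤n) 2≤x) (≤-trans (≤odd-half x) (≤-reflexive (cong odd (sym lenA))))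
          (≤-trans (≤-reflexive (cong (λ a → 2 + a + total ls) lenA)) many) free)))
      where
      enough : N ≤ # (X ∖ A)
      enough = lin (E + C₃ + 1) (large ⊕ ≤-reflexive (#-removeL X A (A-unique H) (A-inside H)) ⊕ ≤-reflexive lenA)
        (regroup N (# (X ∖ A)) (# X) (length A) b (E + C₃))
        where
        regroup : ∀ N y x a b e → y + (suc (e + N + b) + x + a) ≡ N + (x + (a + y) + b) + (e + 1)
        regroup = solve-∀

  forest-extremal : ∀ {κ m} ls p q X → Lengths κ p q → All (2 ≤_) ls → 2 ≤ p → 2 ≤ q →
    extremalC ls p q ≤ # X → ¬ HasForest X (ls ++ p ∷ q ∷ []) → Rich κ (hubSize ls p q) m X → Struct κ (hubSize ls p q) X
  forest-extremal [] p q X lens _ 2≤p 2≤q = pair-extremal p q (hubSize [] p q) X lens 2≤p 2≤q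
    (trans (hubSize≡ [] p q 2≤p) (cong (⌊ p /2⌋ +_) (+-identityʳ _)))
  forest-extremal {κ} {m} (x ∷ ls) p q X lens (2≤x ∷ 2≤ls) 2≤p 2≤q = step-extremal x (ls ++ p ∷ q ∷ []) (hubSize ls p q) (extremalC ls p q) X 2≤x
    (All.++⁺ 2≤ls (2≤p ∷ 2≤q ∷ [])) (hubSize≡ ls p q 2≤p) (λ Y → forest-extremal {κ} {m} ls p q Y lens 2≤ls 2≤p 2≤q)

-- Isomorphism with the extremal graphs

leftover-size : Kind → ℕ → ℕ
leftover-size bare  m = m
leftover-size edge  m = 2 + m
leftover-size match m = m

leftover : ∀ κ m → Graph (leftover-size κ m)
leftover bare  m = K̄ m
leftover edge  m = K 2 ∪ K̄ m
leftover match m = matching m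

K̄-edgeless : ∀ {n} (i j : Fin n) → adj (K̄ n) i j ≡ false
K̄-edgeless i j with does (i Fin.≟ j)
... | true  = refl
... | false = refl

∨-suc-suc : ∀ {k m} (M : Graph m) (i j : Fin (k + m)) → adj (K (suc k) ∨ M) (suc i) (suc j) ≡ adj (K k ∨ M) i j
∨-suc-suc {k} M i j with Fin.splitAt k i | Fin.splitAt k j
... | inj₁ _ | inj₁ _ = refl
... | inj₁ _ | inj₂ _ = refl
... | inj₂ _ | inj₁ _ = refl
... | inj₂ _ | inj₂ _ = refl

∨-zero-suc : ∀ {k m} (M : Graph m) (j : Fin (k + m)) → adj (K (suc k) ∨ M) zero (suc j) ≡ true
∨-zero-suc {k} M j with Fin.splitAt k j
... | inj₁ _ = refl
... | inj₂ _ = refl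

module _ {n : ℕ} where

  record Enumeration (X : VSet n) (N : ℕ) : Set where
    field
      ι     : Fin N → Fin n
      ι-inj : ∀ {i j} → ι i ≡ ι j → i ≡ j
      into  : ∀ i → X (ι i) ≡ true
      onto  : ∀ v → X v ≡ true → ∃[ i ] ι i ≡ v

  enumerate-∅ : ∀ {X} → (∀ v → X v ≡ false) → Enumeration X 0
  enumerate-∅ h = record { ι = λ () ; ι-inj = λ { {()} } ; into = λ () ; onto = λ v Xv → true≢false Xv (h v) }

  -- The new vertex gets index zero, in agreement with the recursive shape of `K (suc k) ∨ M` and
  -- `K 2 ∪ M`.
  enumerate-cons : ∀ {X a N} → X a ≡ true → Enumeration (X - a) N → Enumeration X (suc N)
  enumerate-cons {X} {a} {N} Xa E = record { ι = ι′ ; ι-inj = inj _ _ ; into = into′ ; onto = onto′ }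
    where
    open Enumeration E
    ι′ : Fin (suc N) → Fin n
    ι′ zero    = a
    ι′ (suc i) = ι i
    ≢a : ∀ i → ι i ≢ a
    ≢a i = proj₂ (∈-⁻ X a (into i))
    inj : ∀ i j → ι′ i ≡ ι′ j → i ≡ j
    inj zero    zero    _  = refl
    inj zero    (suc j) eq = contradiction (sym eq) (≢a j)
    inj (suc i) zero    eq = contradiction eq (≢a i)
    inj (suc i) (suc j) eq = cong suc (ι-inj eq)
    into′ : ∀ i → X (ι′ i) ≡ true
    into′ zero    = Xa
    into′ (suc i) = proj₁ (∈-⁻ X a (into i))
    onto′ : ∀ v → X v ≡ true → ∃[ i ] ι′ i ≡ v
    onto′ v Xv with v Fin.≟ a
    ... | yes v≡a = zero , sym v≡a
    ... | no v≢a = let i , eq = onto v (∈-⁺ X a Xv v≢a) in suc i , eq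

  enumerate : ∀ N X → # X ≡ N → Enumeration X N
  enumerate zero    X eq = enumerate-∅ (#-empty X eq)
  enumerate (suc N) X eq = let v , Xv = #-pos X (≤-trans (s≤s z≤n) (≤-reflexive (sym eq))) in
    enumerate-cons Xv (enumerate N (X - v) (suc-injective (trans (sym (#-remove X Xv)) eq)))

module Isomorphism {n : ℕ} (G : Graph n) where
  open LinearForests G public

  Copy : ∀ {N} → VSet n → Graph N → Set
  Copy {N} X M = Σ[ E ∈ Enumeration X N ] ∀ i j → adj G (Enumeration.ι E i) (Enumeration.ι E j) ≡ adj M i j

  copy-join : ∀ {X a k m} {M : Graph m} → X a ≡ true → (∀ v → (X - a) v ≡ true → Adj a v) → Copy (X - a) (K k ∨ M) → Copy X (K (suc k) ∨ M)
  copy-join {X} {a} {k} {m} {M} Xa dom (E , same) = enumerate-cons Xa E , same′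
    where
    same′ : ∀ i j → adj G (Enumeration.ι (enumerate-cons Xa E) i) (Enumeration.ι (enumerate-cons Xa E) j) ≡ adj (K (suc k) ∨ M) i j
    same′ zero    zero    = adj-irrefl G a
    same′ zero    (suc j) = trans (dom _ (Enumeration.into E j)) (sym (∨-zero-suc M j))
    same′ (suc i) zero    = trans (adj-comm (dom _ (Enumeration.into E i))) (trans (sym (∨-zero-suc M i)) (adj-sym (K (suc k) ∨ M) zero (suc i)))
    same′ (suc i) (suc j) = trans (same i j) (sym (∨-suc-suc M i j))

  copy-pair : ∀ {X x y m} {M : Graph m} → X x ≡ true → X y ≡ true → Adj x y → (∀ u → X u ≡ true → Adj x u → u ≡ y) →
    (∀ u → X u ≡ true → Adj y u → u ≡ x) → Copy (X - x - y) M → Copy X (K 2 ∪ M)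
  copy-pair {X} {x} {y} {m} {M} Xx Xy x~y hx hy (E , same) = E′ , same′
    where
    E′ = enumerate-cons Xx (enumerate-cons (∈-⁺ X x Xy (≢-sym (adj-≢ x~y))) E)
    inX : ∀ i → X (Enumeration.ι E i) ≡ true × Enumeration.ι E i ≢ x × Enumeration.ι E i ≢ y
    inX i = let h , ≢y = ∈-⁻ (X - x) y (Enumeration.into E i) ; h′ , ≢x = ∈-⁻ X x h in h′ , ≢x , ≢y
    x≁ : ∀ i → adj G x (Enumeration.ι E i) ≡ false
    x≁ i = let h , _ , ≢y = inX i in not-true⇒false (λ a → ≢y (hx _ h a))
    y≁ : ∀ i → adj G y (Enumeration.ι E i) ≡ false
    y≁ i = let h , ≢x , _ = inX i in not-true⇒false (λ a → ≢x (hy _ h a))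
    same′ : ∀ i j → adj G (Enumeration.ι E′ i) (Enumeration.ι E′ j) ≡ adj (K 2 ∪ M) i j
    same′ zero zero = adj-irrefl G x
    same′ zero (suc zero) = x~y
    same′ zero (suc (suc j)) = x≁ j
    same′ (suc zero) zero = adj-comm x~y
    same′ (suc zero) (suc zero) = adj-irrefl G y
    same′ (suc zero) (suc (suc j)) = y≁ j
    same′ (suc (suc i)) zero = trans (adj-sym G _ x) (x≁ i)
    same′ (suc (suc i)) (suc zero) = trans (adj-sym G _ y) (y≁ i)
    same′ (suc (suc i)) (suc (suc j)) = same i j

  copy-edgeless : ∀ {X m} → # X ≡ m → (∀ u v → X u ≡ true → X v ≡ true → ¬ Adj u v) → Copy X (K̄ m)
  copy-edgeless {X} {m} eq none = E , λ i j → trans (not-true⇒false (none _ _ (Enumeration.into E i) (Enumeration.into E j))) (sym (K̄-edgeless i j))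
    where E = enumerate m X eq

  copy-matched : ∀ {X} m → # X ≡ m → Matched X → Copy X (matching m)
  copy-matched zero eq M = copy-edgeless eq (λ u v Xu → true≢false Xu (#-empty _ eq u))
  copy-matched {X} (suc zero) eq M = copy-edgeless eq (λ u v Xu Xv u~v → adj-≢ u~v (all-equal u v Xu Xv))
    where
    all-equal : ∀ u v → X u ≡ true → X v ≡ true → u ≡ v
    all-equal u v Xu Xv with u Fin.≟ v
    ... | yes eq′ = eq′
    ... | no u≢v = true≢false (∈-⁺ X u Xv (≢-sym u≢v)) (#-empty (X - u) (suc-injective (trans (sym (#-remove X Xu)) eq)) v)
  copy-matched {X} (suc (suc m)) eq (nil h) = contradiction (trans (sym eq) (Σₛ-∅ X _ h)) λ ()
  copy-matched {X} (suc (suc m)) eq (one {v} Xv h) = contradiction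
    (trans (sym (suc-injective (trans (sym (#-remove X Xv)) eq))) (Σₛ-∅ (X - v) _ (λ u → not-true⇒false (λ p → let Xu , u≢v = ∈-⁻ X v p in u≢v (h u Xu))))) λ ()
  copy-matched {X} (suc (suc m)) eq (pair Xx Xy x~y hx hy M) =
    copy-pair Xx Xy x~y hx hy (copy-matched m (suc-injective (suc-injective (trans (sym (pair-# Xx Xy x~y)) eq))) M)

  copy-base : ∀ κ {X} m → # X ≡ leftover-size κ m → Base κ X → Copy X (leftover κ m)
  copy-base bare  m eq b = copy-edgeless eq b
  copy-base edge {X} m eq (x , y , Xx , Xy , x~y , only) = copy-pair Xx Xy x~y hx hy
    (copy-edgeless (suc-injective (suc-injective (trans (sym (pair-# Xx Xy x~y)) eq))) λ u v p q u~v →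
      let p′ , u≢y = ∈-⁻ (X - x) y p ; Xu , u≢x = ∈-⁻ X x p′ ; q′ , _ = ∈-⁻ (X - x) y q ; Xv , _ = ∈-⁻ X x q′
      in [ (λ (e , _) → u≢x e) , (λ (e , _) → u≢y e) ]′ (only u v Xu Xv u~v))
    where
    hx : ∀ u → X u ≡ true → Adj x u → u ≡ y
    hx u Xu a with only x u Xx Xu a
    ... | inj₁ (_ , e) = e
    ... | inj₂ (e , _) = contradiction e (adj-≢ x~y)
    hy : ∀ u → X u ≡ true → Adj y u → u ≡ x
    hy u Xu a with only y u Xy Xu a
    ... | inj₁ (e , _) = contradiction (sym e) (adj-≢ x~y)
    ... | inj₂ (_ , e) = e
  copy-base match m eq b = copy-matched m eq b

  copy-struct : ∀ {κ k X} m → # X ≡ k + leftover-size κ m → Struct κ k X → Copy X (K k ∨ leftover κ m)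
  copy-struct {κ} m eq (base b) = copy-base κ m eq b
  copy-struct {κ} m eq (join Xa dom S) = copy-join Xa dom (copy-struct m (suc-injective (trans (sym (#-remove _ Xa)) eq)) S)

  copy-≅ : ∀ {N} {M : Graph N} → Copy full M → G ≅ M
  copy-≅ {N} {M} (E , same) = mk↔ₛ′ to ι (λ i → ι-inj (back (ι i))) back ,
    λ u v → trans (cong₂ (adj G) (sym (back u)) (sym (back v))) (same (to u) (to v))
    where
    open Enumeration E
    to : Fin n → Fin N
    to v = proj₁ (onto v refl)
    back : ∀ v → ι (to v) ≡ v
    back v = proj₂ (onto v refl)

-- Degree sums and the number of edges

sum-ones : ∀ n → sum {n} (λ _ → 1) ≡ n
sum-ones zero    = refl
sum-ones (suc n) = cong suc (sum-ones n)

degree-sum : ∀ {n} → Graph n → ℕ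
degree-sum G = sum (λ v → sum (λ u → ⟦ adj G v u ⟧))

opaque
  unfolding Σₛ

  degree-sum-e2 : ∀ {n} (G : Graph n) → Counting.e2 G full ≡ degree-sum G
  degree-sum-e2 G = refl

degree-sum-join : ∀ k {m} (M : Graph m) → degree-sum (K k ∨ M) ≡ φ m k + degree-sum M
degree-sum-join zero    M = refl
degree-sum-join (suc k) {m} M = begin
  sum (λ j → ⟦ adj H zero (suc j) ⟧) + sum (λ i → ⟦ adj H (suc i) zero ⟧ + sum (λ j → ⟦ adj H (suc i) (suc j) ⟧))
    ≡⟨ cong₂ _+_ row (sum-+ (λ i → ⟦ adj H (suc i) zero ⟧) (λ i → sum (λ j → ⟦ adj H (suc i) (suc j) ⟧))) ⟩
  (k + m) + (sum (λ i → ⟦ adj H (suc i) zero ⟧) + sum (λ i → sum (λ j → ⟦ adj H (suc i) (suc j) ⟧)))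
    ≡⟨ cong₂ (λ a b → (k + m) + (a + b)) (trans (sum-cong (λ i → cong ⟦_⟧ (adj-sym H (suc i) zero))) row) (sum-cong (λ i → sum-cong (λ j → cong ⟦_⟧ (∨-suc-suc {k} M i j)))) ⟩
  (k + m) + ((k + m) + degree-sum (K k ∨ M)) ≡⟨ cong (λ d → (k + m) + ((k + m) + d)) (degree-sum-join k M) ⟩
  (k + m) + ((k + m) + (φ m k + degree-sum M)) ≡⟨ regroup (k + m) (φ m k) (degree-sum M) ⟩
  φ m k + 2 * (k + m) + degree-sum M ∎
  where
  open ≡-Reasoning
  H = K (suc k) ∨ M
  row : sum (λ j → ⟦ adj H zero (suc j) ⟧) ≡ k + m
  row = trans (sum-cong (λ j → cong ⟦_⟧ (∨-zero-suc {k} M j))) (sum-ones (k + m))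
  regroup : ∀ x f d → x + (x + (f + d)) ≡ f + 2 * x + d
  regroup = solve-∀

degree-sum-pair : ∀ {m} (M : Graph m) → 2 + degree-sum M ≤ degree-sum (K 2 ∪ M)
degree-sum-pair {m} M = s≤s (≤-trans (s≤s (m≤n+m (degree-sum M) (sum {m} (λ j → 0)))) (m≤n+m _ (sum {m} (λ j → 0))))

leftover-rich : ∀ κ m → gap κ (leftover-size κ m) ≤ degree-sum (leftover κ m) + slack κ
leftover-rich bare  m = z≤n
leftover-rich edge  m = ≤-trans (≤-trans (m≤m+n 2 (degree-sum (K̄ m))) (degree-sum-pair (K̄ m))) (m≤m+n _ 0)
leftover-rich match m = matching-rich m
  where
  matching-rich : ∀ m → m ≤ degree-sum (matching m) + 1
  matching-rich zero          = z≤n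
  matching-rich (suc zero)    = s≤s z≤n
  matching-rich (suc (suc m)) = ≤-trans (s≤s (s≤s (matching-rich m))) (+-monoˡ-≤ 1 (degree-sum-pair (matching m)))

module _ {n : ℕ} (G : Graph n) where

  private
    edge? : (p : Fin n × Fin n) → Dec (proj₁ p Fin.< proj₂ p × T (adj G (proj₁ p) (proj₂ p)))
    edge? (u , v) = (u Fin.<? v) ×-dec T? (adj G u v)

    forward : Fin n → Fin n → ℕ
    forward u v = ⟦ does (edge? (u , v)) ⟧

    length-filter-tabulate : ∀ {A : Set} {P : A → Set} (P? : ∀ x → Dec (P x)) {N} (f : Fin N → A) →
      length (filter P? (tabulate f)) ≡ sum (λ i → ⟦ does (P? (f i)) ⟧)
    length-filter-tabulate P? {zero}  f = refl
    length-filter-tabulate P? {suc N} f with does (P? (f zero))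
    ... | true  = cong suc (length-filter-tabulate P? (f ∘ suc))
    ... | false = length-filter-tabulate P? (f ∘ suc)

    product-rows : ∀ {N} (f : Fin N → Fin n) → length (filter edge? (cartesianProduct (tabulate f) (allFin n))) ≡ sum (λ i → sum (forward (f i)))
    product-rows {zero}  f = refl
    product-rows {suc N} f = begin
      length (filter edge? (map (f zero ,_) (allFin n) ++ cartesianProduct (tabulate (f ∘ suc)) (allFin n)))
        ≡⟨ cong length (List.filter-++ edge? (map (f zero ,_) (allFin n)) _) ⟩
      length (filter edge? (map (f zero ,_) (allFin n)) ++ filter edge? (cartesianProduct (tabulate (f ∘ suc)) (allFin n)))
        ≡⟨ List.length-++ (filter edge? (map (f zero ,_) (allFin n))) ⟩
      length (filter edge? (map (f zero ,_) (allFin n))) + length (filter edge? (cartesianProduct (tabulate (f ∘ suc)) (allFin n)))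
        ≡⟨ cong₂ _+_ (trans (cong (length ∘ filter edge?) (List.map-tabulate id (f zero ,_))) (length-filter-tabulate edge? (f zero ,_))) (product-rows (f ∘ suc)) ⟩
      sum (forward (f zero)) + sum (λ i → sum (forward (f (suc i)))) ∎
      where open ≡-Reasoning

    -- `edges` lists an adjacency in one of its two orientations only. Exchanging the order of
    -- summation then gives the handshake lemma.
    orient : ∀ u v → ⟦ adj G u v ⟧ ≡ forward u v + forward v u
    orient u v with Fin.<-cmp u v
    ... | tri< u<v _ v≮u rewrite dec-true (u Fin.<? v) u<v | dec-false (v Fin.<? u) v≮u = sym (+-identityʳ _)
    ... | tri≈ u≮u refl _ rewrite dec-false (u Fin.<? u) u≮u = cong ⟦_⟧ (adj-irrefl G u)
    ... | tri> u≮v _ v<u rewrite dec-true (v Fin.<? u) v<u | dec-false (u Fin.<? v) u≮v = cong ⟦_⟧ (adj-sym G u v)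

  degree-sum-edges : degree-sum G ≡ 2 * e G
  degree-sum-edges = begin
    sum (λ u → sum (λ v → ⟦ adj G u v ⟧))                        ≡⟨ sum-cong (λ u → trans (sum-cong (orient u)) (sum-+ (forward u) (λ v → forward v u))) ⟩
    sum (λ u → sum (forward u) + sum (λ v → forward v u))        ≡⟨ sum-+ (λ u → sum (forward u)) (λ u → sum (λ v → forward v u)) ⟩
    sum (λ u → sum (forward u)) + sum (λ u → sum (λ v → forward v u)) ≡⟨ cong (sum (λ u → sum (forward u)) +_) (sum-swap (λ u v → forward v u)) ⟩
    sum (λ u → sum (forward u)) + sum (λ u → sum (forward u))    ≡⟨ cong₂ _+_ (sym (product-rows id)) (trans (sym (product-rows id)) (sym (+-identityʳ (e G)))) ⟩
    e G + (e G + 0)                                              ∎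
    where open ≡-Reasoning

-- Embeddings and F-freeness of the extremal graphs

IsEmbedding : ∀ {m n} → Graph m → Graph n → (Fin m → Fin n) → Set
IsEmbedding F G f = Injective _≡_ _≡_ f × (∀ u v → Adjacent F u v → Adjacent G (f u) (f v))

T⁺ : ∀ {b} → b ≡ true → T b
T⁺ refl = _

T⁻ : ∀ {b} → T b → b ≡ true
T⁻ {true} _ = refl

module _ {m₁ m₂ n : ℕ} {F₁ : Graph m₁} {F₂ : Graph m₂} {G : Graph n} where

  embed-∪ : ∀ {f g} → IsEmbedding F₁ G f → IsEmbedding F₂ G g → (∀ u v → f u ≢ g v) →
            IsEmbedding (F₁ ∪ F₂) G ([ f , g ]′ ∘ Fin.splitAt m₁)
  embed-∪ {f} {g} (f-inj , f-adj) (g-inj , g-adj) apart = inj , adjacent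
    where
    same-side : ∀ x y → [ f , g ]′ x ≡ [ f , g ]′ y → x ≡ y
    same-side (inj₁ x) (inj₁ y) eq = cong inj₁ (f-inj eq)
    same-side (inj₁ x) (inj₂ y) eq = contradiction eq (apart x y)
    same-side (inj₂ x) (inj₁ y) eq = contradiction (sym eq) (apart y x)
    same-side (inj₂ x) (inj₂ y) eq = cong inj₂ (g-inj eq)
    inj : Injective _≡_ _≡_ ([ f , g ]′ ∘ Fin.splitAt m₁)
    inj {u} {v} eq = trans (sym (Fin.join-splitAt m₁ m₂ u))
      (trans (cong (Fin.join m₁ m₂) (same-side (Fin.splitAt m₁ u) (Fin.splitAt m₁ v) eq)) (Fin.join-splitAt m₁ m₂ v))
    adjacent : ∀ u v → Adjacent (F₁ ∪ F₂) u v → Adjacent G ([ f , g ]′ (Fin.splitAt m₁ u)) ([ f , g ]′ (Fin.splitAt m₁ v))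
    adjacent u v h with Fin.splitAt m₁ u | Fin.splitAt m₁ v
    ... | inj₁ x | inj₁ y = f-adj x y h
    ... | inj₂ x | inj₂ y = g-adj x y h

  embed-left : ∀ {f} → IsEmbedding (F₁ ∪ F₂) G f → IsEmbedding F₁ G (f ∘ (Fin._↑ˡ m₂))
  embed-left {f} (inj , h) = Fin.↑ˡ-injective m₂ _ _ ∘ inj , λ u v a → h (u Fin.↑ˡ m₂) (v Fin.↑ˡ m₂) (lift u v a)
    where
    lift : ∀ u v → Adjacent F₁ u v → Adjacent (F₁ ∪ F₂) (u Fin.↑ˡ m₂) (v Fin.↑ˡ m₂)
    lift u v a rewrite Fin.splitAt-↑ˡ m₁ u m₂ | Fin.splitAt-↑ˡ m₁ v m₂ = a

  embed-right : ∀ {f} → IsEmbedding (F₁ ∪ F₂) G f → IsEmbedding F₂ G (f ∘ (m₁ Fin.↑ʳ_))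
  embed-right {f} (inj , h) = Fin.↑ʳ-injective m₁ _ _ ∘ inj , λ u v a → h (m₁ Fin.↑ʳ u) (m₁ Fin.↑ʳ v) (lift u v a)
    where
    lift : ∀ u v → Adjacent F₂ u v → Adjacent (F₁ ∪ F₂) (m₁ Fin.↑ʳ u) (m₁ Fin.↑ʳ v)
    lift u v a rewrite Fin.splitAt-↑ʳ m₁ m₂ u | Fin.splitAt-↑ʳ m₁ m₂ v = a

lookup-injective : ∀ {A : Set} {xs : List A} → Unique xs → ∀ i j → List.lookup xs i ≡ List.lookup xs j → i ≡ j
lookup-injective (_ ∷ _)  zero    zero    _  = refl
lookup-injective (p ∷ _)  zero    (suc j) eq = contradiction eq (All.lookup p (∈-lookup j))
lookup-injective (p ∷ _)  (suc i) zero    eq = contradiction (sym eq) (All.lookup p (∈-lookup i))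
lookup-injective (_ ∷ ps) (suc i) (suc j) eq = cong suc (lookup-injective ps i j eq)

module Embeddings {n : ℕ} (G : Graph n) where
  open Isomorphism G public

  walk-step : ∀ {u v xs} → Walk u v xs → ∀ i j → toℕ j ≡ suc (toℕ i) → Adj (List.lookup xs i) (List.lookup xs j)
  walk-step [ _ ] zero zero ()
  walk-step (a ∷ [ _ ])   zero    (suc zero) _ = a
  walk-step (a ∷ (_ ∷ _)) zero    (suc zero) _ = a
  walk-step (a ∷ p) (suc i) (suc j) eq = walk-step p i j (suc-injective eq)

  distance-one : ∀ a b → ℕ.∣ a - b ∣ ≡ 1 → b ≡ suc a ⊎ a ≡ suc b
  distance-one zero    b       eq = inj₁ eq
  distance-one (suc a) zero    eq = inj₂ eq
  distance-one (suc a) (suc b) eq = [ inj₁ ∘ cong suc , inj₂ ∘ cong suc ]′ (distance-one a b eq)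

  path-embedding : ∀ {X xs} → IsPath X xs → IsEmbedding (P (length xs)) G (List.lookup xs)
  path-embedding {xs = xs} ((_ , _ , w) , u , _) = lookup-injective u _ _ , λ i j h →
    T⁺ ([ walk-step w i j , adj-comm ∘ walk-step w j i ]′ (distance-one (toℕ i) (toℕ j) (≡ᵇ⇒≡ _ 1 h)))

  Embeds : ∀ {m} → Graph m → (V → Set) → Set
  Embeds {m} F Q = Σ[ f ∈ (Fin m → V) ] IsEmbedding F G f × (∀ u → Q (f u))

  embeds-∪ : ∀ {m₁ m₂} {F₁ : Graph m₁} {F₂ : Graph m₂} {Q₁ Q₂ : V → Set} → Embeds F₁ Q₁ → Embeds F₂ Q₂ →
    (∀ {u} → Q₁ u → Q₂ u → ⊥) → Embeds (F₁ ∪ F₂) (λ v → Q₁ v ⊎ Q₂ v)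
  embeds-∪ {m₁} {F₁ = F₁} {F₂} {Q₁} {Q₂} (f , f-emb , fQ) (g , g-emb , gQ) apart =
    [ f , g ]′ ∘ Fin.splitAt m₁ , embed-∪ {F₁ = F₁} {F₂} {G} f-emb g-emb (λ u v eq → apart (fQ u) (subst Q₂ (sym eq) (gQ v))) ,
    λ u → side (Fin.splitAt m₁ u)
    where
    side : ∀ x → Q₁ ([ f , g ]′ x) ⊎ Q₂ ([ f , g ]′ x)
    side (inj₁ x) = inj₁ (fQ x)
    side (inj₂ x) = inj₂ (gQ x)

  embeds-map : ∀ {m} {F : Graph m} {Q Q′ : V → Set} → (∀ {v} → Q v → Q′ v) → Embeds F Q → Embeds F Q′
  embeds-map h (f , emb , q) = f , emb , h ∘ q

  embeds-K0 : ∀ {Q} → Embeds (K 0) Q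
  embeds-K0 = (λ ()) , ((λ { {()} }) , λ ()) , λ ()

  forest-embeds : ∀ {r} (ℓ : Vector ℕ r) {X U} → Forest X (tabulate ℓ) U → Embeds (⋃ (λ j → P (ℓ j))) (_∈ U)
  forest-embeds {zero}  ℓ {U = U} f = embeds-K0 {_∈ U}
  forest-embeds {suc r} ℓ (cons {xs} {U} path len f d) =
    embeds-map {F = P (ℓ zero) ∪ ⋃ (λ j → P (ℓ (suc j)))} {λ v → v ∈ xs ⊎ v ∈ U} [ ∈-++⁺ˡ , ∈-++⁺ʳ xs ]′ (embeds-∪ {Q₁ = _∈ xs} {_∈ U} (first len) (forest-embeds (ℓ ∘ suc) f) (λ p q → d (p , q)))
    where
    first : ∀ {m} → length xs ≡ m → Embeds (P m) (_∈ xs)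
    first refl = List.lookup xs , path-embedding path , λ i → ∈-lookup i

  star-embeds : ∀ {c ls} → Unique ls → All (Adj c) ls → Embeds (star (length ls)) (_∈ c ∷ ls)
  star-embeds {c} {ls} u adjs = f , ((λ {i} {j} → inj i j) , adjacent) , λ { zero → here refl ; (suc i) → there (∈-lookup i) }
    where
    f : Fin (suc (length ls)) → V
    f zero    = c
    f (suc i) = List.lookup ls i
    leaf : ∀ i → Adj c (List.lookup ls i)
    leaf i = All.lookup adjs (∈-lookup i)
    inj : ∀ i j → f i ≡ f j → i ≡ j
    inj zero    zero    _  = refl
    inj zero    (suc j) eq = contradiction eq (adj-≢ (leaf j))
    inj (suc i) zero    eq = contradiction (sym eq) (adj-≢ (leaf i))
    inj (suc i) (suc j) eq = cong suc (lookup-injective u i j eq)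
    adjacent : ∀ i j → Adjacent (star (length ls)) i j → Adjacent G (f i) (f j)
    adjacent zero    zero    ()
    adjacent zero    (suc j) _ = T⁺ (leaf j)
    adjacent (suc i) zero    _ = T⁺ (adj-comm (leaf i))
    adjacent (suc i) (suc j) h = true≢false (T⁻ h) (K̄-edgeless i j)

  -- Greedy choice. The leaves of `c` are taken off the other centres and off `U`, and then the
  -- whole star joins `U`. What `U` gains, the sizes of the remaining stars lose, so the degree
  -- condition persists.
  stars-embed : ∀ {t} (a : Vector ℕ t) T U → length T ≡ t → Unique T → Disjoint T U →
    (∀ {c} → c ∈ T → length T + length U + sum (λ i → suc (a i)) ≤ deg full c) → Embeds (⋃ (λ i → star (a i))) (_∉ U)
  stars-embed {zero}  a T       U eq u d big = embeds-K0 {_∉ U}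
  stars-embed {suc t} a (c ∷ T) U eq (c∉ ∷ u) d big =
    embeds-map {F = star (a zero) ∪ ⋃ (λ i → star (a (suc i)))} {λ v → v ∈ c ∷ leaves ⊎ v ∉ leaves ++ c ∷ U}
      [ avoid , (λ v∉ v∈U → v∉ (∈-++⁺ʳ leaves (there v∈U))) ]′
      (embeds-∪ {Q₁ = _∈ c ∷ leaves} {_∉ leaves ++ c ∷ U} first (stars-embed (a ∘ suc) T (leaves ++ c ∷ U) (suc-injective eq) u d′ big′)
        (λ { (here refl) v∉ → v∉ (∈-++⁺ʳ leaves (here refl)) ; (there v∈) v∉ → v∉ (∈-++⁺ˡ v∈) }))
    where
    nbrs : VSet n
    nbrs v = adj G c v
    free = elems nbrs ∖∖ (T ++ U)
    leaves = take (a zero) free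
    deg≤ : deg full c ≤ length (elems nbrs)
    deg≤ = ≤-trans (Σₛ-≤lsum full (elems nbrs) (a? c) (λ v _ pos → ∈-elems⁺ nbrs (⟦⟧>0 _ pos))) (ladj≤length c (elems nbrs))
    rest = sum (λ i → suc (a (suc i)))
    enough : a zero ≤ length free
    enough = lin (suc (suc rest)) (big (here refl) ⊕ deg≤ ⊕ ∖∖-length {ws = elems nbrs} {T ++ U} (elems-unique nbrs) ⊕ ≤-reflexive (List.length-++ T))
      (regroup (length T) (length U) (a zero) rest (deg full c) (length (elems nbrs)) (length free) (length (T ++ U)))
      where
      regroup : ∀ t u a s d l f tu → f + (suc t + u + (suc a + s) + d + l + tu) ≡ a + (d + l + (f + tu) + (t + u)) + suc (suc s)
      regroup = solve-∀
    len-leaves : length leaves ≡ a zero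
    len-leaves = trans (List.length-take (a zero) free) (m≤n⇒m⊓n≡m enough)
    leaf-in : ∀ {v} → v ∈ leaves → v ∈ free
    leaf-in v∈ = subst (_ ∈_) (List.take++drop≡id (a zero) free) (∈-++⁺ˡ v∈)
    first : Embeds (star (a zero)) (_∈ c ∷ leaves)
    first = subst (λ m → Embeds (star m) (_∈ c ∷ leaves)) len-leaves
      (star-embeds (Unique.take⁺ (a zero) (Unique.filter⁺ _ (elems-unique nbrs)))
        (All.tabulate (λ v∈ → ∈-elems⁻ nbrs (∖∖-⊆ {ws = elems nbrs} {T ++ U} (leaf-in v∈)))))
    avoid : ∀ {v} → v ∈ c ∷ leaves → v ∉ U
    avoid (here refl) v∈U = d (here refl , v∈U)
    avoid (there v∈)  v∈U = ∖∖-disjoint {ws = elems nbrs} (T ++ U) (leaf-in v∈ , ∈-++⁺ʳ T v∈U)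
    d′ : Disjoint T (leaves ++ c ∷ U)
    d′ (v∈T , v∈) with ∈-++⁻ leaves v∈
    ... | inj₁ h = ∖∖-disjoint {ws = elems nbrs} (T ++ U) (leaf-in h , ∈-++⁺ˡ v∈T)
    ... | inj₂ (here refl) = All.lookup c∉ v∈T refl
    ... | inj₂ (there h) = d (there v∈T , h)
    big′ : ∀ {x} → x ∈ T → length T + length (leaves ++ c ∷ U) + rest ≤ deg full x
    big′ {x} x∈ = ≤-trans (lin 1 (≤-reflexive (List.length-++ leaves {c ∷ U}) ⊕ ≤-reflexive len-leaves)
        (regroup (length T) (length U) (a zero) rest (length leaves) (length (leaves ++ c ∷ U)))) (big (there x∈))
      where
      regroup : ∀ t u a s l lu → suc t + u + (suc a + s) + (lu + l) ≡ t + lu + s + (l + suc u + a) + 1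
      regroup = solve-∀

-- α will be the indicator of the dominating vertices.
module Cover {N : ℕ} (H : Graph N) (α : Fin N → ℕ) where
  open Counting H

  -- With the indicator for α: every copy of `F` uses at least `c` dominating vertices. Such bounds
  -- add up over disjoint unions.
  Covers : ∀ {m} → ℕ → Graph m → Set
  Covers c F = ∀ f → IsEmbedding F H f → c ≤ sum (λ u → α (f u))

  sum-++ : ∀ m {n} (g : Fin (m + n) → ℕ) → sum g ≡ sum (λ i → g (i Fin.↑ˡ n)) + sum (λ j → g (m Fin.↑ʳ j))
  sum-++ zero    g = refl
  sum-++ (suc m) g = trans (cong (g zero +_) (sum-++ m (g ∘ suc))) (sym (+-assoc (g zero) _ _))

  covers-∪ : ∀ {m₁ m₂ c₁ c₂} {F₁ : Graph m₁} {F₂ : Graph m₂} → Covers c₁ F₁ → Covers c₂ F₂ → Covers (c₁ + c₂) (F₁ ∪ F₂)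
  covers-∪ {m₁} {F₁ = F₁} {F₂} h₁ h₂ f emb = ≤-trans
    (+-mono-≤ (h₁ _ (embed-left {F₁ = F₁} {F₂} {H} emb)) (h₂ _ (embed-right {F₁ = F₁} {F₂} {H} emb)))
    (≤-reflexive (sym (sum-++ m₁ (α ∘ f))))

  covers-⋃ : ∀ {k} {m : Vector ℕ k} {F : ∀ i → Graph (m i)} {c : Vector ℕ k} → (∀ i → Covers (c i) (F i)) → Covers (sum c) (⋃ F)
  covers-⋃ {zero}  h f emb = z≤n
  covers-⋃ {suc k} {F = F} h = covers-∪ {F₁ = F zero} (h zero) (covers-⋃ (h ∘ suc))

  sum-lsum : ∀ {k} (f : Fin k → Fin N) → sum (λ u → α (f u)) ≡ lsum α (tabulate f)
  sum-lsum {zero}  f = refl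
  sum-lsum {suc k} f = cong (α (f zero) +_) (sum-lsum (f ∘ suc))

  sum-injective : ∀ {k} (f : Fin k → Fin N) → Injective _≡_ _≡_ f → sum (λ u → α (f u)) ≤ Σₛ full α
  sum-injective f inj = ≤-trans (≤-reflexive (sum-lsum f)) (≤-trans (m≤m+n _ _)
    (≤-reflexive (sym (Σₛ-removeL full (tabulate f) α (Unique.tabulate⁺ inj) (All.tabulate (λ _ → refl))))))

  path-walk : ∀ {k} (f : Fin (suc k) → Fin N) → (∀ u v → Adjacent (P (suc k)) u v → Adjacent H (f u) (f v)) →
              ∃[ v ] Walk (f zero) v (tabulate f)
  path-walk {zero}  f h = f zero , [ f zero ]
  path-walk {suc k} f h = let v , w = path-walk (f ∘ suc) (λ u v → h (suc u) (suc v)) in v , T⁻ (h zero (suc zero) _) ∷ w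

  Outside : Fin N → Fin N → Set
  Outside x y = α x ≡ 0 × α y ≡ 0

  -- Every other link of the walk is used: these links are disjoint, and each has weight at least
  -- one.
  cover-steps : ∀ {u v xs} → Walk u v xs → (∀ {x y} → x ∈ xs → y ∈ xs → Adj x y → 1 ≤ α x + α y) → ⌊ length xs /2⌋ ≤ lsum α xs
  cover-steps [ v ] h = z≤n
  cover-steps (_∷_ {u} a [ v ]) h = ≤-trans (h (here refl) (there (here refl)) a) (≤-reflexive (cong (α u +_) (sym (+-identityʳ (α v)))))
  cover-steps (_∷_ {u} a (_∷_ {v} b w)) h = ≤-trans
    (+-mono-≤ (h (here refl) (there (here refl)) a) (cover-steps w (λ p q → h (there (there p)) (there (there q)))))
    (≤-reflexive (+-assoc (α u) (α v) _))

  one-or-outside : ∀ x y → 1 ≤ α x + α y ⊎ Outside x y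
  one-or-outside x y with α x | α y
  ... | suc _ | _     = inj₁ (s≤s z≤n)
  ... | zero  | suc _ = inj₁ (s≤s z≤n)
  ... | zero  | zero  = inj₂ (refl , refl)

  -- Splitting an odd path at the only edge outside the dominating part leaves
  -- two pieces whose edges can be paired off.
  cover-odd : ∀ p q → (∀ {x y} → Outside x y → Adj x y → x ≡ p × y ≡ q ⊎ x ≡ q × y ≡ p) →
    ∀ h {u v xs} → Walk u v xs → Unique xs → length xs ≡ odd h → h ≤ lsum α xs
  cover-odd p q only zero w u len = z≤n
  cover-odd p q only (suc h) [ v ] u ()
  cover-odd p q only (suc h) (a ∷ [ v ]) u len = contradiction (trans len (cong (λ m → suc (suc m)) (+-suc h (h + 0)))) λ ()
  cover-odd p q only (suc h) (_∷_ {x} {y} a (_∷_ {v = z} {xs = xs} b w)) (x∉ ∷ y∉ ∷ u) len with one-or-outside x y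
  ... | inj₁ pos = ≤-trans (+-mono-≤ pos (cover-odd p q only h w u (suc-injective (suc-injective (trans len (cong (λ m → suc (suc m)) (+-suc h (h + 0))))))))
                     (≤-reflexive (+-assoc (α x) (α y) _))
  ... | inj₂ out = ≤-trans (≤-trans (≤-reflexive half) (cover-steps (b ∷ w) inner)) (m≤n+m _ (α x))
    where
    half : suc h ≡ ⌊ length (y ∷ xs) /2⌋
    half = trans (sym (half-double (suc h))) (cong ⌊_/2⌋ (sym (suc-injective len)))
    inner : ∀ {s t} → s ∈ y ∷ xs → t ∈ y ∷ xs → Adj s t → 1 ≤ α s + α t
    inner {s} {t} s∈ t∈ c with one-or-outside s t
    ... | inj₁ pos = pos
    ... | inj₂ out′ with only out a | only out′ c
    ...   | inj₁ (refl , refl) | inj₁ (refl , _) = contradiction refl (All.lookup x∉ s∈)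
    ...   | inj₁ (refl , refl) | inj₂ (_ , refl) = contradiction refl (All.lookup x∉ t∈)
    ...   | inj₂ (refl , refl) | inj₁ (_ , refl) = contradiction refl (All.lookup x∉ t∈)
    ...   | inj₂ (refl , refl) | inj₂ (refl , _) = contradiction refl (All.lookup x∉ s∈)

  module _ (no-cherry : ∀ {x y z} → α x ≡ 0 → α y ≡ 0 → α z ≡ 0 → Adj x y → Adj y z → x ≡ z) where

    -- At weight zero the centre and two leaves would be a path on three vertices in the part
    -- outside the dominating vertices.
    covers-star : ∀ d → Covers 1 (star (2 + d))
    covers-star d f (inj , h) with sum (λ u → α (f u)) in eq
    ... | suc _ = s≤s z≤n
    ... | zero = contradiction (inj (no-cherry (zeros (suc zero)) (zeros zero) (zeros (suc (suc zero))) (adj-comm (T⁻ (h zero (suc zero) _))) (T⁻ (h zero (suc (suc zero)) _)))) λ ()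
      where
      zeros : ∀ i → α (f i) ≡ 0
      zeros i = n≤0⇒n≡0 (≤-trans (term i (α ∘ f)) (≤-reflexive eq))
        where
        term : ∀ {k} (i : Fin k) (g : Fin k → ℕ) → g i ≤ sum g
        term zero    g = m≤m+n _ _
        term (suc i) g = ≤-trans (term i (g ∘ suc)) (m≤n+m _ (g zero))

    covers-P3 : Covers 1 (P 3)
    covers-P3 f (inj , h) with one-or-outside (f zero) (f (suc zero)) | one-or-outside (f (suc zero)) (f (suc (suc zero)))
    ... | inj₁ pos | _ = ≤-trans pos (+-monoʳ-≤ (α (f zero)) (m≤m+n _ _))
    ... | inj₂ _ | inj₁ pos = ≤-trans (≤-trans pos (+-monoʳ-≤ (α (f (suc zero))) (m≤m+n _ 0))) (m≤n+m _ (α (f zero)))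
    ... | inj₂ (o₁ , o₂) | inj₂ (_ , o₃) = contradiction (inj (no-cherry o₁ o₂ o₃ (T⁻ (h zero (suc zero) _)) (T⁻ (h (suc zero) (suc (suc zero)) _)))) λ ()

module _ {m : ℕ} (M : Graph m) where

  CherryFree : Set
  CherryFree = ∀ x y z → adj M x y ≡ true → adj M y z ≡ true → x ≡ z

pair-cherry-free : ∀ {m} (M : Graph m) → CherryFree M → CherryFree (K 2 ∪ M)
pair-cherry-free M h zero (suc zero) zero _ _ = refl
pair-cherry-free M h (suc zero) zero (suc zero) _ _ = refl
pair-cherry-free M h zero (suc zero) (suc zero) _ ()
pair-cherry-free M h zero (suc zero) (suc (suc z)) _ ()
pair-cherry-free M h (suc zero) zero zero _ ()
pair-cherry-free M h (suc zero) zero (suc (suc z)) _ ()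
pair-cherry-free M h (suc zero) (suc zero) z () _
pair-cherry-free M h (suc zero) (suc (suc y)) z () _
pair-cherry-free M h (suc (suc x)) (suc (suc y)) (suc (suc z)) p q = cong (λ i → suc (suc i)) (h x y z p q)

K̄-cherry-free : ∀ m → CherryFree (K̄ m)
K̄-cherry-free m x y z p _ = true≢false p (K̄-edgeless x y)

leftover-cherry-free : ∀ κ m → CherryFree (leftover κ m)
leftover-cherry-free bare  m = K̄-cherry-free m
leftover-cherry-free edge  m = pair-cherry-free (K̄ m) (K̄-cherry-free m)
leftover-cherry-free match m = go m
  where
  go : ∀ m → CherryFree (matching m)
  go zero          = K̄-cherry-free 0
  go (suc zero)    = K̄-cherry-free 1
  go (suc (suc m)) = pair-cherry-free (matching m) (go m)

PathFor : Kind → ℕ → Set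
PathFor bare  ℓ = 1 ≤ ℓ
PathFor edge  ℓ = ∃[ h ] ℓ ≡ odd h
PathFor match ℓ = ℓ ≡ 3

module ExtremalGraph (s : ℕ) (κ : Kind) (m : ℕ) where

  M = leftover κ m
  H = K s ∨ M

  private
    weight : Fin s ⊎ Fin (leftover-size κ m) → ℕ
    weight = [ (λ _ → 1) , (λ _ → 0) ]′

  α : Fin (s + leftover-size κ m) → ℕ
  α v = weight (Fin.splitAt s v)

  open Counting H using (Adj; Walk)
  open Cover H α

  right : ∀ x → α x ≡ 0 → ∃[ x′ ] s Fin.↑ʳ x′ ≡ x
  right x eq with Fin.splitAt s x in split
  ... | inj₂ x′ = x′ , trans (cong (Fin.join s _) (sym split)) (Fin.join-splitAt s _ x)

  adj-right : ∀ x y → adj H (s Fin.↑ʳ x) (s Fin.↑ʳ y) ≡ adj M x y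
  adj-right x y rewrite Fin.splitAt-↑ʳ s (leftover-size κ m) x | Fin.splitAt-↑ʳ s (leftover-size κ m) y = refl

  no-cherry : ∀ {x y z} → α x ≡ 0 → α y ≡ 0 → α z ≡ 0 → Adj x y → Adj y z → x ≡ z
  no-cherry {x} {y} {z} ox oy oz p q with right x ox | right y oy | right z oz
  ... | x′ , refl | y′ , refl | z′ , refl = cong (s Fin.↑ʳ_)
    (leftover-cherry-free κ m x′ y′ z′ (trans (sym (adj-right x′ y′)) p) (trans (sym (adj-right y′ z′)) q))

  total-weight : Σₛ full α ≡ s
  total-weight = trans (full-sum α) (trans (sum-++ s α)
    (trans (cong₂ _+_ (trans (sum-cong (λ i → cong weight (Fin.splitAt-↑ˡ s i _))) (sum-ones s))
                      (trans (sum-cong (λ j → cong weight (Fin.splitAt-↑ʳ s _ j))) (sum-0 (leftover-size κ m)))) (+-identityʳ s)))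
    where
    opaque
      unfolding Σₛ
      full-sum : ∀ {n} (f : Fin n → ℕ) → Σₛ full f ≡ sum f
      full-sum f = refl

covers-path : ∀ s κ m ℓ → PathFor κ ℓ → Cover.Covers (K s ∨ leftover κ m) (ExtremalGraph.α s κ m) ⌊ ℓ /2⌋ (P ℓ)
covers-path s bare m (suc ℓ) _ f (inj , h) =
  let v , w = path-walk f h in
  ≤-trans (≤-reflexive (cong ⌊_/2⌋ (sym (List.length-tabulate f)))) (≤-trans (cover-steps w inside) (≤-reflexive (sym (sum-lsum f))))
  where
  open ExtremalGraph s bare m
  open Cover H α
  inside : ∀ {x y} → x ∈ tabulate f → y ∈ tabulate f → adj H x y ≡ true → 1 ≤ α x + α y
  inside {x} {y} _ _ p with one-or-outside x y
  ... | inj₁ pos = pos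
  ... | inj₂ (ox , oy) with right x ox | right y oy
  ...   | x′ , refl | y′ , refl = true≢false p (trans (adj-right x′ y′) (K̄-edgeless x′ y′))
covers-path s edge m _ (d , refl) f (inj , h) =
  let v , w = path-walk f h in
  ≤-trans (≤-reflexive (half-odd d)) (≤-trans (cover-odd _ _ only d w (Unique.tabulate⁺ inj) (List.length-tabulate f)) (≤-reflexive (sym (sum-lsum f))))
  where
  open ExtremalGraph s edge m
  open Cover H α
  only : ∀ {x y} → Outside x y → adj H x y ≡ true → x ≡ s Fin.↑ʳ zero × y ≡ s Fin.↑ʳ suc zero ⊎ x ≡ s Fin.↑ʳ suc zero × y ≡ s Fin.↑ʳ zero
  only {x} {y} (ox , oy) p with right x ox | right y oy
  ... | x′ , refl | y′ , refl = split x′ y′ (trans (sym (adj-right x′ y′)) p)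
    where
    split : ∀ x y → adj M x y ≡ true → s Fin.↑ʳ x ≡ s Fin.↑ʳ zero × s Fin.↑ʳ y ≡ s Fin.↑ʳ suc zero ⊎ s Fin.↑ʳ x ≡ s Fin.↑ʳ suc zero × s Fin.↑ʳ y ≡ s Fin.↑ʳ zero
    split zero (suc zero) _ = inj₁ (refl , refl)
    split (suc zero) zero _ = inj₂ (refl , refl)
    split (suc zero) (suc zero) ()
    split (suc zero) (suc (suc y)) ()
    split (suc (suc x)) (suc (suc y)) a = true≢false a (K̄-edgeless x y)
covers-path s match m _ refl = covers-P3 no-cherry
  where
  open ExtremalGraph s match m
  open Cover H α

-- Each star of a copy uses a dominating vertex and each path at least half its order, rounded down.
-- By injectivity this requires `t + b` distinct dominating vertices, but only `s` exist.
extremal-free : ∀ {t r} (a : Vector ℕ t) (ℓ : Vector ℕ r) s κ m → (∀ i → 3 ≤ a i) → (∀ j → PathFor κ (ℓ j)) →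
  s < t + sum (λ j → ⌊ ℓ j /2⌋) → Free (⋃ (λ i → star (a i)) ∪ ⋃ (λ j → P (ℓ j))) (K s ∨ leftover κ m)
extremal-free {t} a ℓ s κ m 3≤a ok s< (f , inj , h) = contradiction s< (≤⇒≯ (begin
  t + sum (λ j → ⌊ ℓ j /2⌋)              ≡⟨ cong (_+ _) (sym (sum-ones t)) ⟩
  sum {t} (λ _ → 1) + sum (λ j → ⌊ ℓ j /2⌋) ≤⟨ covers-∪ {F₁ = ⋃ (λ i → star (a i))} {F₂ = ⋃ (λ j → P (ℓ j))} (covers-⋃ stars) (covers-⋃ (λ j → covers-path s κ m (ℓ j) (ok j))) f (inj , h) ⟩
  sum (λ u → α (f u))                    ≤⟨ sum-injective f inj ⟩
  Σₛ full α                              ≡⟨ total-weight ⟩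
  s                                      ∎))
  where
  open ExtremalGraph s κ m
  open Cover H α
  open ≤-Reasoning
  large-star : ∀ d → 3 ≤ d → Covers 1 (star d)
  large-star (suc zero)    (s≤s ())
  large-star (suc (suc d)) _ = covers-star no-cherry d
  stars : ∀ i → Covers 1 (star (a i))
  stars i = large-star (a i) (3≤a i)

-- Stars and paths

-- The search runs through the values one by one and meets a given function only up to pointwise
-- equality, hence the condition that `Q` respects it.
functionSearch : ∀ {m n} {Q : (Fin m → Fin n) → Set} → (∀ f → Dec (Q f)) → (∀ {f g} → f ≗ g → Q f → Q g) → Dec (∃ Q)
functionSearch {zero} {n} Q? resp = map′ (empty ,_) (λ (f , q) → resp (λ ()) q) (Q? empty)
  where
  empty : Fin 0 → Fin n
  empty ()
functionSearch {suc m} {n} {Q} Q? resp =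
  map′ (λ (x , f , q) → cons x f , q)
       (λ (f , q) → f zero , f ∘ suc , resp (λ { zero → refl ; (suc i) → refl }) q)
       (Fin.any? (λ x → functionSearch (λ f → Q? (cons x f)) (λ eq → resp (λ { zero → refl ; (suc i) → eq i }))))
  where
  cons : Fin n → (Fin m → Fin n) → Fin (suc m) → Fin n
  cons x f zero    = x
  cons x f (suc i) = f i

_⊑?_ : ∀ {m n} (F : Graph m) (G : Graph n) → Dec (F ⊑ G)
F ⊑? G = functionSearch {Q = IsEmbedding F G}
  (λ f → map′ (λ h {u} {v} → h u v) (λ h u v → h) (Fin.all? λ u → Fin.all? λ v → (f u Fin.≟ f v) →-dec (u Fin.≟ v))
         ×-dec Fin.all? (λ u → Fin.all? λ v → T? (adj F u v) →-dec T? (adj G (f u) (f v))))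
  (λ {f} {g} eq (inj , h) → (λ {u} {v} e → inj (trans (eq u) (trans e (sym (eq v))))) ,
                   λ u v a → subst₂ (Adjacent G) (eq u) (eq v) (h u v a))

-- How the path lengths decide the kind of the remainder

parity : ∀ ℓ → ℓ ≡ 2 * ⌊ ℓ /2⌋ ⊎ ℓ ≡ odd ⌊ ℓ /2⌋
parity 0             = inj₁ refl
parity 1             = inj₂ refl
parity (suc (suc ℓ)) with parity ℓ
... | inj₁ eq = inj₁ (cong suc (trans (cong suc eq) (sym (+-suc ⌊ ℓ /2⌋ _))))
... | inj₂ eq = inj₂ (cong suc (trans (cong suc eq) (cong suc (sym (+-suc ⌊ ℓ /2⌋ _)))))

odd-of : ∀ {ℓ} → 2 ∤ ℓ → ℓ ≡ odd ⌊ ℓ /2⌋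
odd-of {ℓ} 2∤ℓ = [ (λ eq → contradiction (divides ⌊ ℓ /2⌋ (trans eq (*-comm 2 ⌊ ℓ /2⌋))) 2∤ℓ) , id ]′ (parity ℓ)

-- The induction peels paths off the front and stops at the last two, so the length that decides the
-- kind has to be moved there.
bring-last : ∀ {x : ℕ} {ls} → x ∈ ls → 2 ≤ length ls → ∃[ rest ] ∃[ q ] ls ↭ rest ++ x ∷ q ∷ [] × q ∈ ls
bring-last {x} x∈ 2≤ with ∈-∃++ x∈
... | ys , zs , refl = build (ys ++ zs) refl
  where
  build : ∀ ws → ws ≡ ys ++ zs → ∃[ rest ] ∃[ q ] ys ++ x ∷ zs ↭ rest ++ x ∷ q ∷ [] × q ∈ ys ++ x ∷ zs
  build [] eq = contradiction (≤-trans 2≤ (≤-reflexive (trans (Perm.↭-length (Perm.shift x ys zs)) (cong (suc ∘ length) (sym eq))))) λ { (s≤s ()) }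
  build (q ∷ rest) eq = rest , q , perm , Perm.∈-resp-↭ (↭-sym perm) (∈-++⁺ʳ rest (there (here refl)))
    where
    perm : ys ++ x ∷ zs ↭ rest ++ x ∷ q ∷ []
    perm = ↭-trans (Perm.shift x ys zs) (↭-trans (Perm.↭-reflexive (cong (x ∷_) (sym eq))) (Perm.++-comm (x ∷ q ∷ []) rest))

Evidence : ∀ {r} → Kind → Vector ℕ r → Set
Evidence bare  ℓ = ∃[ j ] 2 ∣ ℓ j
Evidence edge  ℓ = (∀ j → 2 ∤ ℓ j) × (∃[ j ] ℓ j ≢ 3)
Evidence match ℓ = ∀ j → ℓ j ≡ 3

record Classified {r} (ℓ : Vector ℕ r) : Set where
  field
    kind     : Kind
    evidence : Evidence kind ℓ
    paths    : ∀ j → PathFor kind (ℓ j)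
    rest     : List ℕ
    {p q}    : ℕ
    perm     : tabulate ℓ ↭ rest ++ p ∷ q ∷ []
    lengths  : Lengths kind p q

∈-tabulate : ∀ {r} (ℓ : Vector ℕ r) {x} → x ∈ tabulate ℓ → ∃[ j ] ℓ j ≡ x
∈-tabulate {suc r} ℓ (here eq)  = zero , sym eq
∈-tabulate {suc r} ℓ (there x∈) = let j , eq = ∈-tabulate (ℓ ∘ suc) x∈ in suc j , eq

tabulate-∈ : ∀ {r} (ℓ : Vector ℕ r) j → ℓ j ∈ tabulate ℓ
tabulate-∈ ℓ zero    = here refl
tabulate-∈ ℓ (suc j) = there (tabulate-∈ (ℓ ∘ suc) j)

-- The deciding length `p` is an even one if there is any, otherwise one different from 3 if there
-- is any; its companion `q` may be any other entry of the list.
classify : ∀ {r} (ℓ : Vector ℕ r) → 2 ≤ r → (∀ j → 2 ≤ ℓ j) → Classified ℓ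
classify {r} ℓ 2≤r 2≤ℓ with Fin.any? (λ j → 2 ∣? ℓ j) | Fin.any? (λ j → ¬? (ℓ j ℕ.≟ 3))
... | yes (j , even) | _ =
  let rest , q , perm , q∈ = bring-last (tabulate-∈ ℓ j) long ; i , q≡ = ∈-tabulate ℓ q∈ in
  record { kind = bare ; evidence = j , even ; paths = λ j → ≤-trans (s≤s z≤n) (2≤ℓ j) ; rest = rest ; perm = perm
         ; lengths = even-length (ℓ j) q even (2≤ℓ j) (≤-trans (2≤ℓ i) (≤-reflexive q≡)) }
  where
  long : 2 ≤ length (tabulate ℓ)
  long = ≤-trans 2≤r (≤-reflexive (sym (List.length-tabulate ℓ)))
  even-length : ∀ p q → 2 ∣ p → 2 ≤ p → 2 ≤ q → Lengths bare p q
  even-length .(zero * 2)  q (divides zero refl)    () _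
  even-length .(suc k * 2) q (divides (suc k) refl) _ 2≤q = subst (λ p → Lengths bare p q) (*-comm 2 (suc k)) (even-any k 2≤q)
... | no all-odd | yes (j , ≢3) =
  let rest , q , perm , q∈ = bring-last (tabulate-∈ ℓ j) long ; i , q≡ = ∈-tabulate ℓ q∈ in
  record { kind = edge ; evidence = (λ j 2∣ℓ → all-odd (j , 2∣ℓ)) , j , ≢3 ; paths = λ j → ⌊ ℓ j /2⌋ , oddness j ; rest = rest ; perm = perm
         ; lengths = odd-lengths (ℓ j) q ⌊ ℓ j /2⌋ ⌊ ℓ i /2⌋ (oddness j) (trans (sym q≡) (oddness i)) (2≤ℓ j) (≤-trans (2≤ℓ i) (≤-reflexive q≡)) ≢3 }
  where
  long : 2 ≤ length (tabulate ℓ)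
  long = ≤-trans 2≤r (≤-reflexive (sym (List.length-tabulate ℓ)))
  oddness : ∀ j → ℓ j ≡ odd ⌊ ℓ j /2⌋
  oddness j = odd-of (λ 2∣ℓ → all-odd (j , 2∣ℓ))
  odd-lengths : ∀ p q c d → p ≡ odd c → q ≡ odd d → 2 ≤ p → 2 ≤ q → p ≢ 3 → Lengths edge p q
  odd-lengths _ _ zero          d       refl refl (s≤s ()) _ _
  odd-lengths _ _ (suc zero)    d       refl refl _ _ ≢3 = contradiction refl ≢3
  odd-lengths _ _ (suc (suc c)) zero    refl refl _ (s≤s ()) _
  odd-lengths _ _ (suc (suc c)) (suc d) refl refl _ _ _ = odd-odd c d
... | no _ | no all-three =
  let rest , q , perm , q∈ = bring-last (tabulate-∈ ℓ (first r 2≤r)) long ; i , q≡ = ∈-tabulate ℓ q∈ in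
  record { kind = match ; evidence = three′ ; paths = three′ ; rest = rest ; perm = perm
         ; lengths = subst₂ (Lengths match) (sym (three′ (first r 2≤r))) (trans (sym (three′ i)) q≡) three }
  where
  long : 2 ≤ length (tabulate ℓ)
  long = ≤-trans 2≤r (≤-reflexive (sym (List.length-tabulate ℓ)))
  three′ : ∀ j → ℓ j ≡ 3
  three′ j with ℓ j ℕ.≟ 3
  ... | yes eq = eq
  ... | no ≢3  = contradiction (j , ≢3) all-three
  first : ∀ r → 2 ≤ r → Fin r
  first (suc r) _ = zero

total-halves : ∀ {r} (ℓ : Vector ℕ r) → total (halves (tabulate ℓ)) ≡ sum (λ j → ⌊ ℓ j /2⌋)
total-halves {zero}  ℓ = refl
total-halves {suc r} ℓ = cong (⌊ ℓ zero /2⌋ +_) (total-halves (ℓ ∘ suc))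

module StarsAndPaths {t r : ℕ} (a : Vector ℕ t) (ℓ : Vector ℕ r) where

  S = ⋃ (λ i → star (a i))
  L = ⋃ (λ j → P (ℓ j))
  ls = tabulate ℓ
  starSize = sum (λ i → suc (a i))
  -- Whatever may already be occupied when a star is grown: the centres, the linear forest and the
  -- other stars.
  threshold = t + total ls + starSize

  -- At most `t - 1` vertices of high degree and a rest without `L` give the coefficient
  -- `2 * (t - 1) + (2 * h + 1)`, one below the required `2 * (t + h)`. So `n` is bounded by the
  -- constants involved, the last of which is for the copy of `S`.
  fewC : ℕ → ℕ
  fewC h = edgeC (t + h) + ubC (halves ls) + 2 * threshold * starSize

module Dichotomy {t r : ℕ} (a : Vector ℕ t) (ℓ : Vector ℕ r) {n : ℕ} (G : Graph n) where
  open Embeddings G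
  open StarsAndPaths a ℓ

  many-centres : ∀ T → Free (S ∪ L) G → length T ≡ t → Unique T → (∀ {c} → c ∈ T → threshold ≤ deg full c) → ¬ HasForest (full ∖ T) ls
  many-centres T free len uniq big (U , f) = free (proj₁ whole , proj₁ (proj₂ whole))
    where
    apart : Disjoint T U
    apart (v∈T , v∈U) = Inside-∖-disjoint full T (forest-inside f) (v∈U , v∈T)
    whole = embeds-∪ {F₁ = S} {L} {Q₁ = _∉ U} {_∈ U}
      (stars-embed a T U len uniq apart (λ c∈ → ≤-trans (≤-reflexive (cong₂ (λ x y → x + y + starSize) len (forest-length f))) (big c∈)))
      (forest-embeds ℓ f) (λ v∉ v∈ → v∉ v∈)

  high : VSet n
  high v = does (threshold ≤? deg full v)

  -- High degree only makes the rest `L`-free. That the centres are adjacent to all other vertices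
  -- follows afterwards, from the count in `peelL`.
  dominated : ∀ {κ m h} → Free (S ∪ L) G → t ≤ # high → (∀ X → n ≤ t + # X → ¬ HasForest X ls → Rich κ h m X → Struct κ h X) →
    Rich κ (t + h) m full → Struct κ (t + h) full
  dominated {κ} {m} {h} free many rec rich = subst (λ k → Struct κ (k + h) full) len
    (peelL centres full uniq (All.tabulate (λ _ → refl)) (subst (λ k → Rich κ (k + h) m full) (sym len) rich)
      (rec (full ∖ centres) enough (many-centres centres free len uniq (λ c∈ → does⁻ (threshold ≤? _) (All.lookup (All.take⁺ t (elems-inside high)) c∈)))))
    where
    centres = take t (elems high)
    len : length centres ≡ t
    len = trans (List.length-take t (elems high)) (m≤n⇒m⊓n≡m (≤-trans many (≤-reflexive (#-elems high))))
    uniq : Unique centres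
    uniq = Unique.take⁺ t (elems-unique high)
    enough : n ≤ t + # (full ∖ centres)
    enough = ≤-reflexive (trans (sym #full) (trans (#-removeL full centres uniq (All.tabulate (λ _ → refl))) (cong (_+ # (full ∖ centres)) len)))

  -- A copy of S and the few vertices of high degree meet only boundedly many of
  -- the other edges, which are therefore too many to avoid L.
  few-centres : ∀ {κ m h} → Free (S ∪ L) G → S ⊑ G → (∀ j → 2 ≤ ℓ j) → suc h ≡ total (halves ls) → # high < t → Rich κ (t + h) m full → n ≤ fewC h
  few-centres {κ} {m} {h} free (f , f-emb) 2≤ℓ size few rich =
    lin 0 (rich-dense {κ} {t + h} {m} rich ⊕ e2-removeL Ds full (elems-unique high) (All.tabulate (λ _ → refl)) ⊕ *-monoʳ-≤ 2 cost₁ ⊕ *-monoʳ-≤ (2 * n) few ⊕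
           e2-removeL ws X₁ (elems-unique (X₁ ∩ im)) image-inside ⊕ *-monoʳ-≤ 2 cost₂ ⊕
           subst (λ b → e2 X₂ + 1 * # X₂ ≤ 2 * b * # X₂ + ubC (halves ls)) (sym size) sparse ⊕ *-monoʳ-≤ (suc (2 * h)) (#≤n X₂) ⊕ *-monoʳ-≤ (2 * (t + h)) (≤-reflexive (sym (#full {n}))))
      (regroup n t h (# (full {n})) (e2 full) (edgeC (t + h)) (ubC (halves ls)) (lsum (deg full) Ds) (# high) (e2 X₁) (e2 X₂) (lsum (deg X₁) ws) (threshold * starSize) threshold starSize (# X₂))
    where
    Ds = elems high
    X₁ = full ∖ Ds
    im : VSet n
    im v = does (Fin.any? (λ u → f u Fin.≟ v))
    ws = elems (X₁ ∩ im)
    X₂ = X₁ ∖ ws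
    image-inside : Inside X₁ ws
    image-inside = All.map (λ {v} h → proj₁ (∧-true⁻ (X₁ v) h)) (elems-inside (X₁ ∩ im))
    ws≤ : length ws ≤ starSize
    ws≤ = ≤-trans (unique-⊆-length (elems-unique (X₁ ∩ im)) in-image) (≤-reflexive (List.length-tabulate f))
      where
      in-image : ∀ {v} → v ∈ ws → v ∈ tabulate f
      in-image {v} v∈ = let u , eq = does⁻ (Fin.any? (λ u → f u Fin.≟ v)) (proj₂ (∧-true⁻ (X₁ v) (∈-elems⁻ (X₁ ∩ im) v∈))) in
        subst (_∈ tabulate f) eq (∈-tabulate⁺ u)
    cost₁ : lsum (deg full) Ds ≤ n * # high
    cost₁ = ≤-trans (lsum-mono {g = λ _ → n} Ds (All.tabulate (λ {v} _ → ≤-trans (deg≤# full v) (≤-reflexive #full))))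
      (≤-reflexive (trans (lsum-const n Ds) (cong (n *_) (sym (#-elems high)))))
    cost₂ : lsum (deg X₁) ws ≤ threshold * starSize
    cost₂ = ≤-trans (lsum-mono {g = λ _ → threshold} ws (All.map (λ {v} X₁v → ≤-trans (deg-⊆ (∖⊆ full Ds) v) (low v X₁v)) image-inside))
      (≤-trans (≤-reflexive (lsum-const threshold ws)) (*-monoʳ-≤ threshold ws≤))
      where
      low : ∀ v → X₁ v ≡ true → deg full v ≤ threshold
      low v X₁v with threshold ≤? deg full v
      ... | yes le = contradiction (∈-elems⁺ high (dec-true (threshold ≤? deg full v) le)) (proj₂ (∈∖⁻ full Ds X₁v))
      ... | no ¬le = <⇒≤ (≰⇒> ¬le)
    no-forest : ¬ HasForest X₂ ls
    no-forest (U , φ) = free (proj₁ whole , proj₁ (proj₂ whole))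
      where
      outside : ∀ {v} → im v ≡ true → v ∈ U → ⊥
      outside {v} imv v∈U =
        let X₁v , v∉ws = ∈∖⁻ X₁ ws (All.lookup (forest-inside φ) v∈U) in v∉ws (∈-elems⁺ (X₁ ∩ im) (∧-true⁺ X₁v imv))
      whole = embeds-∪ {F₁ = S} {L} {Q₁ = λ v → im v ≡ true} {_∈ U}
        (f , f-emb , λ u → dec-true (Fin.any? (λ u′ → f u′ Fin.≟ f u)) (u , refl)) (forest-embeds ℓ φ) outside
    2≤ls : All (2 ≤_) ls
    2≤ls = All.tabulate⁺ 2≤ℓ
    sparse : e2 X₂ + 1 * # X₂ ≤ 2 * total (halves ls) * # X₂ + ubC (halves ls)
    sparse = upper-bound (halves ls) (All.map⁺ (All.map ⌊n/2⌋-mono 2≤ls)) X₂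
      (λ φ → no-forest (HasForest-shorten ls (All.map (≤-trans (s≤s z≤n)) 2≤ls) φ))
    regroup : ∀ n t h x e E C l d e₁ e₂ w c θ σ y →
      E + C + 2 * θ * σ + (2 * (t + h) * x + e + 2 * l + 2 * n * suc d + e₁ + 2 * w + (e₂ + 1 * y) + suc (2 * h) * y + 2 * (t + h) * n) ≡
      n + (e + E + (e₁ + 2 * l) + 2 * (n * d) + 2 * n * t + (e₂ + 2 * w) + 2 * (θ * σ) + (2 * suc h * y + C) + suc (2 * h) * n + 2 * (t + h) * x) + 0
    regroup = solve-∀

edges-transport : ∀ {N n k} {F : Graph k} (eq : N ≡ n) (H : Graph N) (G : Graph n) → Free F H → (∀ (H′ : Graph n) → Free F H′ → e H′ ≤ e G) → e H ≤ e G
edges-transport refl H G free max = max H free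

module _ {t r : ℕ} (a : Vector ℕ t) (ℓ : Vector ℕ r) (3≤a : ∀ i → 3 ≤ a i) (2≤ℓ : ∀ j → 2 ≤ ℓ j) (classified : Classified ℓ) where
  open StarsAndPaths a ℓ
  open Classified classified

  private
    h = hubSize rest p q
    s = t + h
    b = sum (λ j → ⌊ ℓ j /2⌋)

    2≤all : All (2 ≤_) (rest ++ p ∷ q ∷ [])
    2≤all = Perm.All-resp-↭ perm (All.tabulate⁺ 2≤ℓ)

    2≤p : 2 ≤ p
    2≤p = All.head (All.++⁻ʳ rest 2≤all)

    2≤q : 2 ≤ q
    2≤q = All.head (All.tail (All.++⁻ʳ rest 2≤all))

    size : suc h ≡ total (halves ls)
    size = trans (hubSize≡ rest p q 2≤p) (ListAction.sum-↭ (Perm.map⁺ ⌊_/2⌋ (↭-sym perm)))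

  b≡ : suc h ≡ b
  b≡ = trans size (total-halves ℓ)

  orderBound : ℕ
  orderBound = suc (fewC h) + extremalC rest p q + t

  extremal-structure : ∀ {n} m (G : Graph n) → n ≡ s + leftover-size kind m → orderBound ≤ n → EX n (S ∪ L) G → S ⊑ G →
    G ≅ (K s ∨ leftover kind m)
  extremal-structure {n} m G n≡ large (free , max) S⊑G = copy-≅ {M = K s ∨ leftover kind m} (copy-struct m (trans #full n≡) struct)
    where
    open Embeddings G
    open Dichotomy a ℓ G using (high; dominated; few-centres)
    lm = leftover-size kind m
    H = K s ∨ leftover kind m
    H≤G : e H ≤ e G
    H≤G = edges-transport {F = S ∪ L} (sym n≡) H G
      (extremal-free a ℓ s kind m 3≤a paths (≤-trans (≤-reflexive (sym (+-suc t h))) (+-monoʳ-≤ t (≤-reflexive b≡)))) max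
    rich : Rich kind s lm full
    rich = trans #full n≡ , (begin
      φ lm s + gap kind lm                                       ≤⟨ +-monoʳ-≤ (φ lm s) (leftover-rich kind m) ⟩
      φ lm s + (degree-sum (leftover kind m) + slack kind)       ≡⟨ sym (+-assoc (φ lm s) _ _) ⟩
      φ lm s + degree-sum (leftover kind m) + slack kind         ≡⟨ cong (_+ slack kind) (trans (sym (degree-sum-join s (leftover kind m))) (degree-sum-edges H)) ⟩
      2 * e H + slack kind                                       ≤⟨ +-monoˡ-≤ (slack kind) (*-monoʳ-≤ 2 H≤G) ⟩
      2 * e G + slack kind                                       ≡⟨ cong (_+ slack kind) (sym (trans (degree-sum-e2 G) (degree-sum-edges G))) ⟩
      e2 full + slack kind                                       ∎)
      where open ≤-Reasoning
    recurse : ∀ X → n ≤ t + # X → ¬ HasForest X ls → Rich kind h lm X → Struct kind h X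
    recurse X n≤ none = forest-extremal {m = lm} rest p q X lengths (All.++⁻ˡ rest 2≤all) 2≤p 2≤q
      (lin (suc (fewC h)) (large ⊕ n≤) (count (fewC h) (extremalC rest p q) t n (# X))) (λ φ → none (HasForest-↭ (↭-sym perm) φ))
      where
      count : ∀ f c t n x → x + (suc f + c + t + n) ≡ c + (n + (t + x)) + suc f
      count = solve-∀
    struct : Struct kind s full
    struct with t ≤? # high
    ... | yes many = dominated {m = lm} free many recurse rich
    ... | no few = contradiction
      (≤-trans (≤-trans (m≤m+n (suc (fewC h)) (extremalC rest p q + t)) (≤-reflexive (sym (+-assoc (suc (fewC h)) _ t)))) large)
      (≤⇒≯ (few-centres {kind} {lm} free S⊑G 2≤ℓ size (≰⇒> few) rich))

  Conclusion : ∀ {n} → Graph n → Set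
  Conclusion {n} G =
    ((∀ j → ℓ j ≡ 3) × G ≅ (K (t + b ∸ 1) ∨ matching (n ∸ t ∸ b + 1)))
    ⊎ ((∀ j → 2 ∤ ℓ j) × (∃[ j ] ℓ j ≢ 3) × G ≅ (K (t + b ∸ 1) ∨ (K 2 ∪ K̄ (n ∸ t ∸ b ∸ 1))))
    ⊎ ((∃[ j ] 2 ∣ ℓ j) × G ≅ (K (t + b ∸ 1) ∨ K̄ (n ∸ t ∸ b + 1)))

  conclusion : ∀ {n} (G : Graph n) → suc (suc (t + b)) ≤ n → (∀ m → n ≡ s + leftover-size kind m → G ≅ (K s ∨ leftover kind m)) →
    Conclusion G
  conclusion {n} G large iso = by-kind kind evidence iso
    where
    s≡ : s ≡ t + b ∸ 1
    s≡ = cong (_∸ 1) (trans (sym (+-suc t h)) (cong (t +_) b≡))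
    d = n ∸ t ∸ b
    d+ : d + (t + b) ≡ n
    d+ = trans (cong (_+ (t + b)) (∸-+-assoc n t b)) (m∸n+n≡m (≤-trans (≤-trans (n≤1+n _) (n≤1+n _)) large))
    n≡ : n ≡ s + (d + 1)
    n≡ = trans (sym d+) (trans (cong (λ c → d + (t + c)) (sym b≡)) (regroup d t h))
      where
      regroup : ∀ d t h → d + (t + suc h) ≡ t + h + (d + 1)
      regroup = solve-∀
    -- This keeps `d ∸ 1` from being truncated, so that the `d + 1` vertices outside the dominating
    -- ones split into an edge and `d ∸ 1` others.
    1≤d : 1 ≤ d
    1≤d = +-cancelʳ-≤ (t + b) 1 d (≤-trans (n≤1+n _) (≤-trans large (≤-reflexive (sym d+))))
    two : 2 + (d ∸ 1) ≡ d + 1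
    two = trans (cong suc (m+[n∸m]≡n 1≤d)) (+-comm 1 d)
    by-kind : ∀ κ → Evidence κ ℓ → (∀ m → n ≡ s + leftover-size κ m → G ≅ (K s ∨ leftover κ m)) →
      Conclusion G
    by-kind bare  ev iso = inj₂ (inj₂ (ev , subst (λ k → G ≅ (K k ∨ K̄ (d + 1))) s≡ (iso (d + 1) n≡)))
    by-kind edge  (all-odd , not-3) iso = inj₂ (inj₁ (all-odd , not-3 ,
      subst (λ k → G ≅ (K k ∨ (K 2 ∪ K̄ (d ∸ 1)))) s≡ (iso (d ∸ 1) (trans n≡ (cong (s +_) (sym two))))))
    by-kind match ev iso = inj₁ (ev , subst (λ k → G ≅ (K k ∨ matching (d + 1))) s≡ (iso (d + 1) n≡))

free-of-part : ∀ {m₁ m₂ n} (F₁ : Graph m₁) (F₂ : Graph m₂) {G : Graph n} → Free F₁ G → Free (F₁ ∪ F₂) G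
free-of-part F₁ F₂ {G} free (f , emb) = free (_ , embed-left {F₁ = F₁} {F₂} {G} emb)

theorem1p7 :
    ∀ (t r : ℕ) → t ≥ 1 → r ≥ 2 →
    ∀ (a : Vector ℕ t) (ℓ : Vector ℕ r) →
    a Preserves Fin._≤_ ⟶ _≥_ → (∀ i → a i ≥ 3) →
    ℓ Preserves Fin._≤_ ⟶ _≥_ → (∀ j → ℓ j ≥ 2) →
    let S = ⋃ (λ i → star (a i))
        F = S ∪ ⋃ (λ j → P (ℓ j))
        b = sum (λ j → ⌊ ℓ j /2⌋)
    in
    ∃[ n₀ ] ∀ n → n ≥ n₀ → ∀ (G : Graph n) → EX n F G →
      EX n S G
      ⊎ ((∀ j → ℓ j ≡ 3)
          × G ≅ (K (t + b ∸ 1) ∨ matching (n ∸ t ∸ b + 1)))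
      ⊎ ((∀ j → 2 ∤ ℓ j) × (∃[ j ] ℓ j ≢ 3)
          × G ≅ (K (t + b ∸ 1) ∨ (K 2 ∪ K̄ (n ∸ t ∸ b ∸ 1))))
      ⊎ ((∃[ j ] 2 ∣ ℓ j)
          × G ≅ (K (t + b ∸ 1) ∨ K̄ (n ∸ t ∸ b + 1)))
theorem1p7 t r _ r≥2 a ℓ _ 3≤a _ 2≤ℓ = N + suc (suc (t + b)) , decide
  where
  open StarsAndPaths a ℓ
  classified = classify ℓ r≥2 2≤ℓ
  N = orderBound a ℓ 3≤a 2≤ℓ classified
  b = sum (λ j → ⌊ ℓ j /2⌋)
  decide : ∀ n → n ≥ N + suc (suc (t + b)) → ∀ (G : Graph n) → EX n (S ∪ L) G →
    EX n S G ⊎ _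
  decide n large G ex@(free , max) with S ⊑? G
  -- `S`-free graphs are also free of the whole forest, so a graph that is extremal for the latter
  -- and lacks `S` is extremal for `S`.
  ... | no  S⋢G = inj₁ (S⋢G , λ H S-free → max H (free-of-part S L {H} S-free))
  ... | yes S⊑G = inj₂ (conclusion a ℓ 3≤a 2≤ℓ classified G (≤-trans (m≤n+m _ N) large)
        (λ m n≡ → extremal-structure a ℓ 3≤a 2≤ℓ classified m G n≡ (≤-trans (m≤m+n N _) large) ex S⊑G))
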